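{- There exist a constant $c$ and an algorithm that solves the Multi-Feedback Vertex Set problem (MFVS) in time $O^*(c^{hk\log k})$, where $h$ is the number of colors of the input edge-colored graph: given an edge-colored graph $G$ with $h$ colors and an integer $k$ (the parameter), the algorithm finds a vertex set of size at most $k$ that hits all monochromatic cycles of $G$, or correctly reports that none exists, in time $O^*(c^{hk\log k})$.
   Context: An edge-colored graph with $h$ colors is a finite simple undirected graph in which each edge is assigned one of $h$ colors. A cycle is monochromatic if all its edges have the same color. A vertex set $S$ hits a cycle if it contains at least one vertex of the cycle. Multi-Feedback Vertex Set (MFVS): given an edge-colored graph $G$ and a parameter $k$, find a vertex set of size at most $k$ that hits all monochromatic cycles of $G$ (or report that none exists). The $O^*$-notation suppresses factors polynomial in the input size. Convention: $k\log k$ is read as $0$ when $k=0$. -}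

module Defs where

open import Data.Bool.Base using (Bool; true; false)
open import Data.Fin.Base using (Fin; toℕ)
import Data.Fin.Properties as Fin
open import Data.Fin.Subset using (Subset; ∣_∣) renaming (_∈_ to _∈ₛ_)
open import Data.List.Base using (List; []; _∷_; _∷ʳ_; map; length; filter; mapMaybe; cartesianProduct; allFin)
open import Data.List.Membership.Propositional using (_∈_)
open import Data.List.Relation.Unary.Linked using (Linked)
open import Data.List.Relation.Unary.Unique.Propositional using (Unique)
open import Data.Maybe.Base as Maybe using (Maybe; just; nothing)
open import Data.Nat.Base using (ℕ; suc; _+_; _*_; _^_; _≤_)
open import Data.Nat.Binary.Base using (ℕᵇ; 2[1+_]; 1+[2_]; fromℕ) renaming (zero to 0ᵇ)
open import Data.Nat.Logarithm using (⌊log₂_⌋)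
open import Data.Product.Base using (_×_; _,_; ∃-syntax)
open import Data.Vec.Base as Vec using (Vec; []; _∷_; lookup)
open import Relation.Binary.PropositionalEquality.Core using (_≡_; refl)
open import Relation.Nullary.Negation.Core using (¬_)

------------------------------------------------------------------------
-- Edge-colored graphs and monochromatic cycles

-- color u v ≡ just c : there is an edge uv, and its color is c.
-- color u v ≡ nothing : u and v are not adjacent.
record EdgeColoredGraph (h : ℕ) : Set where
  field
    n         : ℕ
    color     : Fin n → Fin n → Maybe (Fin h)
    symmetric : ∀ u v → color u v ≡ color v u
    loopless  : ∀ v → color v v ≡ nothing

module _ {h : ℕ} (G : EdgeColoredGraph h) where
  open EdgeColoredGraph G

  Vertex : Set
  Vertex = Fin n

  ColoredEdge : Fin h → Vertex → Vertex → Set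
  ColoredEdge c u v = color u v ≡ just c

  Edge : Vertex → Vertex → Set
  Edge u v = ∃[ c ] ColoredEdge c u v

  -- The cycle v, w₁, …, wₗ, v, where l ≥ 2.
  record Cycle : Set where
    field
      start    : Vertex
      rest     : List Vertex
      long     : 2 ≤ length rest
      distinct : Unique (start ∷ rest)

    vertices : List Vertex
    vertices = start ∷ rest

    closedWalk : List Vertex
    closedWalk = vertices ∷ʳ start

    field
      adjacent : Linked Edge closedWalk

  Monochromatic : Cycle → Set
  Monochromatic C = ∃[ c ] Linked (ColoredEdge c) (Cycle.closedWalk C)

  Hits : Subset n → Cycle → Set
  Hits S C = ∃[ v ] (v ∈ₛ S × v ∈ Cycle.vertices C)

  IsMFVS : ℕ → Subset n → Set
  IsMFVS k S = ∣ S ∣ ≤ k × (∀ C → Monochromatic C → Hits S C)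

  -- An answer is either a vertex set or the report that there is none.
  CorrectAnswer : ℕ → Maybe (Subset n) → Set
  CorrectAnswer k (just S) = IsMFVS k S
  CorrectAnswer k nothing  = ∀ S → ¬ IsMFVS k S

------------------------------------------------------------------------
-- Model of computation
--
-- A first-order call-by-value functional language on binary trees, in
-- the style of the languages F and WHILE of N. D. Jones, "Computability
-- and Complexity from a Programming Perspective" (MIT Press, 1997).
-- A program is a finite table of mutually recursive unary functions.
-- Evaluating any syntax node costs one step. Trees are never copied by
-- an implementation with pointers, and environments have size bounded
-- in terms of the program, so each step is a constant number of pointer
-- operations on a random access machine; the step count is thus
-- polynomially related to running time on RAMs and Turing machines.

data Tree : Set where
  leaf : Tree
  node : Tree → Tree → Tree

size : Tree → ℕ
size leaf       = 1
size (node x y) = suc (size x + size y)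

-- m is the number of functions that can be called, n the number of
-- variables in scope (de Bruijn indices).
data Expr (m n : ℕ) : Set where
  var   : Fin n → Expr m n
  leaf  : Expr m n
  node  : Expr m n → Expr m n → Expr m n
  let′  : Expr m n → Expr m (1 + n) → Expr m n
  -- In the branch for node x y, variable 0 is x and variable 1 is y.
  case  : Expr m n → Expr m n → Expr m (2 + n) → Expr m n
  call  : Fin m → Expr m n → Expr m n

record Program : Set where
  field
    #functions : ℕ
    body       : Fin #functions → Expr #functions 1
    main       : Expr #functions 1

module Semantics (P : Program) where
  open Program P

  infix 4 _⊢_⇓_[_]

  -- ρ ⊢ e ⇓ x [ t ] : in environment ρ, the expression e evaluates to x
  -- in t steps.
  data _⊢_⇓_[_] {n : ℕ} (ρ : Vec Tree n) : Expr #functions n → Tree → ℕ → Set where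
    var : ∀ i → ρ ⊢ var i ⇓ lookup ρ i [ 1 ]

    leaf : ρ ⊢ leaf ⇓ leaf [ 1 ]

    node : ∀ {e₁ e₂ x y t₁ t₂} →
           ρ ⊢ e₁ ⇓ x [ t₁ ] →
           ρ ⊢ e₂ ⇓ y [ t₂ ] →
           ρ ⊢ node e₁ e₂ ⇓ node x y [ suc (t₁ + t₂) ]

    let′ : ∀ {e₁ e₂ x y t₁ t₂} →
           ρ ⊢ e₁ ⇓ x [ t₁ ] →
           (x ∷ ρ) ⊢ e₂ ⇓ y [ t₂ ] →
           ρ ⊢ let′ e₁ e₂ ⇓ y [ suc (t₁ + t₂) ]

    case-leaf : ∀ {e e₁ e₂ z t₁ t₂} →
                ρ ⊢ e ⇓ leaf [ t₁ ] →
                ρ ⊢ e₁ ⇓ z [ t₂ ] →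
                ρ ⊢ case e e₁ e₂ ⇓ z [ suc (t₁ + t₂) ]

    case-node : ∀ {e e₁ e₂ x y z t₁ t₂} →
                ρ ⊢ e ⇓ node x y [ t₁ ] →
                (x ∷ y ∷ ρ) ⊢ e₂ ⇓ z [ t₂ ] →
                ρ ⊢ case e e₁ e₂ ⇓ z [ suc (t₁ + t₂) ]

    call : ∀ {f e x y t₁ t₂} →
           ρ ⊢ e ⇓ x [ t₁ ] →
           (x ∷ []) ⊢ body f ⇓ y [ t₂ ] →
           ρ ⊢ call f e ⇓ y [ suc (t₁ + t₂) ]

  deterministic : ∀ {n} {ρ : Vec Tree n} {e x y s t} →
                  ρ ⊢ e ⇓ x [ s ] → ρ ⊢ e ⇓ y [ t ] → x ≡ y × s ≡ t
  deterministic (var i) (var .i) = refl , refl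
  deterministic leaf leaf = refl , refl
  deterministic (node p q) (node p′ q′)
    with refl , refl ← deterministic p p′
       | refl , refl ← deterministic q q′ = refl , refl
  deterministic (let′ p q) (let′ p′ q′)
    with refl , refl ← deterministic p p′
    with refl , refl ← deterministic q q′ = refl , refl
  deterministic (case-leaf p q) (case-leaf p′ q′)
    with refl , refl ← deterministic p p′
       | refl , refl ← deterministic q q′ = refl , refl
  deterministic (case-leaf p q) (case-node p′ q′)
    with () , _ ← deterministic p p′
  deterministic (case-node p q) (case-leaf p′ q′)
    with () , _ ← deterministic p p′
  deterministic (case-node p q) (case-node p′ q′)
    with refl , refl ← deterministic p p′
    with refl , refl ← deterministic q q′ = refl , refl
  deterministic (call p q) (call p′ q′)
    with refl , refl ← deterministic p p′
    with refl , refl ← deterministic q q′ = refl , refl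

-- P halts on input x with output y after exactly t steps.
Runs : Program → Tree → Tree → ℕ → Set
Runs P x y t = (x ∷ []) ⊢ Program.main P ⇓ y [ t ]
  where open Semantics P

------------------------------------------------------------------------
-- Encodings of inputs and answers as trees

encodeBool : Bool → Tree
encodeBool false = leaf
encodeBool true  = node leaf leaf

encodeList : List Tree → Tree
encodeList []       = leaf
encodeList (x ∷ xs) = node x (encodeList xs)

-- Bijective base 2, least significant digit first, so that the size is
-- logarithmic in the number.
encodeBin : ℕᵇ → Tree
encodeBin 0ᵇ        = leaf
encodeBin 2[1+ b ]  = node (encodeBool false) (encodeBin b)
encodeBin 1+[2 b ]  = node (encodeBool true) (encodeBin b)

encodeℕ : ℕ → Tree
encodeℕ n = encodeBin (fromℕ n)

encodeFin : ∀ {n} → Fin n → Tree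
encodeFin i = encodeℕ (toℕ i)

module _ {h : ℕ} (G : EdgeColoredGraph h) where
  open EdgeColoredGraph G

  -- Every undirected edge occurs once, with its smaller endpoint first.
  coloredEdges : List (Fin n × Fin n × Fin h)
  coloredEdges =
    mapMaybe (λ (u , v) → Maybe.map (λ c → u , v , c) (color u v))
      (filter (λ (u , v) → u Fin.<? v) (cartesianProduct (allFin n) (allFin n)))

  -- The number of colors, the list of vertices, the list of edges.
  -- Since all vertices are listed, the size is at least n.
  encodeGraph : Tree
  encodeGraph =
    node (encodeℕ h)
      (node (encodeList (map encodeFin (allFin n)))
            (encodeList (map (λ (u , v , c) → node (encodeFin u) (node (encodeFin v) (encodeFin c)))
                             coloredEdges)))

  encodeInstance : ℕ → Tree
  encodeInstance k = node encodeGraph (encodeℕ k)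

-- A vertex set is output as its characteristic vector.
encodeAnswer : ∀ {n} → Maybe (Subset n) → Tree
encodeAnswer nothing  = leaf
encodeAnswer (just S) = node leaf (encodeList (map encodeBool (Vec.toList S)))

------------------------------------------------------------------------
-- The time bound

-- ⌊ h k log₂ k ⌋, using h k log₂ k = log₂ (k ^ (h k)). For k = 0 it is
-- log₂ 1 = 0, which agrees with reading k log k as 0. Rounding down
-- only changes c ^ (h k log₂ k) by a factor between 1 and c.
hklogk : ℕ → ℕ → ℕ
hklogk h k = ⌊log₂ (k ^ (h * k)) ⌋

{-# OPTIONS --safe #-}
-- The algorithm handles the colors one after the other and keeps a list of
-- all states that may still lead to a solution. A state assigns to each of
-- the k unknown solution vertices (slots) a set of possible values. For one
-- color, let Y be the 2-core of the vertices not yet dealt with, κ the number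
-- of slots not yet used for this color, e(v) = deg(v) - 2 and E = Σ e(v).
-- A solution S within Y satisfies E ≤ Σ 2 (1 + e(v)) over v ∈ S, because
-- Y ∖ S spans a forest. If E > 2κ, then some solution vertex has
-- E ≤ 2κ (1 + e(v)), and at most 4κ vertices of Y do. If E ≤ 2κ, then a
-- maximal path contains a cycle, hence a solution vertex, and it splits into
-- at most 4κ + 1 pieces that are single vertices or runs of vertices of
-- degree 2. In both cases a cycle of Y that meets a candidate contains all of
-- it, so the state can be refined by intersecting one slot with one candidate,
-- which is then deleted from Y. Each color uses each slot at most once, which
-- bounds the number of states. One solution vertex is guessed beforehand, so
-- that for k = 1 there is no branching at all.
module Submission where

open import Data.Bool.Base using (Bool; T; _∧_; _∨_; false; if_then_else_; not; true)
open import Data.Empty using (⊥; ⊥-elim)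
open import Data.Fin.Base as Fin using (Fin; _↑ʳ_; _↑ˡ_; fromℕ<; splitAt; suc; toℕ; zero)
open import Data.Fin.Patterns
open import Data.Fin.Properties as Fin using (splitAt-↑ʳ; splitAt-↑ˡ; toℕ-fromℕ<; toℕ-injective; toℕ<n)
open import Data.Fin.Subset using (Subset; ∣_∣) renaming (_∈_ to _∈ₛ_)
open import Data.Fin.Subset.Properties using () renaming (_∈?_ to _∈ₛ?_)
open import Data.List.Base using (List; []; [_]; _++_; _∷_; _∷ʳ_; allFin; cartesianProduct; concatMap; drop; filter; foldr; length; map; tabulate; take; upTo)
import Data.List.Membership.DecPropositional as DecMembership
open import Data.List.Membership.Propositional using (_∈_; _∉_; find; lose)
open import Data.List.Membership.Propositional.Properties using (∈-++⁺ʳ; ∈-++⁺ˡ; ∈-++⁻; ∈-allFin; ∈-cartesianProduct⁺; ∈-concatMap⁺; ∈-concatMap⁻; ∈-filter⁺; ∈-filter⁻; ∈-length; ∈-map⁺; ∈-map⁻; ∈-upTo⁺)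
open import Data.List.Properties using (filter-all; filter-notAll; length-++; length-filter; length-map; length-tabulate; length-upTo; map-cong-local; map-id; map-tabulate; map-∘)
open import Data.List.Relation.Binary.Subset.Propositional using (_⊆_)
open import Data.List.Relation.Unary.All as All using (All; []; _∷_; all?)
open import Data.List.Relation.Unary.All.Properties as All using (All¬⇒¬Any; ¬All⇒Any¬; ¬Any⇒All¬)
open import Data.List.Relation.Unary.AllPairs using ([]; _∷_)
open import Data.List.Relation.Unary.Any as Any using (Any; any?; here; there)
open import Data.List.Relation.Unary.Any.Properties as Any using (mapMaybe⁺)
open import Data.List.Relation.Unary.Linked as Linked using (Linked; [-]; []; _∷_)
open import Data.List.Relation.Unary.Unique.Propositional using (Unique)
open import Data.List.Relation.Unary.Unique.Propositional.Properties using (allFin⁺; drop⁺; filter⁺; map⁺)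
open import Data.Maybe.Base as Maybe using (Maybe; just; nothing)
open import Data.Maybe.Properties using (≡-dec)
import Data.Maybe.Relation.Unary.All as MAll
import Data.Maybe.Relation.Unary.Any as MAny
open import Data.Nat.Base
open import Data.Nat.Binary.Base using (1+[2_]; 2[1+_]; fromℕ; ℕᵇ) renaming (toℕ to toℕᵇ; zero to 0ᵇ)
open import Data.Nat.Binary.Properties using (toℕ-fromℕ)
open import Data.Nat.Logarithm using (⌊log₂[2^n]⌋≡n; ⌊log₂_⌋; ⌊log₂⌋-mono-≤)
open import Data.Nat.Properties
open import Data.Nat.Solver using (module +-*-Solver)
open import Data.Product.Base using (_,_; _×_; proj₁; proj₂; ∃-syntax)
open import Data.Sum.Base using ([_,_]′; _⊎_; inj₁; inj₂)
open import Data.Unit.Base using (tt)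
open import Data.Vec.Base as Vec using (Vec; []; _∷_; lookup)
open import Data.Vec.Properties using ([]=⇒lookup; lookup⇒[]=; lookup∘tabulate)
open import Data.Vec.Relation.Unary.All as VAll using ([]; _∷_)
open import Defs
open import Function.Base using (_∘_; id)
open import Function.Bundles using (mk⇔)
open import Relation.Binary.Definitions using (Decidable; DecidableEquality; tri<; tri>; tri≈)
open import Relation.Binary.PropositionalEquality using (_≡_; _≢_; cong; cong₂; module ≡-Reasoning; refl; subst; sym; trans)
open import Relation.Nullary using (Dec; contradiction; does; no; yes; ¬?; ¬_)
open import Relation.Nullary.Decidable using (_×-dec_; _⊎-dec_; dec-false; dec-true; decidable-stable; does-⇔; map′)
import Relation.Unary as Unary

-- Two demands shape the proof. At k = 1 the exponent `hklogk` vanishes, so the number of states has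
-- to be polynomial there. An expansion yields at most (1 + 4κ)κ ≤ (1 + κ)^4 states, and the guessed
-- vertex brings 1 + κ down to at most k whenever k > 0; hence the count is a power of k itself and
-- not of k + 1 or 4k. Moreover, the time is the step count of a concrete program. The algorithm is
-- therefore written in a small language where polynomial time can be read off the shape of an
-- expression; only the loops over colors and over slots fall outside, and an invariant on the
-- number of states bounds their cost. Both `h` and `k` are given in binary and may be exponential
-- in the input size. Hence only colors of actual edges are treated, and there are never more slots
-- than vertices. Soundness speaks of all assignments of values to slots, whereas completeness
-- follows the one assignment that comes from a given solution. So a slot may stay undecided inside
-- a candidate.

-- A total language on trees read as lists

ifᵗ : Tree → Tree → Tree → Tree
ifᵗ leaf       x y = y
ifᵗ (node _ _) x y = x

matchᵗ : Tree → Tree → (Tree → Tree → Tree) → Tree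
matchᵗ leaf       z f = z
matchᵗ (node x y) z f = f x y

appendᵗ : Tree → Tree → Tree
appendᵗ leaf       z = z
appendᵗ (node x y) z = node x (appendᵗ y z)

forᵗ : (Tree → Tree) → Tree → Tree
forᵗ f leaf       = leaf
forᵗ f (node x t) = appendᵗ (f x) (forᵗ f t)

foldᵗ : (Tree → Tree → Tree) → Tree → Tree → Tree
foldᵗ f z leaf       = z
foldᵗ f z (node x t) = f x (foldᵗ f z t)

∥_∥ : ∀ {n} → Vec Tree n → ℕ
∥ [] ∥    = 0
∥ x ∷ ρ ∥ = size x + ∥ ρ ∥

-- Without such a demand a fold could square its accumulator at every step. The bound is required
-- for every `l`, so it also covers the tails of a list, whose folds are the intermediate
-- accumulators.
FoldBounded : ∀ {n} → (Vec Tree n → Tree) → (Vec Tree (2 + n) → Tree) → Set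
FoldBounded z f =
  ∃[ q ] ∀ ρ l → size (foldᵗ (λ x a → f (x ∷ a ∷ ρ)) (z ρ) l) ≤ (2 + (∥ ρ ∥ + size l)) ^ q

-- A total language on trees read as lists: for is concatMap, fold is
-- foldr. In an expression with flag true every fold carries a proof that
-- its result has polynomial size, so that by structural induction the
-- running time is polynomial as well.
data Exp : Bool → ℕ → Set
⟦_⟧ : ∀ {b n} → Exp b n → Vec Tree n → Tree

data Exp where
  arg   : ∀ {b n} → Fin n → Exp b n
  nil   : ∀ {b n} → Exp b n
  cons  : ∀ {b n} → Exp b n → Exp b n → Exp b n
  bind  : ∀ {b n} → Exp b n → Exp b (1 + n) → Exp b n
  match : ∀ {b n} → Exp b n → Exp b n → Exp b (2 + n) → Exp b n
  ifte  : ∀ {b n} → Exp b n → Exp b n → Exp b n → Exp b n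
  app   : ∀ {b m n} → Exp true m → Vec (Exp b n) m → Exp b n
  for   : ∀ {b n} → Exp b n → Exp b (1 + n) → Exp b n
  fold  : ∀ {b n} (xs z : Exp b n) (e : Exp b (2 + n)) →
          (T b → FoldBounded ⟦ z ⟧ ⟦ e ⟧) → Exp b n

⟦_⟧* : ∀ {b m n} → Vec (Exp b n) m → Vec Tree n → Vec Tree m

⟦ arg i ⟧         ρ = lookup ρ i
⟦ nil ⟧           ρ = leaf
⟦ cons e₁ e₂ ⟧    ρ = node (⟦ e₁ ⟧ ρ) (⟦ e₂ ⟧ ρ)
⟦ bind e₁ e₂ ⟧    ρ = ⟦ e₂ ⟧ (⟦ e₁ ⟧ ρ ∷ ρ)
⟦ match e e₁ e₂ ⟧ ρ = matchᵗ (⟦ e ⟧ ρ) (⟦ e₁ ⟧ ρ) (λ x y → ⟦ e₂ ⟧ (x ∷ y ∷ ρ))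
⟦ ifte e e₁ e₂ ⟧  ρ = ifᵗ (⟦ e ⟧ ρ) (⟦ e₁ ⟧ ρ) (⟦ e₂ ⟧ ρ)
⟦ app e es ⟧      ρ = ⟦ e ⟧ (⟦ es ⟧* ρ)
⟦ for xs e ⟧      ρ = forᵗ (λ x → ⟦ e ⟧ (x ∷ ρ)) (⟦ xs ⟧ ρ)
⟦ fold xs z e _ ⟧ ρ = foldᵗ (λ x a → ⟦ e ⟧ (x ∷ a ∷ ρ)) (⟦ z ⟧ ρ) (⟦ xs ⟧ ρ)

⟦ [] ⟧*     ρ = []
⟦ e ∷ es ⟧* ρ = ⟦ e ⟧ ρ ∷ ⟦ es ⟧* ρ

-- The whole environment is kept as one tree in variable 0.
pack : ∀ {n} → Vec Tree n → Tree
pack []      = leaf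
pack (x ∷ ρ) = node x (pack ρ)

-- Compilation into the machine model

-- Only loops become table entries: `for` takes one function for the recursion and one for
-- appending, `fold` takes one. Everything else, subroutines under `app` included, is compiled in
-- line.
#funs : ∀ {b n} → Exp b n → ℕ
#funs* : ∀ {b m n} → Vec (Exp b n) m → ℕ

#funs (arg i)         = 0
#funs nil             = 0
#funs (cons e₁ e₂)    = #funs e₁ + #funs e₂
#funs (bind e₁ e₂)    = #funs e₁ + #funs e₂
#funs (match e e₁ e₂) = #funs e + (#funs e₁ + #funs e₂)
#funs (ifte e e₁ e₂)  = #funs e + (#funs e₁ + #funs e₂)
#funs (app e es)      = #funs e + #funs* es
#funs (for xs e)      = 2 + (#funs xs + #funs e)
#funs (fold xs z e _) = 1 + (#funs xs + (#funs z + #funs e))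

#funs* []       = 0
#funs* (e ∷ es) = #funs e + #funs* es

project : ∀ {m n n′} → Fin n′ → Fin n → Expr m n′
project v zero    = case (var v) leaf (var 0F)
project v (suc i) = case (var v) leaf (project 1F i)

module _ {m : ℕ} where

  left : ∀ {k l} → (Fin (k + l) → Fin m) → Fin k → Fin m
  left {l = l} ι i = ι (i ↑ˡ l)

  right : ∀ k {l} → (Fin (k + l) → Fin m) → Fin l → Fin m
  right k ι i = ι (k ↑ʳ i)

  -- Variable 0 is always the packed environment. `let′` and `case` push further variables on top,
  -- so the environment is packed anew or fetched again before a subterm is entered; `n′` counts the
  -- leftovers below it. `ι` tells where in the global table the functions of this subterm are.
  compile : ∀ {b n n′} (e : Exp b n) → (Fin (#funs e) → Fin m) → Expr m (suc n′)
  compile* : ∀ {b k n n′} (es : Vec (Exp b n) k) → (Fin (#funs* es) → Fin m) → Expr m (suc n′)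

  compile (arg i) ι = project 0F i
  compile nil ι = leaf
  compile (cons e₁ e₂) ι = node (compile e₁ (left ι)) (compile e₂ (right (#funs e₁) ι))
  compile (bind e₁ e₂) ι =
    let′ (compile e₁ (left ι)) (let′ (node (var 0F) (var 1F)) (compile e₂ (right (#funs e₁) ι)))
  compile (match e e₁ e₂) ι =
    case (compile e (left ι)) (compile e₁ (left (right (#funs e) ι)))
      (let′ (node (var 0F) (node (var 1F) (var 2F))) (compile e₂ (right (#funs e₁) (right (#funs e) ι))))
  compile (ifte e e₁ e₂) ι =
    case (compile e (left ι)) (compile e₂ (right (#funs e₁) (right (#funs e) ι)))
      (let′ (var 2F) (compile e₁ (left (right (#funs e) ι))))
  compile (app e es) ι = let′ (compile* es (right (#funs e) ι)) (compile e (left ι))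
  compile (for xs e) ι = call (ι 0F) (node (compile xs (left (right 2 ι))) (var 0F))
  compile (fold xs z e _) ι = call (ι 0F) (node (compile xs (left (right 1 ι))) (var 0F))

  compile* [] ι = leaf
  compile* (e ∷ es) ι = node (compile e (left ι)) (compile* es (right (#funs e) ι))

  -- The argument of a loop function is the pair of the remaining list and the packed environment.
  -- After two `case`s the head and the tail of the list are variables 0 and 1, and the environment
  -- is variable 3. For `appendBody` the second list takes the place of the environment.
  forBody : (g a : Fin m) → Expr m 6 → Expr m 1
  forBody g a e =
    case (var 0F) leaf (case (var 0F) leaf
      (call a (node (let′ (node (var 0F) (var 3F)) e) (call g (node (var 1F) (var 3F))))))

  appendBody : Fin m → Expr m 1
  appendBody a = case (var 0F) leaf (case (var 0F) (var 1F) (node (var 0F) (call a (node (var 1F) (var 3F)))))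

  foldBody : Fin m → Expr m 4 → Expr m 7 → Expr m 1
  foldBody g z e =
    case (var 0F) leaf (case (var 0F) (let′ (var 1F) z)
      (let′ (call g (node (var 1F) (var 3F))) (let′ (node (var 1F) (node (var 0F) (var 4F))) e)))

  bodies : ∀ {b n} (e : Exp b n) → (Fin (#funs e) → Fin m) → Fin (#funs e) → Expr m 1
  bodies* : ∀ {b k n} (es : Vec (Exp b n) k) → (Fin (#funs* es) → Fin m) → Fin (#funs* es) → Expr m 1

  bodies (cons e₁ e₂) ι i =
    [ bodies e₁ (left ι) , bodies e₂ (right (#funs e₁) ι) ]′ (splitAt (#funs e₁) i)
  bodies (bind e₁ e₂) ι i =
    [ bodies e₁ (left ι) , bodies e₂ (right (#funs e₁) ι) ]′ (splitAt (#funs e₁) i)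
  bodies (match e e₁ e₂) ι i =
    [ bodies e (left ι)
    , (λ j → [ bodies e₁ (left (right (#funs e) ι)) , bodies e₂ (right (#funs e₁) (right (#funs e) ι)) ]′
               (splitAt (#funs e₁) j)) ]′ (splitAt (#funs e) i)
  bodies (ifte e e₁ e₂) ι i =
    [ bodies e (left ι)
    , (λ j → [ bodies e₁ (left (right (#funs e) ι)) , bodies e₂ (right (#funs e₁) (right (#funs e) ι)) ]′
               (splitAt (#funs e₁) j)) ]′ (splitAt (#funs e) i)
  bodies (app e es) ι i =
    [ bodies e (left ι) , bodies* es (right (#funs e) ι) ]′ (splitAt (#funs e) i)
  bodies (for xs e) ι 0F = forBody (ι 0F) (ι 1F) (compile e (right (#funs xs) (right 2 ι)))
  bodies (for xs e) ι 1F = appendBody (ι 1F)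
  bodies (for xs e) ι (suc (suc i)) =
    [ bodies xs (left (right 2 ι)) , bodies e (right (#funs xs) (right 2 ι)) ]′ (splitAt (#funs xs) i)
  bodies (fold xs z e _) ι 0F =
    foldBody (ι 0F) (compile z (left (right (#funs xs) (right 1 ι))))
                    (compile e (right (#funs z) (right (#funs xs) (right 1 ι))))
  bodies (fold xs z e _) ι (suc i) =
    [ bodies xs (left (right 1 ι))
    , (λ j → [ bodies z (left (right (#funs xs) (right 1 ι)))
             , bodies e (right (#funs z) (right (#funs xs) (right 1 ι))) ]′ (splitAt (#funs z) j)) ]′
      (splitAt (#funs xs) i)

  bodies* (e ∷ es) ι i =
    [ bodies e (left ι) , bodies* es (right (#funs e) ι) ]′ (splitAt (#funs e) i)

program : ∀ {b} → Exp b 1 → Program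
program e = record
  { #functions = #funs e
  ; body       = bodies e id
  ; main       = let′ (node (var 0F) leaf) (compile e id)
  }

-- Step counts of the compiled code

projectCost : ∀ {n} → Fin n → ℕ
projectCost zero    = 3
projectCost (suc i) = 2 + projectCost i

appendCost : Tree → ℕ
appendCost leaf       = 5
appendCost (node x t) = 10 + appendCost t

forCost : (Tree → Tree) → (Tree → ℕ) → Tree → ℕ
forCost f c leaf       = 5
forCost f c (node x t) = 6 + ((4 + c x + (4 + forCost f c t)) + appendCost (f x))

foldCost : (Tree → Tree → Tree) → Tree → (Tree → Tree → ℕ) → ℕ → Tree → ℕ
foldCost f z c d leaf       = 6 + d
foldCost f z c d (node x t) = 9 + (foldCost f z c d t + (6 + c x (foldᵗ f z t)))

matchCost : Tree → ℕ → (Tree → Tree → ℕ) → ℕ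
matchCost leaf       c d = c
matchCost (node x y) c d = 6 + d x y

ifCost : Tree → ℕ → ℕ → ℕ
ifCost leaf       c d = d
ifCost (node _ _) c d = 2 + c

-- A derivation carries its exact number of steps, so this is the true count for the compiled code;
-- upper bounds enter only later.
cost : ∀ {b n} → Exp b n → Vec Tree n → ℕ
cost* : ∀ {b m n} → Vec (Exp b n) m → Vec Tree n → ℕ

cost (arg i)         ρ = projectCost i
cost nil             ρ = 1
cost (cons e₁ e₂)    ρ = suc (cost e₁ ρ + cost e₂ ρ)
cost (bind e₁ e₂)    ρ = suc (cost e₁ ρ + (4 + cost e₂ (⟦ e₁ ⟧ ρ ∷ ρ)))
cost (match e e₁ e₂) ρ =
  suc (cost e ρ + matchCost (⟦ e ⟧ ρ) (cost e₁ ρ) (λ x y → cost e₂ (x ∷ y ∷ ρ)))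
cost (ifte e e₁ e₂)  ρ = suc (cost e ρ + ifCost (⟦ e ⟧ ρ) (cost e₁ ρ) (cost e₂ ρ))
cost (app e es)      ρ = suc (cost* es ρ + cost e (⟦ es ⟧* ρ))
cost (for xs e)      ρ =
  suc (suc (cost xs ρ + 1) + forCost (λ x → ⟦ e ⟧ (x ∷ ρ)) (λ x → cost e (x ∷ ρ)) (⟦ xs ⟧ ρ))
cost (fold xs z e _) ρ =
  suc (suc (cost xs ρ + 1) + foldCost (λ x a → ⟦ e ⟧ (x ∷ a ∷ ρ)) (⟦ z ⟧ ρ)
                               (λ x a → cost e (x ∷ a ∷ ρ)) (cost z ρ) (⟦ xs ⟧ ρ))

cost* []       ρ = 1
cost* (e ∷ es) ρ = suc (cost e ρ + cost* es ρ)

-- Correctness of the compilation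

module Compiled (P : Program) where
  open Program P
  open Semantics P

  Table : ∀ {k} → (Fin k → Fin #functions) → (Fin k → Expr #functions 1) → Set
  Table ι d = ∀ i → body (ι i) ≡ d i

  table-left : ∀ {k l} {ι : Fin (k + l) → Fin #functions} {d₁ d₂} →
      Table ι (λ i → [ d₁ , d₂ ]′ (splitAt k i)) → Table (left ι) d₁
  table-left {k} {l} {ι} {d₁} {d₂} t i =
    trans (t (i ↑ˡ l)) (cong [ d₁ , d₂ ]′ (splitAt-↑ˡ k i l))

  table-right : ∀ k {l} {ι : Fin (k + l) → Fin #functions} {d₁ d₂} →
      Table ι (λ i → [ d₁ , d₂ ]′ (splitAt k i)) → Table (right k ι) d₂
  table-right k {l} {ι} {d₁} {d₂} t i =
    trans (t (k ↑ʳ i)) (cong [ d₁ , d₂ ]′ (splitAt-↑ʳ k l i))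

  project-⇓ : ∀ {n n′} (v : Fin n′) (i : Fin n) (ρ : Vec Tree n) (σ : Vec Tree n′) →
      lookup σ v ≡ pack ρ → σ ⊢ project v i ⇓ lookup ρ i [ projectCost i ]
  project-⇓ v zero (x ∷ ρ) σ eq =
    case-node (subst (λ y → σ ⊢ var v ⇓ y [ 1 ]) eq (var v)) (var 0F)
  project-⇓ v (suc i) (x ∷ ρ) σ eq =
    case-node (subst (λ y → σ ⊢ var v ⇓ y [ 1 ]) eq (var v))
              (project-⇓ 1F i ρ _ refl)

  -- The bodies in the table are selected by `splitAt`, which does not compute on an injected index,
  -- so a call goes through a propositional equation.
  call-⇓ : ∀ {n f e x y s t} {ρ : Vec Tree n} {d} → body f ≡ d →
      ρ ⊢ e ⇓ x [ s ] → (x ∷ []) ⊢ d ⇓ y [ t ] → ρ ⊢ call f e ⇓ y [ suc (s + t) ]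
  call-⇓ refl p q = call p q

  append-⇓ : ∀ {a} → body a ≡ appendBody a → ∀ x y →
      (node x y ∷ []) ⊢ appendBody a ⇓ appendᵗ x y [ appendCost x ]
  append-⇓ eq leaf y = case-node (var 0F) (case-leaf (var 0F) (var 1F))
  append-⇓ eq (node x t) y =
    case-node (var 0F) (case-node (var 0F)
      (node (var 0F) (call-⇓ eq (node (var 1F) (var 3F)) (append-⇓ eq t y))))

  compile-⇓ : ∀ {b n n′} (e : Exp b n) {ι} → Table ι (bodies e ι) → ∀ ρ (σ : Vec Tree n′) →
      (pack ρ ∷ σ) ⊢ compile e ι ⇓ ⟦ e ⟧ ρ [ cost e ρ ]
  compile*-⇓ : ∀ {b k n n′} (es : Vec (Exp b n) k) {ι} → Table ι (bodies* es ι) → ∀ ρ (σ : Vec Tree n′) →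
      (pack ρ ∷ σ) ⊢ compile* es ι ⇓ pack (⟦ es ⟧* ρ) [ cost* es ρ ]
  for-⇓ : ∀ {b n} (xs : Exp b n) (e : Exp b (1 + n)) {ι} → Table ι (bodies (for xs e) ι) → ∀ ρ l →
          (node l (pack ρ) ∷ []) ⊢ bodies (for xs e) ι 0F
            ⇓ forᵗ (λ x → ⟦ e ⟧ (x ∷ ρ)) l [ forCost (λ x → ⟦ e ⟧ (x ∷ ρ)) (λ x → cost e (x ∷ ρ)) l ]
  fold-⇓ : ∀ {b n} (xs z : Exp b n) (e : Exp b (2 + n)) p {ι} → Table ι (bodies (fold xs z e p) ι) → ∀ ρ l →
      (node l (pack ρ) ∷ []) ⊢ bodies (fold xs z e p) ι 0F
             ⇓ foldᵗ (λ x a → ⟦ e ⟧ (x ∷ a ∷ ρ)) (⟦ z ⟧ ρ) l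
             [ foldCost (λ x a → ⟦ e ⟧ (x ∷ a ∷ ρ)) (⟦ z ⟧ ρ) (λ x a → cost e (x ∷ a ∷ ρ)) (cost z ρ) l ]

  compile-⇓ (arg i) t ρ σ = project-⇓ 0F i ρ _ refl
  compile-⇓ nil t ρ σ = leaf
  compile-⇓ (cons e₁ e₂) t ρ σ =
    node (compile-⇓ e₁ (table-left t) ρ σ) (compile-⇓ e₂ (table-right (#funs e₁) t) ρ σ)
  compile-⇓ (bind e₁ e₂) t ρ σ =
    let′ (compile-⇓ e₁ (table-left t) ρ σ)
         (let′ (node (var 0F) (var 1F)) (compile-⇓ e₂ (table-right (#funs e₁) t) _ _))
  compile-⇓ (match e e₁ e₂) t ρ σ with ⟦ e ⟧ ρ | compile-⇓ e (table-left t) ρ σ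
  ... | leaf | d = case-leaf d (compile-⇓ e₁ (table-left (table-right (#funs e) t)) ρ σ)
  ... | node x y | d =
    case-node d (let′ (node (var 0F) (node (var 1F) (var 2F)))
                      (compile-⇓ e₂ (table-right (#funs e₁) (table-right (#funs e) t)) (x ∷ y ∷ ρ) _))
  compile-⇓ (ifte e e₁ e₂) t ρ σ with ⟦ e ⟧ ρ | compile-⇓ e (table-left t) ρ σ
  ... | leaf | d = case-leaf d (compile-⇓ e₂ (table-right (#funs e₁) (table-right (#funs e) t)) ρ σ)
  ... | node x y | d =
    case-node d (let′ (var 2F) (compile-⇓ e₁ (table-left (table-right (#funs e) t)) ρ _))
  compile-⇓ (app e es) t ρ σ =
    let′ (compile*-⇓ es (table-right (#funs e) t) ρ σ) (compile-⇓ e (table-left t) _ _)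
  compile-⇓ (for xs e) t ρ σ =
    call-⇓ (t 0F) (node (compile-⇓ xs (table-left (λ i → t (suc (suc i)))) ρ σ) (var 0F)) (for-⇓ xs e t ρ _)
  compile-⇓ (fold xs z e p) t ρ σ =
    call-⇓ (t 0F) (node (compile-⇓ xs (table-left (λ i → t (suc i))) ρ σ) (var 0F)) (fold-⇓ xs z e p t ρ _)

  compile*-⇓ [] t ρ σ = leaf
  compile*-⇓ (e ∷ es) t ρ σ =
    node (compile-⇓ e (table-left t) ρ σ) (compile*-⇓ es (table-right (#funs e) t) ρ σ)

  for-⇓ xs e t ρ leaf = case-node (var 0F) (case-leaf (var 0F) leaf)
  for-⇓ xs e t ρ (node x l) =
    case-node (var 0F) (case-node (var 0F)
      (call-⇓ (t 1F)
        (node (let′ (node (var 0F) (var 3F))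
                    (compile-⇓ e (table-right (#funs xs) (λ i → t (suc (suc i)))) (x ∷ ρ) _))
              (call-⇓ (t 0F) (node (var 1F) (var 3F)) (for-⇓ xs e t ρ l)))
        (append-⇓ (t 1F) _ _)))

  fold-⇓ xs z e p t ρ leaf =
    case-node (var 0F) (case-leaf (var 0F)
      (let′ (var 1F) (compile-⇓ z (table-left (table-right (#funs xs) (λ i → t (suc i)))) ρ _)))
  fold-⇓ xs z e p t ρ (node x l) =
    case-node (var 0F) (case-node (var 0F)
      (let′ (call-⇓ (t 0F) (node (var 1F) (var 3F)) (fold-⇓ xs z e p t ρ l))
        (let′ (node (var 1F) (node (var 0F) (var 4F)))
          (compile-⇓ e (table-right (#funs z) (table-right (#funs xs) (λ i → t (suc i)))) _ _))))

program-runs : ∀ {b} (e : Exp b 1) x → Runs (program e) x (⟦ e ⟧ (x ∷ [])) (4 + cost e (x ∷ []))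
program-runs e x = let′ (node (var 0F) leaf) (compile-⇓ e (λ _ → refl) (x ∷ []) _)
  where
  open Compiled (program e)
  open Semantics (program e)

-- Polynomial bounds by structural induction

-- A single exponent suffices because the base is at least 2: a constant c is at most 2^c, and a sum
-- of two positive terms is at most twice their product, which costs one more exponent.
Poly : ∀ {A : Set} → (A → ℕ) → (A → ℕ) → Set
Poly m f = ∃[ q ] ∀ a → f a ≤ (2 + m a) ^ q

1≤size : ∀ t → 1 ≤ size t
1≤size leaf       = s≤s z≤n
1≤size (node _ _) = s≤s z≤n

1≤^ : ∀ x q → 1 ≤ (2 + x) ^ q
1≤^ x q = m^n>0 (2 + x) q

^-mono : ∀ {x y} q → x ≤ y → (2 + x) ^ q ≤ (2 + y) ^ q
^-mono q x≤y = ^-monoˡ-≤ q (s≤s (s≤s x≤y))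

+-≤-2* : ∀ {a b} → 1 ≤ a → 1 ≤ b → a + b ≤ 2 * (a * b)
+-≤-2* {a} {b} 1≤a 1≤b = begin
  a + b ≡⟨ cong₂ _+_ (*-identityʳ a) (*-identityˡ b) ⟨
  a * 1 + 1 * b ≤⟨ +-mono-≤ (*-monoʳ-≤ a 1≤b) (*-monoˡ-≤ b 1≤a) ⟩
  a * b + a * b ≡⟨ cong (a * b +_) (+-identityʳ (a * b)) ⟨
  2 * (a * b) ∎
  where open ≤-Reasoning

n≤2^n : ∀ n → n ≤ 2 ^ n
n≤2^n zero    = z≤n
n≤2^n (suc n) = begin
  1 + n ≤⟨ +-mono-≤ (m^n>0 2 n) (n≤2^n n) ⟩
  2 ^ n + 2 ^ n ≡⟨ cong (2 ^ n +_) (+-identityʳ (2 ^ n)) ⟨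
  2 * 2 ^ n ∎
  where open ≤-Reasoning

module _ {A : Set} {m : A → ℕ} where

  poly-≤ : ∀ {f g} → (∀ a → f a ≤ g a) → Poly m g → Poly m f
  poly-≤ f≤g (q , g≤) = q , λ a → ≤-trans (f≤g a) (g≤ a)

  poly-const : ∀ c → Poly m (λ _ → c)
  poly-const c = c , λ a → ≤-trans (n≤2^n c) (^-monoˡ-≤ c (m≤m+n 2 (m a)))

  poly-measure : Poly m m
  poly-measure = 1 , λ a → ≤-trans (m≤n+m (m a) 2) (≤-reflexive (sym (*-identityʳ (2 + m a))))

  poly-+ : ∀ {f g} → Poly m f → Poly m g → Poly m (λ a → f a + g a)
  poly-+ {f} {g} (p , f≤) (q , g≤) = suc (p + q) , λ a → begin
    f a + g a ≤⟨ +-mono-≤ (f≤ a) (g≤ a) ⟩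
    (2 + m a) ^ p + (2 + m a) ^ q ≤⟨ +-≤-2* (1≤^ (m a) p) (1≤^ (m a) q) ⟩
    2 * ((2 + m a) ^ p * (2 + m a) ^ q) ≡⟨ cong (2 *_) (^-distribˡ-+-* (2 + m a) p q) ⟨
    2 * (2 + m a) ^ (p + q) ≤⟨ *-monoˡ-≤ ((2 + m a) ^ (p + q)) (m≤m+n 2 (m a)) ⟩
    (2 + m a) ^ suc (p + q) ∎
    where open ≤-Reasoning

  poly-* : ∀ {f g} → Poly m f → Poly m g → Poly m (λ a → f a * g a)
  poly-* {f} {g} (p , f≤) (q , g≤) = p + q , λ a → begin
    f a * g a ≤⟨ *-mono-≤ (f≤ a) (g≤ a) ⟩
    (2 + m a) ^ p * (2 + m a) ^ q ≡⟨ ^-distribˡ-+-* (2 + m a) p q ⟨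
    (2 + m a) ^ (p + q) ∎
    where open ≤-Reasoning

  poly-^ : ∀ {f} q → Poly m f → Poly m (λ a → f a ^ q)
  poly-^ zero    p = poly-const 1
  poly-^ (suc q) p = poly-* p (poly-^ q p)

  poly-∘^ : ∀ {f} q → Poly m f → Poly m (λ a → (2 + f a) ^ q)
  poly-∘^ q p = poly-^ q (poly-+ (poly-const 2) p)

poly-∘ : ∀ {A B : Set} {m : A → ℕ} {m′ : B → ℕ} {f} (g : A → B) →
    Poly m (m′ ∘ g) → Poly m′ f → Poly m (f ∘ g)
poly-∘ g p (q , f≤) = poly-≤ (λ a → f≤ (g a)) (poly-∘^ q p)

size-append : ∀ x y → size (appendᵗ x y) ≤ size x + size y
size-append leaf       y = n≤1+n (size y)
size-append (node x t) y = s≤s (begin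
  size x + size (appendᵗ t y) ≤⟨ +-monoʳ-≤ (size x) (size-append t y) ⟩
  size x + (size t + size y) ≡⟨ +-assoc (size x) (size t) (size y) ⟨
  size x + size t + size y ∎)
  where open ≤-Reasoning

size-head : ∀ {s} x t → size (node x t) ≤ s → size x ≤ s
size-head x t = ≤-trans (m≤n⇒m≤1+n (m≤m+n (size x) (size t)))

size-tail : ∀ {s} x t → size (node x t) ≤ s → size t ≤ s
size-tail x t = ≤-trans (m≤n⇒m≤1+n (m≤n+m (size t) (size x)))

appendCost-≤ : ∀ t → appendCost t ≤ 10 * size t
appendCost-≤ leaf       = m≤m+n 5 5
appendCost-≤ (node x t) = begin
  10 + appendCost t ≤⟨ +-monoʳ-≤ 10 (appendCost-≤ t) ⟩
  10 + 10 * size t ≤⟨ +-monoʳ-≤ 10 (*-monoʳ-≤ 10 (m≤n+m (size t) (size x))) ⟩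
  10 + 10 * (size x + size t) ≡⟨ *-suc 10 (size x + size t) ⟨
  10 * suc (size x + size t) ∎
  where open ≤-Reasoning

1+tail*-≤ : ∀ x t K → K + size t * K ≤ size (node x t) * K
1+tail*-≤ x t K = +-monoʳ-≤ K (*-monoˡ-≤ K (m≤n+m (size t) (size x)))

module _ {s : ℕ} {f : Tree → Tree} where

  size-for : ∀ {K} → (∀ x → size x ≤ s → size (f x) ≤ K) →
      ∀ l → size l ≤ s → size (forᵗ f l) ≤ 1 + size l * K
  size-for f≤ leaf       _ = s≤s z≤n
  size-for {K} f≤ (node x t) l≤s = begin
    size (appendᵗ (f x) (forᵗ f t)) ≤⟨ size-append (f x) _ ⟩
    size (f x) + size (forᵗ f t) ≤⟨ +-mono-≤ (f≤ x (size-head x t l≤s)) (size-for f≤ t (size-tail x t l≤s)) ⟩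
    K + (1 + size t * K) ≡⟨ +-suc K _ ⟩
    1 + (K + size t * K) ≤⟨ s≤s (1+tail*-≤ x t K) ⟩
    1 + size (node x t) * K ∎
    where open ≤-Reasoning

  forCost-≤ : ∀ {c : Tree → ℕ} {K J} → (∀ x → size x ≤ s → c x ≤ K) → (∀ x → size x ≤ s → appendCost (f x) ≤ J) →
      ∀ l → size l ≤ s → forCost f c l ≤ 5 + size l * (14 + (K + J))
  forCost-≤ c≤ f≤ leaf _ = m≤m+n 5 _
  forCost-≤ {c} {K} {J} c≤ f≤ (node x t) l≤s = begin
    6 + ((4 + c x + (4 + F)) + appendCost (f x))
      ≤⟨ +-monoʳ-≤ 6 (+-mono-≤ (+-mono-≤ (+-monoʳ-≤ 4 (c≤ x (size-head x t l≤s)))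
           (+-monoʳ-≤ 4 (forCost-≤ c≤ f≤ t (size-tail x t l≤s)))) (f≤ x (size-head x t l≤s))) ⟩
    6 + ((4 + K + (4 + (5 + R))) + J)
      ≡⟨ solve 3 (λ k j r → con 6 :+ ((con 4 :+ k :+ (con 4 :+ (con 5 :+ r))) :+ j)
                         := con 5 :+ ((con 14 :+ (k :+ j)) :+ r)) refl K J R ⟩
    5 + ((14 + (K + J)) + R)
      ≤⟨ +-monoʳ-≤ 5 (1+tail*-≤ x t (14 + (K + J))) ⟩
    5 + size (node x t) * (14 + (K + J)) ∎
    where
    open ≤-Reasoning
    open +-*-Solver
    F = forCost f c t
    R = size t * (14 + (K + J))

foldCost-≤ : ∀ {f z c d K s} → (∀ x t → size (node x t) ≤ s → c x (foldᵗ f z t) ≤ K) →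
    ∀ l → size l ≤ s → foldCost f z c d l ≤ (6 + d) + size l * (15 + K)
foldCost-≤ c≤ leaf _ = m≤m+n _ _
foldCost-≤ {f} {z} {c} {d} {K} c≤ (node x t) l≤s = begin
  9 + (foldCost f z c d t + (6 + c x (foldᵗ f z t)))
    ≤⟨ +-monoʳ-≤ 9 (+-mono-≤ (foldCost-≤ c≤ t (size-tail x t l≤s)) (+-monoʳ-≤ 6 (c≤ x t l≤s))) ⟩
  9 + (((6 + d) + R) + (6 + K))
    ≡⟨ solve 3 (λ k e r → con 9 :+ (((con 6 :+ e) :+ r) :+ (con 6 :+ k))
                       := (con 6 :+ e) :+ ((con 15 :+ k) :+ r)) refl K d R ⟩
  (6 + d) + ((15 + K) + R)
    ≤⟨ +-monoʳ-≤ (6 + d) (1+tail*-≤ x t (15 + K)) ⟩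
  (6 + d) + size (node x t) * (15 + K) ∎
  where
  open ≤-Reasoning
  open +-*-Solver
  R = size t * (15 + K)

size-lookup : ∀ {n} (ρ : Vec Tree n) i → size (lookup ρ i) ≤ ∥ ρ ∥
size-lookup (x ∷ ρ) zero    = m≤m+n _ _
size-lookup (x ∷ ρ) (suc i) = ≤-trans (size-lookup ρ i) (m≤n+m _ _)

size-poly : ∀ {n} (e : Exp true n) → Poly ∥_∥ (λ ρ → size (⟦ e ⟧ ρ))
size*-poly : ∀ {m n} (es : Vec (Exp true n) m) → Poly ∥_∥ (λ ρ → ∥ ⟦ es ⟧* ρ ∥)

size-poly (arg i) = poly-≤ (λ ρ → size-lookup ρ i) poly-measure
size-poly nil = poly-const 1
size-poly (cons e₁ e₂) = poly-+ (poly-const 1) (poly-+ (size-poly e₁) (size-poly e₂))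
size-poly (bind e₁ e₂) =
  poly-∘ (λ ρ → ⟦ e₁ ⟧ ρ ∷ ρ) (poly-+ (size-poly e₁) poly-measure) (size-poly e₂)
size-poly (match e e₁ e₂) with size-poly e₂
... | q , e₂≤ = poly-≤ bound (poly-+ (size-poly e₁) (poly-∘^ q (poly-+ (size-poly e) poly-measure)))
  where
  bound : ∀ ρ → size (matchᵗ (⟦ e ⟧ ρ) (⟦ e₁ ⟧ ρ) (λ x y → ⟦ e₂ ⟧ (x ∷ y ∷ ρ)))
              ≤ size (⟦ e₁ ⟧ ρ) + (2 + (size (⟦ e ⟧ ρ) + ∥ ρ ∥)) ^ q
  bound ρ with ⟦ e ⟧ ρ
  ... | leaf     = m≤m+n _ _
  ... | node x y = ≤-trans (≤-trans (e₂≤ (x ∷ y ∷ ρ)) (^-mono q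
    (m≤n⇒m≤1+n (≤-reflexive (sym (+-assoc (size x) (size y) ∥ ρ ∥)))))) (m≤n+m _ (size (⟦ e₁ ⟧ ρ)))
size-poly (ifte e e₁ e₂) = poly-≤ bound (poly-+ (size-poly e₁) (size-poly e₂))
  where
  bound : ∀ ρ → size (ifᵗ (⟦ e ⟧ ρ) (⟦ e₁ ⟧ ρ) (⟦ e₂ ⟧ ρ)) ≤ size (⟦ e₁ ⟧ ρ) + size (⟦ e₂ ⟧ ρ)
  bound ρ with ⟦ e ⟧ ρ
  ... | leaf     = m≤n+m _ _
  ... | node _ _ = m≤m+n _ _
size-poly (app e es) = poly-∘ ⟦ es ⟧* (size*-poly es) (size-poly e)
size-poly (for xs e) with size-poly e
... | q , e≤ = poly-≤ (λ ρ → size-for (λ x x≤ → ≤-trans (e≤ (x ∷ ρ)) (^-mono q (+-monoˡ-≤ ∥ ρ ∥ x≤))) (⟦ xs ⟧ ρ) ≤-refl)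
  (poly-+ (poly-const 1) (poly-* (size-poly xs) (poly-∘^ q (poly-+ (size-poly xs) poly-measure))))
size-poly (fold xs z e p) with p tt
... | q , e≤ = poly-≤ (λ ρ → e≤ ρ (⟦ xs ⟧ ρ)) (poly-∘^ q (poly-+ poly-measure (size-poly xs)))

size*-poly []       = poly-const 0
size*-poly (e ∷ es) = poly-+ (size-poly e) (size*-poly es)

-- The body of a fold runs in environments that contain the fold of a tail. The proof carried by the
-- fold bounds these as well, so one polynomial serves for all iterations.
cost-poly : ∀ {n} (e : Exp true n) → Poly ∥_∥ (cost e)
cost*-poly : ∀ {m n} (es : Vec (Exp true n) m) → Poly ∥_∥ (cost* es)

cost-poly (arg i) = poly-const (projectCost i)
cost-poly nil = poly-const 1
cost-poly (cons e₁ e₂) = poly-+ (poly-const 1) (poly-+ (cost-poly e₁) (cost-poly e₂))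
cost-poly (bind e₁ e₂) =
  poly-+ (poly-const 1) (poly-+ (cost-poly e₁) (poly-+ (poly-const 4)
    (poly-∘ (λ ρ → ⟦ e₁ ⟧ ρ ∷ ρ) (poly-+ (size-poly e₁) poly-measure) (cost-poly e₂))))
cost-poly (match e e₁ e₂) with cost-poly e₂
... | q , e₂≤ = poly-+ (poly-const 1) (poly-+ (cost-poly e) (poly-≤ bound
    (poly-+ (cost-poly e₁) (poly-+ (poly-const 6) (poly-∘^ q (poly-+ (size-poly e) poly-measure))))))
  where
  bound : ∀ ρ → matchCost (⟦ e ⟧ ρ) (cost e₁ ρ) (λ x y → cost e₂ (x ∷ y ∷ ρ))
              ≤ cost e₁ ρ + (6 + (2 + (size (⟦ e ⟧ ρ) + ∥ ρ ∥)) ^ q)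
  bound ρ with ⟦ e ⟧ ρ
  ... | leaf     = m≤m+n _ _
  ... | node x y = ≤-trans (+-monoʳ-≤ 6 (≤-trans (e₂≤ (x ∷ y ∷ ρ)) (^-mono q
    (m≤n⇒m≤1+n (≤-reflexive (sym (+-assoc (size x) (size y) ∥ ρ ∥))))))) (m≤n+m _ (cost e₁ ρ))
cost-poly (ifte e e₁ e₂) =
  poly-+ (poly-const 1) (poly-+ (cost-poly e) (poly-≤ bound
    (poly-+ (poly-const 2) (poly-+ (cost-poly e₁) (cost-poly e₂)))))
  where
  bound : ∀ ρ → ifCost (⟦ e ⟧ ρ) (cost e₁ ρ) (cost e₂ ρ) ≤ 2 + (cost e₁ ρ + cost e₂ ρ)
  bound ρ with ⟦ e ⟧ ρ
  ... | leaf     = ≤-trans (m≤n+m _ (cost e₁ ρ)) (m≤n+m _ 2)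
  ... | node _ _ = +-monoʳ-≤ 2 (m≤m+n _ _)
cost-poly (app e es) =
  poly-+ (poly-const 1) (poly-+ (cost*-poly es) (poly-∘ ⟦ es ⟧* (size*-poly es) (cost-poly e)))
cost-poly (for xs e) with size-poly e | cost-poly e
... | q , e≤ | r , c≤ = poly-+ (poly-const 1) (poly-+ (poly-+ (poly-const 1) (poly-+ (cost-poly xs) (poly-const 1)))
  (poly-≤ (λ ρ → forCost-≤
      (λ x x≤ → ≤-trans (c≤ (x ∷ ρ)) (^-mono r (+-monoˡ-≤ ∥ ρ ∥ x≤)))
      (λ x x≤ → ≤-trans (appendCost-≤ (⟦ e ⟧ (x ∷ ρ)))
        (*-monoʳ-≤ 10 (≤-trans (e≤ (x ∷ ρ)) (^-mono q (+-monoˡ-≤ ∥ ρ ∥ x≤)))))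
      (⟦ xs ⟧ ρ) ≤-refl)
    (poly-+ (poly-const 5) (poly-* (size-poly xs) (poly-+ (poly-const 14)
      (poly-+ (poly-∘^ r sizes) (poly-* (poly-const 10) (poly-∘^ q sizes))))))))
  where sizes = poly-+ (size-poly xs) poly-measure
cost-poly (fold xs z e p) with p tt | cost-poly e
... | q , e≤ | r , c≤ = poly-+ (poly-const 1) (poly-+ (poly-+ (poly-const 1) (poly-+ (cost-poly xs) (poly-const 1)))
  (poly-≤ (λ ρ → foldCost-≤
      (λ x t l≤ → ≤-trans (c≤ _) (^-mono r (+-mono-≤ (size-head x t l≤)
        (+-monoˡ-≤ ∥ ρ ∥ (≤-trans (e≤ ρ t) (^-mono q (+-monoʳ-≤ ∥ ρ ∥ (size-tail x t l≤))))))))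
      (⟦ xs ⟧ ρ) ≤-refl)
    (poly-+ (poly-+ (poly-const 6) (cost-poly z)) (poly-* (size-poly xs) (poly-+ (poly-const 15)
      (poly-∘^ r (poly-+ (size-poly xs) (poly-+ (poly-∘^ q (poly-+ poly-measure (size-poly xs))) poly-measure))))))))

cost*-poly []       = poly-const 1
cost*-poly (e ∷ es) = poly-+ (poly-const 1) (poly-+ (cost-poly e) (cost*-poly es))

-- It suffices that one step of a fold adds an amount that does not depend
-- on the accumulator.
additive : ∀ {n} {z : Vec Tree n → Tree} {f : Vec Tree (2 + n) → Tree} {g : Vec Tree (1 + n) → ℕ} →
    Poly ∥_∥ (λ ρ → size (z ρ)) → Poly ∥_∥ g →
    (∀ x a ρ → size (f (x ∷ a ∷ ρ)) ≤ size a + g (x ∷ ρ)) → FoldBounded z f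
additive {n} {z} {f} {g} (p , z≤) (q , g≤) f≤ = proj₁ final , λ ρ l → ≤-trans (bound ρ l l ≤-refl) (proj₂ final (ρ , l))
  where
  final : Poly (λ (ρ , l) → ∥ ρ ∥ + size l)
               (λ ((ρ , l) : Vec Tree n × Tree) → (2 + ∥ ρ ∥) ^ p + size l * (2 + (size l + ∥ ρ ∥)) ^ q)
  final = poly-+ (poly-∘^ p (poly-≤ (λ _ → m≤m+n _ _) poly-measure))
    (poly-* (poly-≤ (λ (ρ , l) → m≤n+m (size l) ∥ ρ ∥) poly-measure)
            (poly-∘^ q (poly-≤ (λ (ρ , l) → ≤-reflexive (+-comm (size l) ∥ ρ ∥)) poly-measure)))
  bound : ∀ ρ l t → size t ≤ size l → size (foldᵗ (λ x a → f (x ∷ a ∷ ρ)) (z ρ) t)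
        ≤ (2 + ∥ ρ ∥) ^ p + size t * (2 + (size l + ∥ ρ ∥)) ^ q
  bound ρ l leaf t≤ = ≤-trans (z≤ ρ) (m≤m+n _ _)
  bound ρ l (node x t) t≤ = begin
    size (f (x ∷ a ∷ ρ)) ≤⟨ f≤ x a ρ ⟩
    size a + g (x ∷ ρ) ≤⟨ +-mono-≤ (bound ρ l t (size-tail x t t≤))
                                   (≤-trans (g≤ (x ∷ ρ)) (^-mono q (+-monoˡ-≤ ∥ ρ ∥ (size-head x t t≤)))) ⟩
    (Z + size t * K) + K ≡⟨ +-assoc Z (size t * K) K ⟩
    Z + (size t * K + K) ≡⟨ cong (Z +_) (+-comm (size t * K) K) ⟩
    Z + (K + size t * K) ≤⟨ +-monoʳ-≤ Z (1+tail*-≤ x t K) ⟩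
    Z + size (node x t) * K ∎
    where
    open ≤-Reasoning
    a = foldᵗ (λ x a → f (x ∷ a ∷ ρ)) (z ρ) t
    K = (2 + (size l + ∥ ρ ∥)) ^ q
    Z = (2 + ∥ ρ ∥) ^ p

fold⁺ : ∀ {n} (xs z : Exp true n) (e : Exp true (2 + n)) (g : Vec Tree (1 + n) → ℕ) → Poly ∥_∥ g →
        (∀ x a ρ → size (⟦ e ⟧ (x ∷ a ∷ ρ)) ≤ size a + g (x ∷ ρ)) → Exp true n
fold⁺ xs z e g g-poly e≤ = fold xs z e λ _ → additive {z = ⟦ z ⟧} {⟦ e ⟧} {g} (size-poly z) g-poly e≤

-- Sums, averaging and iteration on lists

sumOf : ∀ {A : Set} → (A → ℕ) → List A → ℕ
sumOf f []       = 0
sumOf f (x ∷ xs) = f x + sumOf f xs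

sumOf-+ : ∀ {A : Set} (f g : A → ℕ) xs → sumOf (λ x → f x + g x) xs ≡ sumOf f xs + sumOf g xs
sumOf-+ f g []       = refl
sumOf-+ f g (x ∷ xs) = begin
  f x + g x + sumOf (λ x → f x + g x) xs ≡⟨ cong (f x + g x +_) (sumOf-+ f g xs) ⟩
  f x + g x + (sumOf f xs + sumOf g xs) ≡⟨ solve 4 (λ a b c d → a :+ b :+ (c :+ d) := a :+ c :+ (b :+ d)) refl (f x) (g x) (sumOf f xs) (sumOf g xs) ⟩
  f x + sumOf f xs + (g x + sumOf g xs) ∎
  where
  open ≡-Reasoning
  open +-*-Solver

sumOf-cong : ∀ {A : Set} {f g : A → ℕ} xs → (∀ {x} → x ∈ xs → f x ≡ g x) → sumOf f xs ≡ sumOf g xs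
sumOf-cong []       eq = refl
sumOf-cong (x ∷ xs) eq = cong₂ _+_ (eq (here refl)) (sumOf-cong xs (eq ∘ there))

sumOf-≤ : ∀ {A : Set} {f g : A → ℕ} xs → (∀ {x} → x ∈ xs → f x ≤ g x) → sumOf f xs ≤ sumOf g xs
sumOf-≤ []       le = z≤n
sumOf-≤ (x ∷ xs) le = +-mono-≤ (le (here refl)) (sumOf-≤ xs (le ∘ there))

sumOf-const : ∀ {A : Set} c (xs : List A) → sumOf (λ _ → c) xs ≡ length xs * c
sumOf-const c []       = refl
sumOf-const c (x ∷ xs) = cong (c +_) (sumOf-const c xs)

length-concatMap : ∀ {A B : Set} (f : A → List B) xs → length (concatMap f xs) ≡ sumOf (length ∘ f) xs
length-concatMap f []       = refl
length-concatMap f (x ∷ xs) = trans (length-++ (f x)) (cong (length (f x) +_) (length-concatMap f xs))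

nonempty? : ∀ {A : Set} (xs : List A) → Dec (1 ≤ length xs)
nonempty? []      = no λ ()
nonempty? (_ ∷ _) = yes (s≤s z≤n)

-- The quantities that the algorithm compares, such as E and 2κ, are kept as lists. Cancelling entry
-- against entry spares the program any arithmetic.
shorter? : ∀ {A B : Set} (xs : List A) (ys : List B) → Dec (length xs < length ys)
shorter? _        []       = no λ ()
shorter? []       (_ ∷ _)  = yes (s≤s z≤n)
shorter? (_ ∷ xs) (_ ∷ ys) = map′ s≤s s≤s⁻¹ (shorter? xs ys)

-- Averaging: if k * f x < m for every entry, then adding up gives k * sum < length * m ≤ k * m,
-- against m ≤ sum. The summand `length ys` in `bound` preserves the strictness, and 0 < m excludes
-- the empty list.
heavy-summand : ∀ {A : Set} (f : A → ℕ) xs {k m} → length xs ≤ k → 0 < m → m ≤ sumOf f xs →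
    ∃[ x ] (x ∈ xs × m ≤ k * f x)
heavy-summand f xs {k} {m} len≤k 0<m m≤ with any? (λ x → m ≤? k * f x) xs
... | yes p with x , x∈xs , le ← find p = x , x∈xs , le
... | no none = ⊥-elim (absurd k xs len≤k m≤ (¬Any⇒All¬ xs none))
  where
  open ≤-Reasoning
  bound : ∀ k ys → All (λ x → ¬ m ≤ k * f x) ys → k * sumOf f ys + length ys ≤ length ys * m
  bound k [] [] = ≤-reflexive (cong (_+ 0) (*-zeroʳ k))
  bound k (y ∷ ys) (p ∷ ps) = begin
    k * (f y + sumOf f ys) + suc (length ys)
      ≡⟨ solve 4 (λ k a b c → k :* (a :+ b) :+ (con 1 :+ c) := con 1 :+ k :* a :+ (k :* b :+ c)) refl k (f y) (sumOf f ys) (length ys) ⟩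
    suc (k * f y) + (k * sumOf f ys + length ys)
      ≤⟨ +-mono-≤ (≰⇒> p) (bound k ys ps) ⟩
    m + length ys * m ∎
    where open +-*-Solver
  absurd : ∀ k ys → length ys ≤ k → m ≤ sumOf f ys → All (λ x → ¬ m ≤ k * f x) ys → ⊥
  absurd k       []       _  m≤ _ = <⇒≱ 0<m m≤
  absurd (suc k) (y ∷ ys) le m≤ ps = <-irrefl refl (begin-strict
    suc k * m ≤⟨ *-monoʳ-≤ (suc k) m≤ ⟩
    suc k * sumOf f (y ∷ ys) <⟨ m<m+n _ (s≤s z≤n) ⟩
    suc k * sumOf f (y ∷ ys) + length (y ∷ ys) ≤⟨ bound (suc k) (y ∷ ys) ps ⟩
    length (y ∷ ys) * m ≤⟨ *-monoˡ-≤ m le ⟩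
    suc k * m ∎)

-- The list is only a counter. In this form an iteration is a `fold` of the language.
iterate : ∀ {A B : Set} → (A → A) → A → List B → A
iterate f x = foldr (λ _ → f) x

module _ {A B : Set} (f : A → A) (μ : A → ℕ) (decreases : ∀ x → f x ≡ x ⊎ μ (f x) < μ x) where

  progress : ∀ x (l : List B) → f (iterate f x l) ≡ iterate f x l ⊎ μ (iterate f x l) + length l ≤ μ x
  progress x [] = inj₂ (≤-reflexive (+-identityʳ (μ x)))
  progress x (_ ∷ l) with progress x l
  ... | inj₁ eq = inj₁ (cong f eq)
  ... | inj₂ le with decreases (iterate f x l)
  ...   | inj₁ eq = inj₁ (cong f eq)
  ...   | inj₂ lt = inj₂ (≤-trans (≤-reflexive (+-suc _ (length l))) (≤-trans (+-monoˡ-≤ (length l) lt) le))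

  -- If no fixed point has occurred, the measure has dropped once per entry of `l`, hence to 0, and
  -- another drop is impossible.
  iterate-fixed : ∀ x (l : List B) → μ x ≤ length l → f (iterate f x l) ≡ iterate f x l
  iterate-fixed x l μ≤ with progress x l
  ... | inj₁ eq = eq
  ... | inj₂ le with decreases (iterate f x l)
  ...   | inj₁ eq = eq
  ...   | inj₂ lt = contradiction (≤-trans le μ≤) (<⇒≱ (m<n+m (length l) (≤-trans (s≤s z≤n) lt)))

module _ {A : Set} {P Q : A → Set} (P? : Unary.Decidable P) (Q? : Unary.Decidable Q) (P⇒Q : ∀ {x} → P x → Q x) where

  length-filter-≤ : ∀ xs → length (filter P? xs) ≤ length (filter Q? xs)
  length-filter-≤ [] = z≤n
  length-filter-≤ (x ∷ xs) with P? x | Q? x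
  ... | yes _ | yes _ = s≤s (length-filter-≤ xs)
  ... | yes p | no ¬q = contradiction (P⇒Q p) ¬q
  ... | no _  | yes _ = m≤n⇒m≤1+n (length-filter-≤ xs)
  ... | no _  | no _  = length-filter-≤ xs

  length-filter-< : ∀ {x xs} → x ∈ xs → Q x → ¬ P x → length (filter P? xs) < length (filter Q? xs)
  length-filter-< {xs = x ∷ xs} x∈ q ¬p with P? x | Q? x
  length-filter-< {xs = x ∷ xs} (here refl) q ¬p | yes p | _     = contradiction p ¬p
  length-filter-< {xs = x ∷ xs} (here refl) q ¬p | _     | no ¬q = contradiction q ¬q
  length-filter-< {xs = x ∷ xs} (here refl) q ¬p | no _  | yes _ = s≤s (length-filter-≤ xs)
  length-filter-< {xs = x ∷ xs} (there x∈)  q ¬p | yes _ | yes _ = s≤s (length-filter-< x∈ q ¬p)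
  length-filter-< {xs = x ∷ xs} (there x∈)  q ¬p | yes p | no ¬q = contradiction (P⇒Q p) ¬q
  length-filter-< {xs = x ∷ xs} (there x∈)  q ¬p | no _  | yes _ = m≤n⇒m≤1+n (length-filter-< x∈ q ¬p)
  length-filter-< {xs = x ∷ xs} (there x∈)  q ¬p | no _  | no _  = length-filter-< x∈ q ¬p

Unique-⊆-tail : ∀ {A : Set} {x : A} {xs ys} → x ∉ xs → (x ∷ xs) ⊆ ys → ∀ {y} → y ∈ xs → y ∈ ys × y ≢ x
Unique-⊆-tail x∉ sub y∈ = sub (there y∈) , λ { refl → x∉ y∈ }

head-∉ : ∀ {A : Set} {x : A} {xs} → Unique (x ∷ xs) → x ∉ xs
head-∉ (x≢ ∷ _) = All¬⇒¬Any x≢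

two-elements : ∀ {A : Set} {l : List A} {x y} → x ∈ l → y ∈ l → x ≢ y → 2 ≤ length l
two-elements (here refl) (here refl) x≢y = contradiction refl x≢y
two-elements (here refl) (there y∈) x≢y = s≤s (∈-length y∈)
two-elements (there x∈) _ x≢y = s≤s (∈-length x∈)

-- Graphs: the 2-core, maximal paths and candidates

module WithEquality {V : Set} (_≟_ : DecidableEquality V) where

  open DecMembership _≟_ using (_∈?_) public

  infixl 6 _∖_ _∖∖_

  ≢? : ∀ u → Unary.Decidable (_≢ u)
  ≢? u v = ¬? (v ≟ u)

  ∉? : ∀ C → Unary.Decidable (_∉ C)
  ∉? C v = ¬? (v ∈? C)

  _∖_ : List V → V → List V
  Y ∖ u = filter (≢? u) Y

  _∖∖_ : List V → List V → List V
  Y ∖∖ C = filter (∉? C) Y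

  ∈-∖ : ∀ {Y u v} → v ∈ Y → v ≢ u → v ∈ Y ∖ u
  ∈-∖ = ∈-filter⁺ (≢? _)

  ∖-⊆ : ∀ Y u → (Y ∖ u) ⊆ Y
  ∖-⊆ Y u = proj₁ ∘ ∈-filter⁻ (≢? u)

  ∖-≢ : ∀ {Y u v} → v ∈ Y ∖ u → v ≢ u
  ∖-≢ {Y} {u} = proj₂ ∘ ∈-filter⁻ (≢? u) {xs = Y}

  ∖-unique : ∀ {Y} u → Unique Y → Unique (Y ∖ u)
  ∖-unique u = filter⁺ (≢? u)

  ∉-∖ : ∀ {u} Y → u ∉ Y → Y ∖ u ≡ Y
  ∉-∖ {u} Y u∉Y = filter-all (≢? u) (All.tabulate λ { v∈Y refl → u∉Y v∈Y })

  sumOf-∖ : ∀ (f : V → ℕ) {Y u} → Unique Y → u ∈ Y → sumOf f Y ≡ f u + sumOf f (Y ∖ u)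
  sumOf-∖ f {x ∷ Y} {u} uniq@(_ ∷ uniqY) u∈ with x ≟ u
  ... | yes refl = cong (λ Z → f x + sumOf f Z) (sym (∉-∖ Y (head-∉ uniq)))
  sumOf-∖ f {x ∷ Y} {u} _ (here refl) | no x≢u = contradiction refl x≢u
  sumOf-∖ f {x ∷ Y} {u} (_ ∷ uniqY) (there u∈Y) | no x≢u = begin
    f x + sumOf f Y ≡⟨ cong (f x +_) (sumOf-∖ f uniqY u∈Y) ⟩
    f x + (f u + sumOf f (Y ∖ u)) ≡⟨ solve 3 (λ a b c → a :+ (b :+ c) := b :+ (a :+ c)) refl (f x) (f u) (sumOf f (Y ∖ u)) ⟩
    f u + (f x + sumOf f (Y ∖ u)) ∎
    where
    open ≡-Reasoning
    open +-*-Solver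

  sumOf-∖-≤ : ∀ (f : V → ℕ) {Y u} → u ∈ Y → f u + sumOf f (Y ∖ u) ≤ sumOf f Y
  sumOf-∖-≤ f {x ∷ Y} {u} u∈ with x ≟ u
  ... | yes refl = +-monoʳ-≤ (f x) (sub Y)
    where
    sub : ∀ Z → sumOf f (Z ∖ u) ≤ sumOf f Z
    sub [] = z≤n
    sub (z ∷ Z) with z ≟ u
    ... | yes _ = ≤-trans (sub Z) (m≤n+m _ (f z))
    ... | no  _ = +-monoʳ-≤ (f z) (sub Z)
  sumOf-∖-≤ f {x ∷ Y} {u} (here refl) | no x≢u = contradiction refl x≢u
  sumOf-∖-≤ f {x ∷ Y} {u} (there u∈Y) | no x≢u = begin
    f u + (f x + sumOf f (Y ∖ u)) ≡⟨ solve 3 (λ a b c → b :+ (a :+ c) := a :+ (b :+ c)) refl (f x) (f u) (sumOf f (Y ∖ u)) ⟩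
    f x + (f u + sumOf f (Y ∖ u)) ≤⟨ +-monoʳ-≤ (f x) (sumOf-∖-≤ f u∈Y) ⟩
    f x + sumOf f Y ∎
    where
    open ≤-Reasoning
    open +-*-Solver

  sumOf-⊆ : ∀ (f : V → ℕ) {X Y} → Unique X → X ⊆ Y → sumOf f X ≤ sumOf f Y
  sumOf-⊆ f {[]} _ _ = z≤n
  sumOf-⊆ f {x ∷ X} {Y} uniq@(_ ∷ uniqX) X⊆Y = begin
    f x + sumOf f X ≤⟨ +-monoʳ-≤ (f x) (sumOf-⊆ f uniqX (λ y∈ → let y∈Y , y≢x = Unique-⊆-tail (head-∉ uniq) X⊆Y y∈ in ∈-∖ y∈Y y≢x)) ⟩
    f x + sumOf f (Y ∖ x) ≤⟨ sumOf-∖-≤ f (X⊆Y (here refl)) ⟩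
    sumOf f Y ∎
    where open ≤-Reasoning

  length-⊆ : ∀ {X Y : List V} → Unique X → X ⊆ Y → length X ≤ length Y
  length-⊆ {X} {Y} uniq X⊆Y = begin
    length X ≡⟨ *-identityʳ (length X) ⟨
    length X * 1 ≡⟨ sumOf-const 1 X ⟨
    sumOf (λ _ → 1) X ≤⟨ sumOf-⊆ (λ _ → 1) uniq X⊆Y ⟩
    sumOf (λ _ → 1) Y ≡⟨ sumOf-const 1 Y ⟩
    length Y * 1 ≡⟨ *-identityʳ (length Y) ⟩
    length Y ∎
    where open ≤-Reasoning

  two-distinct : ∀ {l : List V} → Unique l → 2 ≤ length l → ∃[ x ] ∃[ y ] (x ∈ l × y ∈ l × x ≢ y)
  two-distinct {x ∷ []}    _ (s≤s ())
  two-distinct {x ∷ y ∷ l} ((x≢y ∷ _) ∷ _) _ = x , y , here refl , there (here refl) , x≢y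

  module Graph {_~_ : V → V → Set} (_~?_ : Decidable _~_)
               (~-sym : ∀ {u v} → u ~ v → v ~ u) (~-irrefl : ∀ {u} → ¬ u ~ u) where

    nbrs : List V → V → List V
    nbrs Y v = filter (v ~?_) Y

    deg : List V → V → ℕ
    deg Y v = length (nbrs Y v)

    2≤deg? : ∀ Y → Unary.Decidable (λ v → 2 ≤ deg Y v)
    2≤deg? Y v = 2 ≤? deg Y v

    strip₁ : List V → List V
    strip₁ Y = filter (2≤deg? Y) Y

    strip : List V → List V
    strip Y = iterate strip₁ Y Y

    -- Lists that stand for numbers: `excess` has length deg - 2, the number e(v), and `surplus` has
    -- length E.
    excess : List V → V → List V
    excess Y v = drop 2 (nbrs Y v)

    surplus : List V → List V
    surplus Y = concatMap (excess Y) Y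

    nexts : List V → V → List V → List V
    nexts Y v p = filter (λ u → (v ~? u) ×-dec ¬? (u ∈? (v ∷ p))) Y

    extend : List V → List V → List V
    extend Y []      = []
    extend Y (v ∷ p) = take 1 (nexts Y v p) ++ (v ∷ p)

    -- The path grows at its head and is maximal at that end alone. This is enough, because a cycle
    -- is closed by an edge at the head.
    walk : List V → List V
    walk Y = iterate (extend Y) (take 1 Y) Y

    addToFirst : V → List (List V) → List (List V)
    addToFirst v []       = [ [ v ] ]
    addToFirst v (g ∷ gs) = (v ∷ g) ∷ gs

    -- The first group is the run still open. A vertex of positive excess becomes a group of its
    -- own, and the empty group in front of it opens a new run. A group that stays empty is
    -- harmless: taken as a candidate it empties a slot, and the state becomes infeasible.
    addToGroups : List V → V → List (List V) → List (List V)
    addToGroups Y v gs = if does (nonempty? (excess Y v)) then [] ∷ [ v ] ∷ gs else addToFirst v gs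

    groups : List V → List V → List (List V)
    groups Y = foldr (addToGroups Y) [ [] ]

    -- A list of length 2κ(1 + e(v)), where κ is the length of `pend`, made to be compared with
    -- `surplus`.
    weight : ∀ {A : Set} → List V → List A → V → List V
    weight Y pend v = concatMap (λ _ → (v ∷ excess Y v) ++ (v ∷ excess Y v)) pend

    candidates : ∀ {A : Set} → List V → List A → List (List V)
    candidates Y pend =
      if does (shorter? (pend ++ pend) (surplus Y))
      then map [_] (filter (λ v → ¬? (shorter? (weight Y pend v) (surplus Y))) Y)
      else groups Y (walk Y)

    Dense : List V → Set
    Dense Y = ∀ {v} → v ∈ Y → 2 ≤ deg Y v

    -- What stripping and grouping use of a cycle: a property of its vertex set, free of any cyclic
    -- order.
    TwoNbrs : List V → Set
    TwoNbrs Q = ∀ {v} → v ∈ Q → ∃[ u ] ∃[ w ] (u ∈ Q × w ∈ Q × u ≢ w × v ~ u × v ~ w)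

    record ~Cycle : Set where
      field
        start    : V
        rest     : List V
        long     : 2 ≤ length rest
        distinct : Unique (start ∷ rest)
        linked   : Linked _~_ ((start ∷ rest) ∷ʳ start)

      vertices : List V
      vertices = start ∷ rest

    open ~Cycle using (vertices)

    cycle-two-nbrs : ∀ C → TwoNbrs (vertices C)
    cycle-two-nbrs record { start = x ; rest = r₁ ∷ [] ; long = s≤s () }
    cycle-two-nbrs record { start = x ; rest = r₁ ∷ r₂ ∷ t ; distinct = d@(x≢ ∷ (r₁≢ ∷ _)) ; linked = l@(xr₁ ∷ l′@(_ ∷ l″)) } = nbrsOf
      where
      Q = x ∷ r₁ ∷ r₂ ∷ t
      -- `inner` runs along the cycle, p being the predecessor of v. Only for the last vertex is the
      -- other neighbor x, so p ≢ x is demanded only there. In the first call p is x itself, but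
      -- then t is nonempty because the cycle is long enough.
      inner : ∀ p v t → Linked _~_ ((p ∷ v ∷ t) ∷ʳ x) → Unique (p ∷ v ∷ t) → (p ∷ v ∷ t) ⊆ Q →
              All (x ≢_) (v ∷ t) → (t ≡ [] → p ≢ x) →
              ∀ {y} → y ∈ v ∷ t → ∃[ u ] ∃[ w ] (u ∈ Q × w ∈ Q × u ≢ w × y ~ u × y ~ w)
      inner p v [] (pv ∷ vx ∷ [-]) _ sub _ p≢x (here refl) =
        p , x , sub (here refl) , here refl , p≢x refl , ~-sym pv , vx
      inner p v (s ∷ t) (pv ∷ vs ∷ _) ((_ ∷ p≢s ∷ _) ∷ _) sub _ _ (here refl) =
        p , s , sub (here refl) , sub (there (there (here refl))) , p≢s , ~-sym pv , vs
      inner p v (s ∷ t) (_ ∷ lk) (_ ∷ uq) sub (x≢v ∷ x≢) _ (there y∈) =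
        inner v s t lk uq (sub ∘ there) x≢ (λ _ v≡x → x≢v (sym v≡x)) y∈
      lastNbr : ∀ a t → Linked _~_ ((a ∷ t) ∷ʳ x) → ∃[ b ] (b ∈ a ∷ t × b ~ x)
      lastNbr a []      (ax ∷ _) = a , here refl , ax
      lastNbr a (b ∷ t) (_ ∷ lk) with c , c∈ , cx ← lastNbr b t lk = c , there c∈ , cx
      nbrsOf : TwoNbrs Q
      nbrsOf (here refl) with b , b∈ , bx ← lastNbr r₂ t l″ =
        r₁ , b , there (here refl) , there (there b∈) , (λ { refl → All¬⇒¬Any r₁≢ b∈ }) , xr₁ , ~-sym bx
      nbrsOf (there y∈) = inner x r₁ (r₂ ∷ t) l d id x≢ (λ ()) y∈

    two-nbrs⇒deg : ∀ {Q Y} → TwoNbrs Q → Q ⊆ Y → ∀ {v} → v ∈ Q → 2 ≤ deg Y v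
    two-nbrs⇒deg two Q⊆Y {v} v∈Q with u , w , u∈ , w∈ , u≢w , vu , vw ← two v∈Q =
      two-elements (∈-filter⁺ (v ~?_) (Q⊆Y u∈) vu) (∈-filter⁺ (v ~?_) (Q⊆Y w∈) vw) u≢w

    dense⇒two-nbrs : ∀ {Y} → Unique Y → Dense Y → TwoNbrs Y
    dense⇒two-nbrs {Y} uniq dense {v} v∈Y
      with u , w , u∈ , w∈ , u≢w ← two-distinct (filter⁺ (v ~?_) uniq) (dense v∈Y)
      with u∈Y , vu ← ∈-filter⁻ (v ~?_) {xs = Y} u∈ | w∈Y , vw ← ∈-filter⁻ (v ~?_) {xs = Y} w∈ =
      u , w , u∈Y , w∈Y , u≢w , vu , vw

    strip₁-decreases : ∀ Y → strip₁ Y ≡ Y ⊎ length (strip₁ Y) < length Y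
    strip₁-decreases Y with all? (2≤deg? Y) Y
    ... | yes all = inj₁ (filter-all (2≤deg? Y) all)
    ... | no ¬all = inj₂ (filter-notAll (2≤deg? Y) Y (¬All⇒Any¬ (2≤deg? Y) Y ¬all))

    -- A round that changes the list removes a vertex, so as many rounds as there are vertices reach
    -- the 2-core.
    strip-dense : ∀ Y → Dense (strip Y)
    strip-dense Y {v} v∈ = proj₂ (∈-filter⁻ (2≤deg? (strip Y)) {xs = strip Y} (subst (v ∈_) (sym fixed) v∈))
      where
      fixed : strip₁ (strip Y) ≡ strip Y
      fixed = iterate-fixed strip₁ length strip₁-decreases Y Y ≤-refl

    module _ {Y : List V} where

      strip-⊆ : strip Y ⊆ Y
      strip-⊆ = go Y
        where
        go : ∀ l → iterate strip₁ Y l ⊆ Y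
        go []      v∈ = v∈
        go (_ ∷ l) v∈ = go l (proj₁ (∈-filter⁻ (2≤deg? (iterate strip₁ Y l)) v∈))

      strip-unique : Unique Y → Unique (strip Y)
      strip-unique uniq = go Y
        where
        go : ∀ l → Unique (iterate strip₁ Y l)
        go []      = uniq
        go (_ ∷ l) = filter⁺ (2≤deg? (iterate strip₁ Y l)) (go l)

      length-strip : length (strip Y) ≤ length Y
      length-strip = go Y
        where
        go : ∀ l → length (iterate strip₁ Y l) ≤ length Y
        go []      = ≤-refl
        go (_ ∷ l) = ≤-trans (length-filter (2≤deg? (iterate strip₁ Y l)) (iterate strip₁ Y l)) (go l)

      -- The members of Q witness each other's degrees, so none of them can be the first to be
      -- stripped.
      two-nbrs⊆strip : ∀ {Q} → TwoNbrs Q → Q ⊆ Y → Q ⊆ strip Y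
      two-nbrs⊆strip {Q} two Q⊆Y = go Y
        where
        go : ∀ l → Q ⊆ iterate strip₁ Y l
        go []      v∈ = Q⊆Y v∈
        go (_ ∷ l) v∈ = ∈-filter⁺ (2≤deg? (iterate strip₁ Y l)) (go l v∈) (two-nbrs⇒deg two (go l) v∈)

    record Path (Y p : List V) : Set where
      field
        unique : Unique p
        within : p ⊆ Y
        linked : Linked _~_ p

    ∈-nexts⁻ : ∀ Y v p u → u ∈ nexts Y v p → u ∈ Y × v ~ u × u ∉ v ∷ p
    ∈-nexts⁻ Y v p u = ∈-filter⁻ (λ u → (v ~? u) ×-dec ¬? (u ∈? (v ∷ p)))

    module _ {Y : List V} where

      extend-path : ∀ {p} → Path Y p → Path Y (extend Y p)
      extend-path {[]}    P = P
      extend-path {v ∷ p} P with nexts Y v p | ∈-nexts⁻ Y v p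
      ... | []     | _    = P
      ... | u ∷ us | from with u∈Y , vu , u∉ ← from _ (here refl) = record
        { unique = ¬Any⇒All¬ (v ∷ p) u∉ ∷ Path.unique P
        ; within = λ { (here refl) → u∈Y ; (there w∈) → Path.within P w∈ }
        ; linked = ~-sym vu ∷ Path.linked P
        }

      extend-decreases : ∀ p → extend Y p ≡ p ⊎ length (Y ∖∖ extend Y p) < length (Y ∖∖ p)
      extend-decreases [] = inj₁ refl
      extend-decreases (v ∷ p) with nexts Y v p | ∈-nexts⁻ Y v p
      ... | []     | _    = inj₁ refl
      ... | u ∷ us | from with u∈Y , vu , u∉ ← from _ (here refl) = inj₂ (length-filter-< (∉? (u ∷ v ∷ p)) (∉? (v ∷ p))
        (λ w∉ w∈ → w∉ (there w∈)) u∈Y u∉ (λ u∉′ → u∉′ (here refl)))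

      walk-path : Path Y (walk Y)
      walk-path = go Y
        where
        first : ∀ Z → Z ⊆ Y → Path Y (take 1 Z)
        first []      _   = record { unique = [] ; within = λ () ; linked = [] }
        first (z ∷ Z) sub = record { unique = [] ∷ [] ; within = λ { (here refl) → sub (here refl) } ; linked = [-] }
        go : ∀ (l : List V) → Path Y (iterate (extend Y) (take 1 Y) l)
        go []      = first Y id
        go (_ ∷ l) = extend-path (go l)

      walk-fixed : extend Y (walk Y) ≡ walk Y
      walk-fixed = iterate-fixed (extend Y) (λ p → length (Y ∖∖ p)) extend-decreases (take 1 Y) Y
        (length-filter (λ v → ¬? (v ∈? take 1 Y)) Y)

      walk-maximal : ∀ {v p} → walk Y ≡ v ∷ p → ∀ {u} → u ∈ Y → v ~ u → u ∈ v ∷ p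
      walk-maximal {v} {p} eq {u} u∈Y vu = decidable-stable (u ∈? (v ∷ p)) λ u∉ →
        longer (∈-filter⁺ P? u∈Y (vu , u∉)) (trans (cong (extend Y) (sym eq)) (trans walk-fixed eq))
        where
        P? = λ u → (v ~? u) ×-dec ¬? (u ∈? (v ∷ p))
        longer : ∀ {xs : List V} → u ∈ xs → take 1 xs ++ (v ∷ p) ≢ v ∷ p
        longer {_ ∷ _} _ e = 1+n≢n (cong length e)

      walk-nonempty : ∀ {y} → y ∈ Y → walk Y ≢ []
      walk-nonempty {y} y∈ = go Y
        where
        go : ∀ l → iterate (extend Y) (take 1 Y) l ≢ []
        go [] = first Y y∈
          where
          first : ∀ Z → y ∈ Z → take 1 Z ≢ []
          first (_ ∷ _) _ ()
        go (_ ∷ l) eq with iterate (extend Y) (take 1 Y) l | go l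
        ... | []    | ne = ne refl
        ... | v ∷ p | _ with nexts Y v p
        go (_ ∷ l) () | v ∷ p | _ | []
        go (_ ∷ l) () | v ∷ p | _ | _ ∷ _

    prefixTo : ∀ {u} {l : List V} → u ∈ l → List V
    prefixTo (here {x} _)  = [ x ]
    prefixTo (there {x} i) = x ∷ prefixTo i

    prefixTo-⊆ : ∀ {u} {l : List V} (i : u ∈ l) → prefixTo i ⊆ l
    prefixTo-⊆ (here _)  (here eq)  = here eq
    prefixTo-⊆ (there i) (here eq)  = here eq
    prefixTo-⊆ (there i) (there v∈) = there (prefixTo-⊆ i v∈)

    prefixTo-unique : ∀ {u} {l : List V} (i : u ∈ l) → Unique l → Unique (prefixTo i)
    prefixTo-unique (here _)  (_ ∷ _)  = [] ∷ []
    prefixTo-unique (there i) (x≢ ∷ uq) = All.tabulate (λ v∈ → All.lookup x≢ (prefixTo-⊆ i v∈)) ∷ prefixTo-unique i uq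

    prefixTo-linked : ∀ {u x z} {l : List V} (i : u ∈ l) → Linked _~_ (x ∷ l) → u ~ z → Linked _~_ ((x ∷ prefixTo i) ∷ʳ z)
    prefixTo-linked (here refl) (xu ∷ _) uz = xu ∷ uz ∷ [-]
    prefixTo-linked (there i)   (xy ∷ l) uz = xy ∷ prefixTo-linked i l uz

    -- The head of the path has two neighbors, and by maximality both lie on the path. At least one
    -- of them is not the next vertex of the path, and the segment up to it closes to a cycle of
    -- length at least 3.
    dense⇒cycle-in-walk : ∀ {Y y} → Unique Y → Dense Y → y ∈ Y → ∃[ C ] vertices C ⊆ walk Y
    dense⇒cycle-in-walk {Y} uniq dense y∈ with walk Y in eq | walk-path {Y} | walk-nonempty y∈
    ... | []    | _ | ne = contradiction refl ne
    ... | v ∷ p | P | _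
      with u , w , u∈Y , w∈Y , u≢w , vu , vw ← dense⇒two-nbrs uniq dense (Path.within P (here refl)) =
      close p P (inRest u∈Y vu) (inRest w∈Y vw) u≢w vu vw
      where
      inRest : ∀ {u} → u ∈ Y → v ~ u → u ∈ p
      inRest u∈Y vu with walk-maximal eq u∈Y vu
      ... | here refl = contradiction vu ~-irrefl
      ... | there u∈p = u∈p
      build : ∀ r p → Path Y (v ∷ r ∷ p) → ∀ {u} → u ∈ p → v ~ u → ∃[ C ] vertices C ⊆ (v ∷ r ∷ p)
      build r p record { unique = uq ; linked = lk } u∈ vu = record
        { start    = v
        ; rest     = r ∷ prefixTo u∈
        ; long     = s≤s (nonempty u∈)
        ; distinct = prefixTo-unique (there (there u∈)) uq
        ; linked   = prefixTo-linked (there u∈) lk (~-sym vu)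
        } , prefixTo-⊆ (there (there u∈))
        where
        nonempty : ∀ {u} {l : List V} (i : u ∈ l) → 1 ≤ length (prefixTo i)
        nonempty (here _)  = s≤s z≤n
        nonempty (there _) = s≤s z≤n
      close : ∀ p → Path Y (v ∷ p) → ∀ {u w} → u ∈ p → w ∈ p → u ≢ w → v ~ u → v ~ w → ∃[ C ] vertices C ⊆ (v ∷ p)
      close (r ∷ p) P (here refl) (here refl) u≢w _  _  = contradiction refl u≢w
      close (r ∷ p) P (there u∈)  _           u≢w vu _  = build r p P u∈ vu
      close (r ∷ p) P (here _)    (there w∈)  u≢w _  vw = build r p P w∈ vw

    -- A cycle inside Y contains all of C or nothing of it. This allows a slot to be narrowed to C
    -- without deciding which member is chosen.
    Class : List V → List V → Set
    Class Y C = ∀ {Q} → Q ⊆ Y → TwoNbrs Q → ∀ {u w} → u ∈ C → w ∈ C → u ∈ Q → w ∈ Q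

    three-in-two : ∀ {l : List V} {x y z} → length l ≡ 2 → x ∈ l → y ∈ l → z ∈ l → x ≢ y → x ≢ z → y ≢ z → ⊥
    three-in-two {_ ∷ _ ∷ []} _ (here refl)         (here refl)         _                   x≢y _   _   = x≢y refl
    three-in-two {_ ∷ _ ∷ []} _ (here refl)         (there (here refl)) (here refl)         _   x≢z _   = x≢z refl
    three-in-two {_ ∷ _ ∷ []} _ (here refl)         (there (here refl)) (there (here refl)) _   _   y≢z = y≢z refl
    three-in-two {_ ∷ _ ∷ []} _ (there (here refl)) (here refl)         (here refl)         _   _   y≢z = y≢z refl
    three-in-two {_ ∷ _ ∷ []} _ (there (here refl)) (here refl)         (there (here refl)) _   x≢z _   = x≢z refl
    three-in-two {_ ∷ _ ∷ []} _ (there (here refl)) (there (here refl)) _                   x≢y _   _   = x≢y refl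

    excess-empty : ∀ (l : List V) → 2 ≤ length l → ¬ 1 ≤ length (drop 2 l) → length l ≡ 2
    excess-empty (_ ∷ [])         (s≤s ()) _
    excess-empty (_ ∷ _ ∷ [])     _        _ = refl
    excess-empty (_ ∷ _ ∷ _ ∷ _)  _        h = contradiction (s≤s z≤n) h

    -- The two neighbors of v that lie in Q are already all its neighbors in Y.
    forced : ∀ {Y Q v w} → deg Y v ≡ 2 → Q ⊆ Y → TwoNbrs Q → w ∈ Y → v ~ w → v ∈ Q → w ∈ Q
    forced {Y} {Q} {v} {w} deg≡2 Q⊆Y two w∈Y vw v∈Q
      with a , b , a∈ , b∈ , a≢b , va , vb ← two v∈Q | w ≟ a | w ≟ b
    ... | yes refl | _        = a∈
    ... | no _     | yes refl = b∈
    ... | no w≢a   | no w≢b   = ⊥-elim (three-in-two deg≡2 (nbr w∈Y vw) (nbr (Q⊆Y a∈) va) (nbr (Q⊆Y b∈) vb) w≢a w≢b a≢b)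
      where
      nbr : ∀ {u} → u ∈ Y → v ~ u → u ∈ nbrs Y v
      nbr = ∈-filter⁺ (v ~?_)

    singleton-class : ∀ {Y} v → Class Y [ v ]
    singleton-class v _ _ (here refl) (here refl) u∈ = u∈

    -- The invariant that lets the next path vertex join the open run: the run has only vertices of
    -- degree 2, and unless it is empty it begins with the head of the path so far, to which the
    -- next vertex is adjacent.
    data GroupRuns (Y : List V) (p : List V) : List (List V) → Set where
      run : ∀ {g gs} → Class Y g → All (λ v → deg Y v ≡ 2) g →
            (∀ {w g′} → g ≡ w ∷ g′ → ∃[ p′ ] p ≡ w ∷ p′) → All (Class Y) gs → GroupRuns Y p (g ∷ gs)

    groups-runs : ∀ {Y} → Dense Y → ∀ p → p ⊆ Y → Linked _~_ p → GroupRuns Y p (groups Y p)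
    groups-runs dense [] _ _ = run (λ _ _ ()) [] (λ ()) []
    groups-runs {Y} dense (v ∷ p) p⊆Y lk with groups Y p | groups-runs dense p (p⊆Y ∘ there) (tailL lk) | nonempty? (excess Y v)
      where
      tailL : ∀ {v p} → Linked _~_ (v ∷ p) → Linked _~_ p
      tailL [-]      = []
      tailL (_ ∷ lk) = lk
    ... | _ | run cls d2 hd clss | yes _ = run (λ _ _ ()) [] (λ ()) (singleton-class v ∷ cls ∷ clss)
    ... | [] ∷ _ | run cls d2 hd clss | no none =
      run (singleton-class v) (excess-empty (nbrs Y v) (dense (p⊆Y (here refl))) none ∷ [])
          (λ { refl → p , refl }) clss
    ... | (w ∷ g) ∷ _ | run cls d2@(w2 ∷ _) hd clss | no none with p′ , refl ← hd refl | vw ∷ _ ← lk =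
      run bigger (v2 ∷ d2) (λ { refl → p , refl }) clss
      where
      v2 = excess-empty (nbrs Y v) (dense (p⊆Y (here refl))) none
      v∈Y = p⊆Y (here refl)
      w∈Y = p⊆Y (there (here refl))
      -- Membership in Q passes between v and the run through w: the two are adjacent and both have
      -- degree 2.
      bigger : Class Y (v ∷ w ∷ g)
      bigger {Q} Q⊆Y two u∈ x∈ u∈Q = fromW x∈ (toW u∈ u∈Q)
        where
        toW : ∀ {u} → u ∈ v ∷ w ∷ g → u ∈ Q → w ∈ Q
        toW (here refl) u∈Q = forced v2 Q⊆Y two w∈Y vw u∈Q
        toW (there u∈)  u∈Q = cls Q⊆Y two u∈ (here refl) u∈Q
        fromW : ∀ {x} → x ∈ v ∷ w ∷ g → w ∈ Q → x ∈ Q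
        fromW (here refl) w∈Q = forced w2 Q⊆Y two v∈Y (~-sym vw) w∈Q
        fromW (there x∈)  w∈Q = cls Q⊆Y two (here refl) x∈ w∈Q

    groups-cover : ∀ {Y} p {v} → v ∈ p → ∃[ C ] (C ∈ groups Y p × v ∈ C)
    groups-cover {Y} (x ∷ p) {v} v∈ with nonempty? (excess Y x)
    groups-cover {Y} (x ∷ p) (here refl) | yes _ = [ x ] , there (here refl) , here refl
    groups-cover {Y} (x ∷ p) (there v∈) | yes _ with C , C∈ , v∈C ← groups-cover {Y} p v∈ = C , there (there C∈) , v∈C
    groups-cover {Y} (x ∷ p) (here refl) | no _ with groups Y p
    ... | []     = [ x ] , here refl , here refl
    ... | g ∷ gs = x ∷ g , here refl , here refl
    groups-cover {Y} (x ∷ p) (there v∈) | no _ with groups Y p | groups-cover {Y} p v∈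
    ... | g ∷ gs | C , here refl , v∈C = x ∷ g , here refl , there v∈C
    ... | g ∷ gs | C , there C∈  , v∈C = C , there C∈ , v∈C

    -- Only a vertex of positive excess adds groups, and it adds two; the 1 is the initial open run.
    length-groups : ∀ Y p → length (groups Y p) ≤ 1 + 2 * sumOf (length ∘ excess Y) p
    length-groups Y [] = s≤s z≤n
    length-groups Y (v ∷ p) with nonempty? (excess Y v)
    ... | yes 1≤ = begin
      2 + length (groups Y p) ≤⟨ +-monoʳ-≤ 2 (length-groups Y p) ⟩
      2 + (1 + 2 * S) ≡⟨ solve 1 (λ s → con 2 :+ (con 1 :+ con 2 :* s) := con 1 :+ con 2 :* (con 1 :+ s)) refl S ⟩
      1 + 2 * (1 + S) ≤⟨ s≤s (*-monoʳ-≤ 2 (+-monoˡ-≤ S 1≤)) ⟩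
      1 + 2 * (length (excess Y v) + S) ∎
      where
      open ≤-Reasoning
      open +-*-Solver
      S = sumOf (length ∘ excess Y) p
    ... | no _ = ≤-trans (add (groups Y p) (nonempty p)) (≤-trans (length-groups Y p) (s≤s (*-monoʳ-≤ 2 (m≤n+m _ (length (excess Y v))))))
      where
      nonempty : ∀ p → 1 ≤ length (groups Y p)
      nonempty [] = s≤s z≤n
      nonempty (x ∷ p) with nonempty? (excess Y x) | groups Y p
      ... | yes _ | _     = s≤s z≤n
      ... | no _  | []    = s≤s z≤n
      ... | no _  | _ ∷ _ = s≤s z≤n
      add : ∀ gs → 1 ≤ length gs → length (addToFirst v gs) ≤ length gs
      add (_ ∷ _) _ = ≤-refl

-- Degree counting and the number of candidates

length-filter-* : ∀ {A : Set} {P : A → Set} (P? : Unary.Decidable P) (f : A → ℕ) k {m} → (∀ x → P x → m ≤ k * f x) →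
    ∀ xs → length (filter P? xs) * m ≤ k * sumOf f xs
length-filter-* P? f k le [] = z≤n
length-filter-* P? f k le (x ∷ xs) with P? x
... | yes p = ≤-trans (+-mono-≤ (le x p) (length-filter-* P? f k le xs)) (≤-reflexive (sym (*-distribˡ-+ k (f x) (sumOf f xs))))
... | no _  = ≤-trans (length-filter-* P? f k le xs) (*-monoʳ-≤ k (m≤n+m _ (f x)))

module Counting {V : Set} (_≟_ : DecidableEquality V) {_~_ : V → V → Set} (_~?_ : Decidable _~_)
                (~-sym : ∀ {u v} → u ~ v → v ~ u) (~-irrefl : ∀ {u} → ¬ u ~ u) where

  open WithEquality _≟_
  open Graph _~?_ ~-sym ~-irrefl
  open ~Cycle using (vertices)

  indicator : ∀ {P : Set} → Dec P → ℕ
  indicator p = if does p then 1 else 0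

  indicator-⇔ : ∀ {P Q : Set} (p : Dec P) (q : Dec Q) → (P → Q) → (Q → P) → indicator p ≡ indicator q
  indicator-⇔ (yes _) (yes _) _ _ = refl
  indicator-⇔ (no _)  (no _)  _ _ = refl
  indicator-⇔ (yes p) (no ¬q) f _ = contradiction (f p) ¬q
  indicator-⇔ (no ¬p) (yes q) _ g = contradiction (g q) ¬p

  deg-sum : ∀ v Y → deg Y v ≡ sumOf (λ u → indicator (v ~? u)) Y
  deg-sum v [] = refl
  deg-sum v (u ∷ Y) with v ~? u
  ... | yes _ = cong suc (deg-sum v Y)
  ... | no  _ = deg-sum v Y

  deg-∖ : ∀ {Y u} v → Unique Y → u ∈ Y → deg Y v ≡ indicator (v ~? u) + deg (Y ∖ u) v
  deg-∖ {Y} {u} v uniq u∈ = begin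
    deg Y v ≡⟨ deg-sum v Y ⟩
    sumOf (λ u → indicator (v ~? u)) Y ≡⟨ sumOf-∖ _ uniq u∈ ⟩
    indicator (v ~? u) + sumOf (λ u → indicator (v ~? u)) (Y ∖ u) ≡⟨ cong (indicator (v ~? u) +_) (deg-sum v (Y ∖ u)) ⟨
    indicator (v ~? u) + deg (Y ∖ u) v ∎
    where open ≡-Reasoning

  degreeSum : List V → ℕ
  degreeSum Y = sumOf (deg Y) Y

  -- An edge at u is counted twice in the degree sum, once at u and once at its other end.
  degreeSum-∖ : ∀ {Y u} → Unique Y → u ∈ Y → degreeSum Y ≤ degreeSum (Y ∖ u) + 2 * deg Y u
  degreeSum-∖ {Y} {u} uniq u∈ = begin
    sumOf (deg Y) Y
      ≡⟨ sumOf-∖ (deg Y) uniq u∈ ⟩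
    deg Y u + sumOf (deg Y) (Y ∖ u)
      ≡⟨ cong (deg Y u +_) (sumOf-cong (Y ∖ u) λ {v} _ → deg-∖ v uniq u∈) ⟩
    deg Y u + sumOf (λ v → indicator (v ~? u) + deg (Y ∖ u) v) (Y ∖ u)
      ≡⟨ cong (deg Y u +_) (sumOf-+ _ (deg (Y ∖ u)) (Y ∖ u)) ⟩
    deg Y u + (sumOf (λ v → indicator (v ~? u)) (Y ∖ u) + degreeSum (Y ∖ u))
      ≡⟨ cong (λ z → deg Y u + (z + degreeSum (Y ∖ u))) (sumOf-cong (Y ∖ u) λ {v} _ → indicator-⇔ (v ~? u) (u ~? v) ~-sym ~-sym) ⟩
    deg Y u + (sumOf (λ v → indicator (u ~? v)) (Y ∖ u) + degreeSum (Y ∖ u))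
      ≡⟨ cong (λ z → deg Y u + (z + degreeSum (Y ∖ u))) (deg-sum u (Y ∖ u)) ⟨
    deg Y u + (deg (Y ∖ u) u + degreeSum (Y ∖ u))
      ≤⟨ +-monoʳ-≤ (deg Y u) (+-monoˡ-≤ _ (≤-trans (m≤n+m _ (indicator (u ~? u))) (≤-reflexive (sym (deg-∖ u uniq u∈))))) ⟩
    deg Y u + (deg Y u + degreeSum (Y ∖ u))
      ≡⟨ solve 2 (λ d w → d :+ (d :+ w) := w :+ con 2 :* d) refl (deg Y u) (degreeSum (Y ∖ u)) ⟩
    degreeSum (Y ∖ u) + 2 * deg Y u ∎
    where
    open ≤-Reasoning
    open +-*-Solver

  length-∖ : ∀ {Y u} → Unique Y → u ∈ Y → length Y ≡ suc (length (Y ∖ u))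
  length-∖ {Y} {u} uniq u∈ = begin
    length Y ≡⟨ count Y ⟨
    sumOf (λ _ → 1) Y ≡⟨ sumOf-∖ (λ _ → 1) uniq u∈ ⟩
    suc (sumOf (λ _ → 1) (Y ∖ u)) ≡⟨ cong suc (count (Y ∖ u)) ⟩
    suc (length (Y ∖ u)) ∎
    where
    open ≡-Reasoning
    count : ∀ Z → sumOf (λ _ → 1) Z ≡ length Z
    count Z = trans (sumOf-const 1 Z) (*-identityʳ (length Z))

  -- A forest has at most as many edges as vertices. Acyclicity is expressed by the absence of
  -- nonempty dense subsets: in this form it passes to subsets, and it directly provides a vertex of
  -- degree at most 1 to delete.
  degreeSum-forest : ∀ n Y → length Y ≤ n → Unique Y → (∀ {Z y} → Z ⊆ Y → Unique Z → Dense Z → y ∉ Z) →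
      degreeSum Y ≤ 2 * length Y
  degreeSum-forest n [] _ _ _ = z≤n
  degreeSum-forest (suc n) Y@(y ∷ _) (s≤s len≤) uniq acyclic with all? (2≤deg? Y) Y
  ... | yes all = contradiction (here refl) (acyclic {Y} {y} id uniq (All.lookup all))
  ... | no ¬all with v , v∈Y , deg<2 ← find (¬All⇒Any¬ (2≤deg? Y) Y ¬all) = begin
    degreeSum Y ≤⟨ degreeSum-∖ uniq v∈Y ⟩
    degreeSum (Y ∖ v) + 2 * deg Y v ≤⟨ +-mono-≤ (degreeSum-forest n (Y ∖ v)
                                                   (≤-trans (s≤s⁻¹ (≤-reflexive (sym (length-∖ uniq v∈Y)))) len≤)
                                                   (∖-unique v uniq) (λ Z⊆ → acyclic (∖-⊆ Y v ∘ Z⊆)))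
                                                   (*-monoʳ-≤ 2 (s≤s⁻¹ (≰⇒> deg<2))) ⟩
    2 * length (Y ∖ v) + 2 ≡⟨ solve 1 (λ l → con 2 :* l :+ con 2 := con 2 :* (con 1 :+ l)) refl (length (Y ∖ v)) ⟩
    2 * suc (length (Y ∖ v)) ≡⟨ cong (2 *_) (length-∖ uniq v∈Y) ⟨
    2 * length Y ∎
    where
    open ≤-Reasoning
    open +-*-Solver

  hit-tail : ∀ {u s} {Z : List V} → u ∉ Z → ∃[ w ] (w ∈ u ∷ s × w ∈ Z) → ∃[ w ] (w ∈ s × w ∈ Z)
  hit-tail u∉Z (w , here refl , w∈Z) = contradiction w∈Z u∉Z
  hit-tail u∉Z (w , there w∈s , w∈Z) = w , w∈s , w∈Z

  -- Deleting the members of `s` one by one leaves a forest. A deleted vertex u takes 2 deg ≤ 2 + 2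
  -- g u from the degree sum and 2 from twice the number of vertices, which leaves 2 g u. As degrees
  -- shrink on the way, the bound `g` is fixed in advance. `T` collects the vertices really deleted:
  -- they lie in Y, and a repetition in `s` counts once.
  degreeSum-hit : ∀ (g : V → ℕ) s {Y} → Unique Y → (∀ v → deg Y v ≤ suc (g v)) →
      (∀ {Z y} → Z ⊆ Y → Unique Z → Dense Z → y ∈ Z → ∃[ u ] (u ∈ s × u ∈ Z)) →
      ∃[ T ] ((∀ {u} → u ∈ T → u ∈ s × u ∈ Y) × length T ≤ length s ×
      degreeSum Y ≤ 2 * length Y + sumOf (λ u → 2 * g u) T)
  degreeSum-hit g [] {Y} uniq deg≤ hit = [] , (λ ()) , z≤n ,
    ≤-trans (degreeSum-forest (length Y) Y ≤-refl uniq (λ Z⊆ uZ dZ y∈ → none (hit Z⊆ uZ dZ y∈))) (m≤m+n _ 0)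
    where
    none : ∀ {Z} → ¬ (∃[ u ] (u ∈ [] × u ∈ Z))
    none (_ , () , _)
  degreeSum-hit g (u ∷ s) {Y} uniq deg≤ hit with u ∈? Y
  ... | no u∉ with T , T⊆ , len , le ← degreeSum-hit g s uniq deg≤
                     (λ Z⊆ uZ dZ y∈ → hit-tail (u∉ ∘ Z⊆) (hit Z⊆ uZ dZ y∈)) =
    T , (λ v∈ → there (proj₁ (T⊆ v∈)) , proj₂ (T⊆ v∈)) , m≤n⇒m≤1+n len , le
  ... | yes u∈ with T , T⊆ , len , le ← degreeSum-hit g s {Y ∖ u} (∖-unique u uniq)
                     (λ v → ≤-trans (≤-trans (m≤n+m _ (indicator (v ~? u))) (≤-reflexive (sym (deg-∖ v uniq u∈)))) (deg≤ v))
                     (λ Z⊆ uZ dZ y∈ → hit-tail (λ u∈Z → ∖-≢ {Y} (Z⊆ u∈Z) refl) (hit (∖-⊆ Y u ∘ Z⊆) uZ dZ y∈)) =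
    u ∷ T , (λ { (here refl) → here refl , u∈ ; (there v∈) → there (proj₁ (T⊆ v∈)) , ∖-⊆ Y u (proj₂ (T⊆ v∈)) }) , s≤s len , (begin
      degreeSum Y ≤⟨ degreeSum-∖ uniq u∈ ⟩
      degreeSum (Y ∖ u) + 2 * deg Y u ≤⟨ +-mono-≤ le (*-monoʳ-≤ 2 (deg≤ u)) ⟩
      2 * length (Y ∖ u) + sumOf (λ u → 2 * g u) T + 2 * suc (g u)
        ≡⟨ solve 3 (λ l t g → con 2 :* l :+ t :+ con 2 :* (con 1 :+ g) := con 2 :* (con 1 :+ l) :+ (con 2 :* g :+ t)) refl
             (length (Y ∖ u)) (sumOf (λ u → 2 * g u) T) (g u) ⟩
      2 * suc (length (Y ∖ u)) + sumOf (λ u → 2 * g u) (u ∷ T) ≡⟨ cong (λ z → 2 * z + sumOf (λ u → 2 * g u) (u ∷ T)) (length-∖ uniq u∈) ⟨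
      2 * length Y + sumOf (λ u → 2 * g u) (u ∷ T) ∎)
    where
    open ≤-Reasoning
    open +-*-Solver

  length-drop-2 : ∀ (l : List V) → length l ≤ 2 + length (drop 2 l)
  length-drop-2 []          = z≤n
  length-drop-2 (_ ∷ [])    = s≤s z≤n
  length-drop-2 (_ ∷ _ ∷ l) = ≤-refl

  length-drop-2-≡ : ∀ (l : List V) → 2 ≤ length l → length l ≡ 2 + length (drop 2 l)
  length-drop-2-≡ (_ ∷ [])    (s≤s ())
  length-drop-2-≡ (_ ∷ _ ∷ l) _ = refl

  degreeSum-dense : ∀ {Y} → Dense Y → degreeSum Y ≡ 2 * length Y + length (surplus Y)
  degreeSum-dense {Y} dense = begin
    sumOf (deg Y) Y ≡⟨ sumOf-cong Y (λ {v} v∈ → length-drop-2-≡ (nbrs Y v) (dense v∈)) ⟩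
    sumOf (λ v → 2 + length (excess Y v)) Y ≡⟨ sumOf-+ (λ _ → 2) (length ∘ excess Y) Y ⟩
    sumOf (λ _ → 2) Y + sumOf (length ∘ excess Y) Y ≡⟨ cong₂ _+_ (trans (sumOf-const 2 Y) (*-comm (length Y) 2)) (sym (length-concatMap (excess Y) Y)) ⟩
    2 * length Y + length (surplus Y) ∎
    where open ≡-Reasoning

  length-weight : ∀ {A : Set} Y (pend : List A) v → length (weight Y pend v) ≡ length pend * (2 * suc (length (excess Y v)))
  length-weight Y pend v = begin
    length (weight Y pend v) ≡⟨ length-concatMap (λ _ → (v ∷ ex) ++ (v ∷ ex)) pend ⟩
    sumOf (λ _ → length ((v ∷ ex) ++ (v ∷ ex))) pend ≡⟨ sumOf-const (length ((v ∷ ex) ++ (v ∷ ex))) pend ⟩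
    length pend * length ((v ∷ ex) ++ (v ∷ ex))
      ≡⟨ cong (length pend *_) (trans (length-++ (v ∷ ex) {v ∷ ex}) (cong (suc (length ex) +_) (sym (+-identityʳ (suc (length ex)))))) ⟩
    length pend * (2 * suc (length ex)) ∎
    where
    open ≡-Reasoning
    ex = excess Y v

  private
    light? : ∀ {A : Set} Y (pend : List A) → Unary.Decidable (λ v → ¬ length (weight Y pend v) < length (surplus Y))
    light? Y pend v = ¬? (shorter? (weight Y pend v) (surplus Y))

  hit-dense : ∀ {s Y} → (∀ C → vertices C ⊆ Y → ∃[ u ] (u ∈ s × u ∈ vertices C)) →
      ∀ {Z y} → Z ⊆ Y → Unique Z → Dense Z → y ∈ Z → ∃[ u ] (u ∈ s × u ∈ Z)
  hit-dense hit {Z} Z⊆ uZ dZ z∈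
    with C , C⊆ ← dense⇒cycle-in-walk uZ dZ z∈
    with u , u∈s , u∈C ← hit C (λ v∈ → Z⊆ (Path.within (walk-path {Z}) (C⊆ v∈))) =
    u , u∈s , Path.within (walk-path {Z}) (C⊆ u∈C)

  candidates-hit : ∀ {A : Set} {Y} {pend : List A} {y} s → Unique Y → Dense Y → y ∈ Y → length s ≤ length pend →
      (∀ C → vertices C ⊆ Y → ∃[ u ] (u ∈ s × u ∈ vertices C)) →
      ∃[ C ] (C ∈ candidates Y pend × ∃[ u ] (u ∈ s × u ∈ C))
  candidates-hit {Y = Y} {pend} s uniq dense y∈ len≤ hit with shorter? (pend ++ pend) (surplus Y)
  ... | no _ with C , C⊆ ← dense⇒cycle-in-walk uniq dense y∈
    with u , u∈s , u∈C ← hit C (Path.within (walk-path {Y}) ∘ C⊆)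
    with D , D∈ , u∈D ← groups-cover {Y} (walk Y) (C⊆ u∈C) = D , D∈ , u , u∈s , u∈D
  ... | yes 2κ<E
    with T , T⊆ , lenT , le ← degreeSum-hit (λ v → suc (length (excess Y v))) s uniq (λ v → length-drop-2 (nbrs Y v))
           (hit-dense hit)
    with u , u∈T , heavy ← heavy-summand (λ u → 2 * suc (length (excess Y u))) T (≤-trans lenT len≤)
           (≤-trans (s≤s z≤n) 2κ<E)
           -- Both bounds on the degree sum contain twice the number of vertices. Without it they
           -- say E ≤ Σ 2 (1 + e(u)) over `T`.
           (+-cancelˡ-≤ (2 * length Y) _ _ (≤-trans (≤-reflexive (sym (degreeSum-dense dense))) le)) =
    [ u ] , ∈-map⁺ [_] (∈-filter⁺ (light? Y pend) (proj₂ (T⊆ u∈T))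
      (≤⇒≯ (≤-trans heavy (≤-reflexive (sym (length-weight Y pend u)))))) , u , proj₁ (T⊆ u∈T) , here refl

  candidates-class : ∀ {A : Set} {Y} {pend : List A} → Dense Y → ∀ {C} → C ∈ candidates Y pend → Class Y C
  candidates-class {Y = Y} {pend} dense {C} C∈ with shorter? (pend ++ pend) (surplus Y)
  ... | yes _ with v , _ , refl ← ∈-map⁻ [_] C∈ = singleton-class v
  ... | no _ with groups Y (walk Y) | groups-runs dense (walk Y) (Path.within (walk-path {Y})) (Path.linked (walk-path {Y}))
  candidates-class dense (here refl) | no _ | _ ∷ _ | run cls _ _ _ = cls
  candidates-class dense (there C∈)  | no _ | _ ∷ _ | run _ _ _ clss = All.lookup clss C∈

  -- If E > 2κ, then E ≤ 2κ(1 + e(v)) forces e(v) ≥ 1, thus 1 + e(v) ≤ 2 e(v) and E ≤ 4κ e(v). As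
  -- the e(v) add up to E, at most 4κ vertices qualify. If E ≤ 2κ, there are at most 1 + 2E ≤ 1 + 4κ
  -- groups.
  length-candidates : ∀ {A : Set} {Y} {pend : List A} → length (candidates Y pend) ≤ 1 + 4 * length pend
  length-candidates {Y = Y} {pend} with shorter? (pend ++ pend) (surplus Y)
  ... | no 2κ≮E = begin
    length (groups Y (walk Y)) ≤⟨ length-groups Y (walk Y) ⟩
    1 + 2 * sumOf (length ∘ excess Y) (walk Y) ≤⟨ s≤s (*-monoʳ-≤ 2 (sumOf-⊆ (length ∘ excess Y) (Path.unique (walk-path {Y})) (Path.within (walk-path {Y})))) ⟩
    1 + 2 * sumOf (length ∘ excess Y) Y ≡⟨ cong (λ z → 1 + 2 * z) (length-concatMap (excess Y) Y) ⟨
    1 + 2 * length (surplus Y) ≤⟨ s≤s (*-monoʳ-≤ 2 (≮⇒≥ 2κ≮E)) ⟩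
    1 + 2 * length (pend ++ pend) ≡⟨ cong (λ z → 1 + 2 * z) (length-++ pend) ⟩
    1 + 2 * (length pend + length pend) ≡⟨ solve 1 (λ κ → con 1 :+ con 2 :* (κ :+ κ) := con 1 :+ con 4 :* κ) refl (length pend) ⟩
    1 + 4 * length pend ∎
    where
    open ≤-Reasoning
    open +-*-Solver
  ... | yes 2κ<E = m≤n⇒m≤1+n (*-cancelʳ-≤ _ _ E {{>-nonZero (≤-trans (s≤s z≤n) 2κ<E)}} (begin
    length (map [_] (filter (light? Y pend) Y)) * E ≡⟨ cong (_* E) (length-map [_] (filter (light? Y pend) Y)) ⟩
    length (filter (light? Y pend) Y) * E ≤⟨ length-filter-* (light? Y pend) (length ∘ excess Y) (4 * κ) (λ v l → light-≤ _ (≤-trans (≮⇒≥ l) (≤-reflexive (length-weight Y pend v)))) Y ⟩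
    4 * κ * sumOf (length ∘ excess Y) Y ≡⟨ cong (4 * κ *_) (length-concatMap (excess Y) Y) ⟨
    4 * κ * E ∎))
    where
    open ≤-Reasoning
    open +-*-Solver
    E = length (surplus Y)
    κ = length pend
    κ+κ<E : κ + κ < E
    κ+κ<E = ≤-trans (s≤s (≤-reflexive (sym (length-++ pend)))) 2κ<E
    -- An excess of 0 would give E ≤ 2 κ.
    light-≤ : ∀ e → E ≤ κ * (2 * suc e) → E ≤ 4 * κ * e
    light-≤ zero le = contradiction (≤-trans κ+κ<E le) (<-irrefl (solve 1 (λ κ → κ :+ κ := κ :* con 2) refl κ))
    light-≤ (suc e) le = ≤-trans le (≤-trans (m≤m+n _ (κ * (2 * e))) (≤-reflexive
      (solve 2 (λ κ e → κ :* (con 2 :* (con 2 :+ e)) :+ κ :* (con 2 :* e) := con 4 :* κ :* (con 1 :+ e)) refl κ e)))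

-- The search through the states

∈-concatMap : ∀ {A B : Set} (f : A → List B) {x y xs} → x ∈ xs → y ∈ f x → y ∈ concatMap f xs
∈-concatMap f x∈ y∈ = ∈-concatMap⁺ f (lose x∈ y∈)

length-filter-tabulate : ∀ {m} {A : Set} {P : A → Set} (P? : Unary.Decidable P) (f : Fin m → A) (S : Subset m) →
    (∀ i → P (f i) → Vec.lookup S i ≡ true) → (∀ i → Vec.lookup S i ≡ true → P (f i)) →
    length (filter P? (tabulate f)) ≡ ∣ S ∣
length-filter-tabulate P? f [] _ _ = refl
length-filter-tabulate P? f (x ∷ S) to from with P? (f zero) | x in eq
... | yes _ | true  = cong suc (length-filter-tabulate P? (f ∘ suc) S (to ∘ suc) (from ∘ suc))
... | no _  | false = length-filter-tabulate P? (f ∘ suc) S (to ∘ suc) (from ∘ suc)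
... | yes p | false with () ← to zero p
... | no ¬p | true  = contradiction (from zero refl) ¬p

nth : ∀ {A : Set} → List A → ℕ → A → A
nth []       _       d = d
nth (x ∷ xs) zero    d = x
nth (x ∷ xs) (suc i) d = nth xs i d

∈⇒nth : ∀ {A : Set} {x : A} {xs} → x ∈ xs → ∃[ i ] (i < length xs × (∀ d → nth xs i d ≡ x))
∈⇒nth (here refl) = 0 , s≤s z≤n , λ _ → refl
∈⇒nth (there x∈) with i , i< , eq ← ∈⇒nth x∈ = suc i , s≤s i< , eq

module Search {h : ℕ} (G : EdgeColoredGraph h) where
  open EdgeColoredGraph G

  V : Set
  V = Fin n

  _~[_]?_ : ∀ u c v → Dec (ColoredEdge G c u v)
  u ~[ c ]? v = ≡-dec Fin._≟_ (color u v) (just c)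

  coloredEdge-sym : ∀ {c u v} → ColoredEdge G c u v → ColoredEdge G c v u
  coloredEdge-sym {u = u} {v} e = trans (symmetric v u) e

  coloredEdge-irrefl : ∀ {c u} → ¬ ColoredEdge G c u u
  coloredEdge-irrefl {u = u} e with () ← trans (sym (loopless u)) e

  open WithEquality (Fin._≟_ {n})

  module Color (c : Fin h) where
    open Graph (λ u v → u ~[ c ]? v) coloredEdge-sym coloredEdge-irrefl public
    open Counting Fin._≟_ (λ u v → u ~[ c ]? v) coloredEdge-sym coloredEdge-irrefl public

  open Color using (strip; candidates; ~Cycle)
  open Color.~Cycle using (vertices)

  Slot : Set
  Slot = V × List V

  -- One vertex of the solution, if any is allowed at all, is fixed in the
  -- first component. The others are known by their slots: the vertex in
  -- slot (i , D) is to be chosen from D.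
  State : Set
  State = List V × List Slot

  -- While a color is treated: the fixed vertex, the vertices that can lie
  -- on a cycle not hit so far, the slots not used so far for this color,
  -- and all slots.
  ColorState : Set
  ColorState = List V × List V × List V × List Slot

  restrictSlot : V → List V → Slot → Slot
  restrictSlot i C (j , D) = j , (if does (j Fin.≟ i) then filter (_∈? C) D else D)

  restrict : V → List V → List Slot → List Slot
  restrict i C = map (restrictSlot i C)

  branch : List V → List V → List V → List Slot → List V → List ColorState
  branch vs Y pend slots C = map (λ i → vs , Y ∖∖ C , pend ∖ i , restrict i C slots) pend

  expand : Fin h → ColorState → List ColorState
  expand c st@(vs , Y , pend , slots) =
    if does (nonempty? (strip c Y))
    then concatMap (branch vs (strip c Y) pend slots) (candidates c (strip c Y) pend)
    else [ st ]

  start : List V → State → ColorState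
  start ids (vs , slots) = vs , allFin n ∖∖ vs , ids , slots

  -- Every expansion of an unfinished state uses up a slot, so a state whose core is still nonempty
  -- after κ expansions has failed for this color.
  finish : Fin h → ColorState → List State
  finish c (vs , Y , pend , slots) = if does (nonempty? (strip c Y)) then [] else [ (vs , slots) ]

  expansions : Fin h → List V → List State → List ColorState
  expansions c ids sts = iterate (concatMap (expand c)) (map (start ids) sts) ids

  round : List V → Fin h → List State → List State
  round ids c sts = concatMap (finish c) (expansions c ids sts)

  edgeColor : V × V × Fin h → Fin h
  edgeColor (_ , _ , c) = c

  addColor : V × V × Fin h → List (Fin h) → List (Fin h)
  addColor e cs = if does (any? (edgeColor e Fin.≟_) cs) then cs else edgeColor e ∷ cs

  -- `h` is given in binary, so a loop over all colors could be exponentially long. A color without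
  -- edges has no cycles.
  usedColors : List (Fin h)
  usedColors = foldr addColor [] (coloredEdges G)

  below? : ∀ k → Unary.Decidable {A = V} (λ v → toℕ v < k)
  below? k v = toℕ v <? k

  -- Vertices serve as mere labels of slots. However large `k` is, at most n labels arise; this
  -- matters because `k`, too, is given in binary.
  firstIds : ℕ → List V
  firstIds k = filter (below? k) (allFin n)

  initial : List V → List State
  initial []        = [ ([] , []) ]
  initial (_ ∷ ids) = map (λ v → [ v ] , map (_, allFin n) ids) (allFin n)

  search : ℕ → List State
  search k = foldr (round (drop 1 (firstIds k))) (initial (firstIds k)) usedColors

  Feasible : State → Set
  Feasible (_ , slots) = All (λ (_ , D) → 1 ≤ length D) slots

  feasible? : Unary.Decidable Feasible
  feasible? (_ , slots) = all? (λ (_ , D) → nonempty? D) slots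

  -- Every assignment that fits a final state is a solution, so the first value of each slot will
  -- do.
  choice : State → List V
  choice (vs , slots) = vs ++ concatMap (λ (_ , D) → take 1 D) slots

  chosen : State → Subset n
  chosen st = Vec.tabulate (λ v → does (v ∈? choice st))

  firstAnswer : List State → Maybe (Subset n)
  firstAnswer []       = nothing
  firstAnswer (st ∷ _) = just (chosen st)

  answer : ℕ → Maybe (Subset n)
  answer k = firstAnswer (filter feasible? (search k))

  -- Soundness and completeness for one color

  Fits : (V → V) → List Slot → Set
  Fits s slots = All (λ (i , D) → s i ∈ D) slots

  Meets : ∀ {c} → List V → ~Cycle c → Set
  Meets {c} W C = ∃[ u ] (u ∈ W × u ∈ vertices c C)

  restrict-ids : ∀ i C slots → map proj₁ (restrict i C slots) ≡ map proj₁ slots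
  restrict-ids i C []          = refl
  restrict-ids i C (_ ∷ slots) = cong (_ ∷_) (restrict-ids i C slots)

  restrict-fits⁻ : ∀ {s i C} slots → Fits s (restrict i C slots) → Fits s slots
  restrict-fits⁻ [] [] = []
  restrict-fits⁻ {i = i} {C} ((j , D) ∷ slots) (p ∷ ps) with j Fin.≟ i
  ... | yes _ = proj₁ (∈-filter⁻ (_∈? C) p) ∷ restrict-fits⁻ slots ps
  ... | no _  = p ∷ restrict-fits⁻ slots ps

  restrict-fits⁺ : ∀ {s i C} slots → s i ∈ C → Fits s slots → Fits s (restrict i C slots)
  restrict-fits⁺ [] si∈ [] = []
  restrict-fits⁺ {i = i} {C} ((j , D) ∷ slots) si∈ (p ∷ ps) with j Fin.≟ i
  ... | yes refl = ∈-filter⁺ (_∈? C) p si∈ ∷ restrict-fits⁺ slots si∈ ps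
  ... | no _     = p ∷ restrict-fits⁺ slots si∈ ps

  restrict-∈ : ∀ {s i C} slots → i ∈ map proj₁ slots → Fits s (restrict i C slots) → s i ∈ C
  restrict-∈ {i = i} {C} ((j , D) ∷ slots) i∈ (p ∷ ps) with j Fin.≟ i
  restrict-∈ {C = C} ((j , D) ∷ slots) i∈           (p ∷ ps) | yes refl = proj₂ (∈-filter⁻ (_∈? C) {xs = D} p)
  restrict-∈         ((j , D) ∷ slots) (here refl)  (p ∷ ps) | no j≢j   = contradiction refl j≢j
  restrict-∈         ((j , D) ∷ slots) (there i∈)   (p ∷ ps) | no _     = restrict-∈ slots i∈ ps

  nonempty⇒∈ : ∀ {A : Set} {xs : List A} → 1 ≤ length xs → ∃[ x ] x ∈ xs
  nonempty⇒∈ {xs = x ∷ _} _ = x , here refl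

  ∉-∖∖ : ∀ {Q C Y} → Q ⊆ Y → ¬ Any (_∈ C) Q → Q ⊆ Y ∖∖ C
  ∉-∖∖ {C = C} Q⊆Y none v∈ = ∈-filter⁺ (∉? C) (Q⊆Y v∈) (λ v∈C → none (lose v∈ v∈C))

  ∖∖-⊆ : ∀ {Y C} → (Y ∖∖ C) ⊆ Y
  ∖∖-⊆ {C = C} = proj₁ ∘ ∈-filter⁻ (∉? C)

  empty-∉ : ∀ {A : Set} (xs : List A) → ¬ 1 ≤ length xs → ∀ {x} → x ∉ xs
  empty-∉ (_ ∷ _) h _ = h (s≤s z≤n)

  module _ (c : Fin h) (ids : List V) where

    open Color c hiding (strip; candidates; ~Cycle)

    -- `covers` speaks of all assignments that still fit, so a state stands for many potential
    -- solutions at once; a cycle that leaves Y is hit by each of them.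
    record Sound (st : State) (cst : ColorState) : Set where
      private
        vs    = proj₁ cst
        Y     = proj₁ (proj₂ cst)
        pend  = proj₁ (proj₂ (proj₂ cst))
        slots = proj₂ (proj₂ (proj₂ cst))
      field
        same    : vs ≡ proj₁ st
        ids≡    : map proj₁ slots ≡ map proj₁ (proj₂ st)
        refines : ∀ {s} → Fits s slots → Fits s (proj₂ st)
        unique  : Unique Y
        pend⊆   : pend ⊆ ids
        covers  : ∀ {s} → Fits s slots → (C : ~Cycle c) → vertices c C ⊆ Y ⊎ Meets (vs ++ map s ids) C

    start-sound : ∀ st → Sound st (start ids st)
    start-sound (vs , slots) = record
      { same    = refl
      ; ids≡    = refl
      ; refines = id
      ; unique  = filter⁺ (∉? vs) (allFin⁺ n)
      ; pend⊆   = id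
      ; covers  = λ {s} _ C → covers s C
      }
      where
      covers : ∀ s C → vertices c C ⊆ (allFin n ∖∖ vs) ⊎ Meets (vs ++ map s ids) C
      covers s C with any? (_∈? vs) (vertices c C)
      ... | no none = inj₁ (∉-∖∖ (λ _ → ∈-allFin _) none)
      ... | yes p with u , u∈C , u∈vs ← find p = inj₂ (u , ∈-++⁺ˡ u∈vs , u∈C)

    branch-sound : ∀ {st vs Y pend slots C} → Sound st (vs , Y , pend , slots) → ids ⊆ map proj₁ (proj₂ st) →
        C ∈ candidates c (strip c Y) pend → ∀ {cst} → cst ∈ branch vs (strip c Y) pend slots C → Sound st cst
    branch-sound {st} {vs} {Y} {pend} {slots} {C} snd ids⊆ C∈ cst∈ with i , i∈ , refl ← ∈-map⁻ _ cst∈ = record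
      { same    = same
      ; ids≡    = trans (restrict-ids i C slots) ids≡
      ; refines = refines ∘ restrict-fits⁻ slots
      ; unique  = filter⁺ (∉? C) (strip-unique unique)
      ; pend⊆   = pend⊆ ∘ ∖-⊆ pend i
      ; covers  = covers′
      }
      where
      open Sound snd
      covers′ : ∀ {s} → Fits s (restrict i C slots) → ∀ D → vertices c D ⊆ (strip c Y ∖∖ C) ⊎ Meets (vs ++ map s ids) D
      covers′ {s} fits D with covers (restrict-fits⁻ slots fits) D
      ... | inj₂ meets = inj₂ meets
      ... | inj₁ D⊆Y with any? (_∈? C) (vertices c D)
      ...   | no none = inj₁ (∉-∖∖ (two-nbrs⊆strip (cycle-two-nbrs D) D⊆Y) none)
      -- D meets C in u, and slot i can now only take values in C. As C is a class, D contains that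
      -- value too.
      ...   | yes p with u , u∈D , u∈C ← find p = inj₂
        ( s i
        , ∈-++⁺ʳ vs (∈-map⁺ s (pend⊆ i∈))
        , candidates-class {pend = pend} (strip-dense Y) C∈ (two-nbrs⊆strip (cycle-two-nbrs D) D⊆Y) (cycle-two-nbrs D) u∈C
            (restrict-∈ slots (subst (i ∈_) (sym ids≡) (ids⊆ (pend⊆ i∈))) fits) u∈D
        )

    expand-sound : ∀ {st cst cst′} → ids ⊆ map proj₁ (proj₂ st) → Sound st cst → cst′ ∈ expand c cst → Sound st cst′
    expand-sound {cst = vs , Y , pend , slots} ids⊆ snd cst′∈ with nonempty? (strip c Y)
    expand-sound {cst = vs , Y , pend , slots} ids⊆ snd (here refl) | no _ = snd
    ... | yes _ with C , C∈ , ∈C ← find (∈-concatMap⁻ (branch vs (strip c Y) pend slots) cst′∈) =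
      branch-sound snd ids⊆ C∈ ∈C

    expansions-sound : ∀ {sts} → (∀ {st} → st ∈ sts → ids ⊆ map proj₁ (proj₂ st)) → ∀ {cst} →
        cst ∈ expansions c ids sts → ∃[ st ] (st ∈ sts × Sound st cst)
    expansions-sound {sts} ids⊆ = go ids
      where
      go : ∀ (l : List V) {cst} → cst ∈ iterate (concatMap (expand c)) (map (start ids) sts) l → ∃[ st ] (st ∈ sts × Sound st cst)
      go [] cst∈ with st , st∈ , refl ← ∈-map⁻ (start ids) cst∈ = st , st∈ , start-sound st
      go (_ ∷ l) cst∈
        with cst′ , cst′∈ , ∈cst′ ← find (∈-concatMap⁻ (expand c) {xs = iterate (concatMap (expand c)) (map (start ids) sts) l} cst∈)
        with st , st∈ , snd ← go l cst′∈ = st , st∈ , expand-sound (ids⊆ st∈) snd ∈cst′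

    record Refinement (st st′ : State) : Set where
      field
        same    : proj₁ st′ ≡ proj₁ st
        ids≡    : map proj₁ (proj₂ st′) ≡ map proj₁ (proj₂ st)
        refines : ∀ {s} → Fits s (proj₂ st′) → Fits s (proj₂ st)
        hits    : ∀ {s} → Fits s (proj₂ st′) → (C : ~Cycle c) → Meets (proj₁ st′ ++ map s ids) C

    round-sound : ∀ {sts} → (∀ {st} → st ∈ sts → ids ⊆ map proj₁ (proj₂ st)) → ∀ {st′} →
        st′ ∈ round ids c sts → ∃[ st ] (st ∈ sts × Refinement st st′)
    round-sound {sts} ids⊆ {st′} st′∈
      with cst@(vs , Y , pend , slots) , cst∈ , ∈cst ← find (∈-concatMap⁻ (finish c) {xs = expansions c ids sts} st′∈)
      with st , st∈ , snd ← expansions-sound {sts} ids⊆ cst∈ = st , st∈ , finished ∈cst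
      where
      finished : ∀ {st′} → st′ ∈ finish c cst → Refinement st st′
      finished st′∈ with nonempty? (strip c Y)
      finished (here refl) | no none = record
        { same = Sound.same snd ; ids≡ = Sound.ids≡ snd ; refines = Sound.refines snd ; hits = hits′ }
        where
        hits′ : ∀ {s} → Fits s slots → ∀ C → Meets (vs ++ map s ids) C
        hits′ fits C with Sound.covers snd fits C
        ... | inj₂ meets = meets
        ... | inj₁ C⊆Y = contradiction (two-nbrs⊆strip (cycle-two-nbrs C) C⊆Y (here refl)) (empty-∉ (strip c Y) none)

    -- Here one assignment is fixed. What is left of the graph has to be hit by the pending slots
    -- alone, since each expansion deletes all that a used slot is held responsible for.
    record Solves (s : V → V) (vs₀ : List V) (cst : ColorState) : Set where
      private
        Y     = proj₁ (proj₂ cst)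
        pend  = proj₁ (proj₂ (proj₂ cst))
        slots = proj₂ (proj₂ (proj₂ cst))
      field
        same   : proj₁ cst ≡ vs₀
        unique : Unique Y
        fits   : Fits s slots
        hits   : (C : ~Cycle c) → vertices c C ⊆ Y → Meets (map s pend) C

    Finished : ColorState → Set
    Finished (_ , Y , _) = ¬ 1 ≤ length (strip c Y)

    Within : ℕ → ColorState → Set
    Within m cst@(_ , _ , pend , _) = Finished cst ⊎ length pend ≤ m

    -- Some candidate contains the value of a pending slot i. The branch for this pair keeps `s`
    -- fitting and has one pending slot less. A finished state passes through unchanged, whence the
    -- alternative in `Within`.
    expand-complete : ∀ {s vs₀ m cst} → Solves s vs₀ cst → Within (suc m) cst →
        ∃[ cst′ ] (cst′ ∈ expand c cst × Solves s vs₀ cst′ × Within m cst′)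
    expand-complete {cst = cst@(vs , Y , pend , slots)} sol within with nonempty? (strip c Y)
    ... | no none = cst , here refl , sol , inj₁ none
    expand-complete sol (inj₁ none) | yes some = contradiction some none
    expand-complete {s} {vs₀} {m} {vs , Y , pend , slots} sol (inj₂ len≤) | yes some
      with y , y∈ ← nonempty⇒∈ some
      with C , C∈ , u , u∈s , u∈C ← candidates-hit {pend = pend} (map s pend) (strip-unique (Solves.unique sol)) (strip-dense Y) y∈
             (≤-reflexive (length-map s pend)) (λ D D⊆ → Solves.hits sol D (λ v∈ → strip-⊆ (D⊆ v∈)))
      with i , i∈ , refl ← ∈-map⁻ s u∈s =
      _ , ∈-concatMap (branch vs (strip c Y) pend slots) C∈ (∈-map⁺ _ i∈) , record
        { same   = Solves.same sol
        ; unique = filter⁺ (∉? C) (strip-unique (Solves.unique sol))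
        ; fits   = restrict-fits⁺ slots u∈C (Solves.fits sol)
        ; hits   = hits′
        } , inj₂ (s≤s⁻¹ (≤-trans (filter-notAll (≢? i) pend (lose i∈ (λ ne → ne refl))) len≤))
      where
      -- A cycle that avoids C avoids the value of slot i, so another pending slot hits it.
      hits′ : ∀ D → vertices c D ⊆ (strip c Y ∖∖ C) → Meets (map s (pend ∖ i)) D
      hits′ D D⊆ with w , w∈s , w∈D ← Solves.hits sol D (λ v∈ → strip-⊆ (∖∖-⊆ {strip c Y} (D⊆ v∈)))
        with j , j∈ , refl ← ∈-map⁻ s w∈s =
        s j , ∈-map⁺ s (∈-∖ j∈ λ { refl → proj₂ (∈-filter⁻ (∉? C) {xs = strip c Y} (D⊆ w∈D)) u∈C }) , w∈D

    expansions-complete : ∀ {s vs₀ m} (l : List V) {csts cst} → cst ∈ csts → Solves s vs₀ cst → Within (length l + m) cst →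
        ∃[ cst′ ] (cst′ ∈ iterate (concatMap (expand c)) csts l × Solves s vs₀ cst′ × Within m cst′)
    expansions-complete [] cst∈ sol within = _ , cst∈ , sol , within
    expansions-complete {m = m} (_ ∷ l) {cst = cst} cst∈ sol within
      with cst₁ , cst₁∈ , sol₁ , within₁ ← expansions-complete {m = suc m} l cst∈ sol (subst (λ k → Within k cst) (sym (+-suc (length l) m)) within)
      with cst₂ , cst₂∈ , sol₂ , within₂ ← expand-complete sol₁ within₁ =
      cst₂ , ∈-concatMap (expand c) cst₁∈ cst₂∈ , sol₂ , within₂

    -- Without pending slots a nonempty core would contain a cycle that nothing hits.
    finished : ∀ {s vs₀ cst} → Solves s vs₀ cst → Within 0 cst → Finished cst
    finished sol (inj₁ none) = none
    finished {cst = vs , Y , [] , slots} sol (inj₂ _) some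
      with y , y∈ ← nonempty⇒∈ some
      with C , C⊆ ← dense⇒cycle-in-walk (strip-unique (Solves.unique sol)) (strip-dense Y) y∈
      with Solves.hits sol C (λ v∈ → strip-⊆ (Path.within (walk-path {strip c Y}) (C⊆ v∈)))
    ... | _ , () , _

    start-solves : ∀ {s vs slots} → Fits s slots → ((C : ~Cycle c) → Meets (vs ++ map s ids) C) →
        Solves s vs (start ids (vs , slots))
    start-solves {s} {vs} fits hits =
      record { same = refl ; unique = filter⁺ (∉? vs) (allFin⁺ n) ; fits = fits ; hits = hits′ }
      where
      hits′ : ∀ C → vertices c C ⊆ (allFin n ∖∖ vs) → Meets (map s ids) C
      hits′ C C⊆ with u , u∈ , u∈C ← hits C with ∈-++⁻ vs u∈
      ... | inj₁ u∈vs = contradiction u∈vs (proj₂ (∈-filter⁻ (∉? vs) {xs = allFin n} (C⊆ u∈C)))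
      ... | inj₂ u∈s  = u , u∈s , u∈C

    round-complete : ∀ {s sts vs slots} → (vs , slots) ∈ sts → Fits s slots → ((C : ~Cycle c) → Meets (vs ++ map s ids) C) →
        ∃[ slots′ ] ((vs , slots′) ∈ round ids c sts × Fits s slots′)
    round-complete {s} {sts} {vs} {slots} st∈ fits hits
      with (_ , Y , pend , slots′) , cst∈ , sol , within ← expansions-complete {m = 0} ids (∈-map⁺ (start ids) st∈) (start-solves fits hits) (inj₂ (≤-reflexive (sym (+-identityʳ _))))
      with none ← finished sol within | refl ← Solves.same sol =
      slots′ , ∈-concatMap (finish c) cst∈ done , Solves.fits sol
      where
      done : (vs , slots′) ∈ finish c (vs , Y , pend , slots′)
      done with nonempty? (strip c Y)
      ... | yes some = contradiction some none
      ... | no _     = here refl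

  -- All colors together

  record Handled (ids : List V) (cs : List (Fin h)) (st : State) : Set where
    field
      ids≡ : map proj₁ (proj₂ st) ≡ ids
      hits : ∀ {c s} → c ∈ cs → Fits s (proj₂ st) → (C : ~Cycle c) → Meets (proj₁ st ++ map s ids) C

  -- Later rounds only shrink the slots, so an assignment that fits at the end fits at every earlier
  -- stage and hits the cycles of the colors treated there.
  rounds-sound : ∀ {ids sts} → (∀ {st} → st ∈ sts → map proj₁ (proj₂ st) ≡ ids) → ∀ cs {st′} →
      st′ ∈ foldr (round ids) sts cs → Handled ids cs st′ × ∃[ st ] (st ∈ sts × proj₁ st′ ≡ proj₁ st)
  rounds-sound ids≡ [] st∈ = record { ids≡ = ids≡ st∈ ; hits = λ () } , _ , st∈ , refl
  rounds-sound {ids} {sts} ids≡ (c ∷ cs) {st′} st′∈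
    with st , st∈ , ref ← round-sound c ids (λ st∈ {v} → subst (v ∈_) (sym (Handled.ids≡ (proj₁ (rounds-sound ids≡ cs st∈))))) {st′} st′∈
    with hd , st₀ , st₀∈ , eq ← rounds-sound {ids} {sts} ids≡ cs st∈ =
    record { ids≡ = trans (Refinement.ids≡ ref) (Handled.ids≡ hd) ; hits = hits′ } , st₀ , st₀∈ , trans (Refinement.same ref) eq
    where
    open Refinement
    hits′ : ∀ {c′ s} → c′ ∈ c ∷ cs → Fits s (proj₂ st′) → (C : ~Cycle c′) → Meets (proj₁ st′ ++ map s ids) C
    hits′ (here refl) fits C = hits ref fits C
    hits′ {s = s} (there c∈) fits C =
      subst (λ vs → Meets (vs ++ map s ids) C) (sym (Refinement.same ref)) (Handled.hits hd c∈ (refines ref fits) C)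

  rounds-complete : ∀ {s ids sts vs slots} → (vs , slots) ∈ sts → Fits s slots →
      (∀ {c} (C : ~Cycle c) → Meets (vs ++ map s ids) C) → ∀ cs →
      ∃[ slots′ ] ((vs , slots′) ∈ foldr (round ids) sts cs × Fits s slots′)
  rounds-complete st∈ fits hits [] = _ , st∈ , fits
  rounds-complete {ids = ids} st∈ fits hits (c ∷ cs) with slots′ , st′∈ , fits′ ← rounds-complete {ids = ids} st∈ fits hits cs =
    round-complete c ids st′∈ fits′ hits

  -- Edges, cycles and the vertex set that is returned

  ∈-coloredEdges⁺ : ∀ {u v c} → u Fin.< v → ColoredEdge G c u v → (u , v , c) ∈ coloredEdges G
  ∈-coloredEdges⁺ {u} {v} {c} u<v e = mapMaybe⁺ f pairs (Any.map⁺ (lose {P = λ p → MAny.Any ((u , v , c) ≡_) (f p)}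
    (∈-filter⁺ (λ (u , v) → u Fin.<? v) (∈-cartesianProduct⁺ (∈-allFin u) (∈-allFin v)) u<v)
    (subst (λ m → MAny.Any ((u , v , c) ≡_) (Maybe.map (λ c → u , v , c) m)) (sym e) (MAny.just refl))))
    where
    f : V × V → Maybe (V × V × Fin h)
    f (u , v) = Maybe.map (λ c → u , v , c) (color u v)
    pairs = filter (λ (u , v) → u Fin.<? v) (cartesianProduct (allFin n) (allFin n))

  ∈-coloredEdges : ∀ {u v c} → ColoredEdge G c u v → (u , v , c) ∈ coloredEdges G ⊎ (v , u , c) ∈ coloredEdges G
  ∈-coloredEdges {u} {v} e with Fin.<-cmp u v
  ... | tri< u<v _ _  = inj₁ (∈-coloredEdges⁺ u<v e)
  ... | tri≈ _ refl _ = contradiction e coloredEdge-irrefl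
  ... | tri> _ _ v<u  = inj₂ (∈-coloredEdges⁺ v<u (coloredEdge-sym e))

  coloredEdges-sound : ∀ {u v c} → (u , v , c) ∈ coloredEdges G → ColoredEdge G c u v
  coloredEdges-sound e∈ = All.lookup (All.mapMaybe⁺ {f = f} (All.map⁺ (All.universal correct pairs))) e∈
    where
    f : V × V → Maybe (V × V × Fin h)
    f (u , v) = Maybe.map (λ c → u , v , c) (color u v)
    pairs = filter (λ (u , v) → u Fin.<? v) (cartesianProduct (allFin n) (allFin n))
    correct : ∀ p → MAll.All (λ (u , v , c) → ColoredEdge G c u v) (f p)
    correct (u , v) with color u v in eq
    ... | nothing = MAll.nothing
    ... | just _  = MAll.just eq

  usedColors⁺ : ∀ {u v c} → (u , v , c) ∈ coloredEdges G → c ∈ usedColors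
  usedColors⁺ {c = c} = go (coloredEdges G)
    where
    go : ∀ es {u v} → (u , v , c) ∈ es → c ∈ foldr addColor [] es
    go (e ∷ es) e∈ with any? (edgeColor e Fin.≟_) (foldr addColor [] es)
    go (e ∷ es) (here refl) | yes c∈ = c∈
    go (e ∷ es) (there e∈)  | yes _  = go es e∈
    go (e ∷ es) (here refl) | no _   = here refl
    go (e ∷ es) (there e∈)  | no _   = there (go es e∈)

  usedColors-unique : Unique usedColors
  usedColors-unique = go (coloredEdges G)
    where
    go : ∀ es → Unique (foldr addColor [] es)
    go [] = []
    go (e ∷ es) with any? (edgeColor e Fin.≟_) (foldr addColor [] es)
    ... | yes _ = go es
    ... | no c∉ = All.¬Any⇒All¬ _ c∉ ∷ go es

  cycle-color : ∀ {c} → ~Cycle c → c ∈ usedColors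
  cycle-color record { rest = _ ∷ _ ; linked = e ∷ _ } with ∈-coloredEdges e
  ... | inj₁ e∈ = usedColors⁺ e∈
  ... | inj₂ e∈ = usedColors⁺ e∈

  fromCycle : ∀ {c} (C : Cycle G) → Linked (ColoredEdge G c) (Cycle.closedWalk C) → ~Cycle c
  fromCycle C lk = record { start = Cycle.start C ; rest = Cycle.rest C ; long = Cycle.long C ; distinct = Cycle.distinct C ; linked = lk }

  toCycle : ∀ {c} → ~Cycle c → Cycle G
  toCycle {c} C = record
    { start = C.start ; rest = C.rest ; long = C.long ; distinct = C.distinct ; adjacent = Linked.map (c ,_) C.linked }
    where module C = Color.~Cycle c C

  members : Subset n → List V
  members S = filter (_∈ₛ? S) (allFin n)

  members-unique : ∀ S → Unique (members S)
  members-unique S = filter⁺ (_∈ₛ? S) (allFin⁺ n)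

  length-firstIds : ∀ k → length (firstIds k) ≤ k
  length-firstIds k = begin
    length (firstIds k) ≡⟨ length-map toℕ (firstIds k) ⟨
    length (map toℕ (firstIds k)) ≤⟨ WithEquality.length-⊆ _≟_ (map⁺ toℕ-injective (filter⁺ (below? k) (allFin⁺ n))) below ⟩
    length (upTo k) ≡⟨ length-upTo k ⟩
    k ∎
    where
    open ≤-Reasoning
    below : map toℕ (firstIds k) ⊆ upTo k
    below i∈ with v , v∈ , refl ← ∈-map⁻ toℕ i∈ = ∈-upTo⁺ (proj₂ (∈-filter⁻ (below? k) {xs = allFin n} v∈))

  initial-ids : ∀ {ids st} → st ∈ initial ids → map proj₁ (proj₂ st) ≡ drop 1 ids
  initial-ids {[]} (here refl) = refl
  initial-ids {i ∷ ids} st∈ with v , _ , refl ← ∈-map⁻ _ st∈ = trans (sym (map-∘ ids)) (map-id ids)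

  initial-length : ∀ {ids st} → st ∈ initial ids → length (proj₁ st) + length (drop 1 ids) ≡ length ids
  initial-length {[]} (here refl) = refl
  initial-length {i ∷ ids} st∈ with v , _ , refl ← ∈-map⁻ _ st∈ = refl

  fits-cong : ∀ {s s′ i} → (∀ {j} → i ≢ j → s j ≡ s′ j) → ∀ slots → All (i ≢_) (map proj₁ slots) → Fits s slots → Fits s′ slots
  fits-cong eq []                []       []       = []
  fits-cong eq ((j , D) ∷ slots) (i≢ ∷ ps) (p ∷ qs) = subst (_∈ D) (eq i≢) p ∷ fits-cong eq slots ps qs

  -- The labels are distinct, so separate choices for the slots combine to one function on labels.
  choose : ∀ slots → Unique (map proj₁ slots) → All (λ (_ , D) → 1 ≤ length D) slots →
      ∃[ s ] (Fits s slots × map s (map proj₁ slots) ≡ concatMap (λ (_ , D) → take 1 D) slots)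
  choose [] _ _ = id , [] , refl
  choose ((i , v ∷ D) ∷ slots) (i≢ ∷ uniq) (_ ∷ ne) with s , fits , eq ← choose slots uniq ne =
    s′ , s′i ∷ fits-cong (λ i≢j → sym (s′j i≢j)) slots i≢ fits , cong₂ _∷_ s′i≡ (trans (map-cong-local (All.map s′j i≢)) eq)
    where
    s′ : V → V
    s′ j = if does (i Fin.≟ j) then v else s j
    s′i≡ : s′ i ≡ v
    s′i≡ rewrite dec-true (i Fin.≟ i) refl = refl
    s′i : s′ i ∈ v ∷ D
    s′i = here s′i≡
    s′j : ∀ {j} → i ≢ j → s′ j ≡ s j
    s′j {j} i≢j rewrite dec-false (i Fin.≟ j) i≢j = refl

  length-members : ∀ S → length (members S) ≡ ∣ S ∣
  length-members S = length-filter-tabulate (_∈ₛ? S) id S (λ i → []=⇒lookup) (λ i → lookup⇒[]= i S)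

  ∣chosen∣ : ∀ st → ∣ chosen st ∣ ≤ length (choice st)
  ∣chosen∣ st = begin
    ∣ chosen st ∣ ≡⟨ length-filter-tabulate (_∈? choice st) id (chosen st)
                                                               (λ i i∈ → trans (lookup∘tabulate _ i) (dec-true (i ∈? choice st) i∈))
                                                               (λ i eq → does⇒ (i ∈? choice st) (trans (sym (lookup∘tabulate _ i)) eq)) ⟨
    length (filter (_∈? choice st) (allFin n)) ≤⟨ length-⊆ (filter⁺ (_∈? choice st) (allFin⁺ n)) (proj₂ ∘ ∈-filter⁻ (_∈? choice st) {xs = allFin n}) ⟩
    length (choice st) ∎
    where
    open ≤-Reasoning
    does⇒ : ∀ {P : Set} (p : Dec P) → does p ≡ true → P
    does⇒ (yes p) _ = p

  chosen⁺ : ∀ {st v} → v ∈ choice st → v ∈ₛ chosen st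
  chosen⁺ {st} {v} v∈ = lookup⇒[]= v (chosen st) (trans (lookup∘tabulate _ v) (dec-true (v ∈? choice st) v∈))

  answer-sound : ∀ {k st} → st ∈ search k → Feasible st → IsMFVS G k (chosen st)
  answer-sound {k} {st} st∈ feasible
    with hd , st₀ , st₀∈ , vs≡ ← rounds-sound {drop 1 (firstIds k)} {initial (firstIds k)} (initial-ids {firstIds k}) usedColors {st} st∈
    with s , fits , s≡ ← choose (proj₂ st) (subst Unique (sym (Handled.ids≡ hd)) (drop⁺ 1 (filter⁺ (below? k) (allFin⁺ n)))) feasible =
    size≤ , hit
    where
    open ≤-Reasoning
    ids = drop 1 (firstIds k)
    picks≡ : map s ids ≡ concatMap (λ (_ , D) → take 1 D) (proj₂ st)
    picks≡ = trans (cong (map s) (sym (Handled.ids≡ hd))) s≡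
    size≤ : ∣ chosen st ∣ ≤ k
    size≤ = begin
      ∣ chosen st ∣ ≤⟨ ∣chosen∣ st ⟩
      length (choice st) ≡⟨ length-++ (proj₁ st) ⟩
      length (proj₁ st) + length (concatMap (λ (_ , D) → take 1 D) (proj₂ st)) ≡⟨ cong₂ (λ vs ws → length vs + length ws) vs≡ (sym picks≡) ⟩
      length (proj₁ st₀) + length (map s ids) ≡⟨ cong (length (proj₁ st₀) +_) (length-map s ids) ⟩
      length (proj₁ st₀) + length ids ≡⟨ initial-length {firstIds k} st₀∈ ⟩
      length (firstIds k) ≤⟨ length-firstIds k ⟩
      k ∎
    hit : ∀ C → Monochromatic G C → Hits G (chosen st) C
    hit C (c , lk) with u , u∈ , u∈C ← Handled.hits hd {c} (cycle-color (fromCycle C lk)) fits (fromCycle C lk) =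
      u , chosen⁺ {st} (subst (λ ws → u ∈ proj₁ st ++ ws) picks≡ u∈) , u∈C

  answer-complete : ∀ {k} S → IsMFVS G k S → ∃[ st ] (st ∈ search k × Feasible st)
  answer-complete {k} S (∣S∣≤k , hitS) = found (firstIds k) assigned
    where
    s : V → V
    -- Label i is sent to the member of S at position i. Labels beyond the size of S may take any
    -- value, so the default is the label itself.
    s i = nth (members S) (toℕ i) i
    length≤n : length (members S) ≤ n
    length≤n = ≤-trans (length-⊆ (members-unique S) (λ {v} _ → ∈-allFin v)) (≤-reflexive (length-tabulate id))
    assigned : ∀ {v} → v ∈ₛ S → ∃[ i ] (i ∈ firstIds k × s i ≡ v)
    assigned {v} v∈S with p , p< , nth≡ ← ∈⇒nth (∈-filter⁺ (_∈ₛ? S) (∈-allFin v) v∈S) =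
      fromℕ< p<n , ∈-filter⁺ (below? k) (∈-allFin _)
        (subst (_< k) (sym (toℕ-fromℕ< p<n)) (≤-trans p< (≤-trans (≤-reflexive (length-members S)) ∣S∣≤k))) ,
      trans (cong (λ q → nth (members S) q (fromℕ< p<n)) (toℕ-fromℕ< p<n)) (nth≡ _)
      where p<n = ≤-trans p< length≤n
    meets : ∀ {W c} → (∀ {v} → v ∈ₛ S → v ∈ W) → (C : ~Cycle c) → Meets W C
    meets {c = c} S⊆W C with v , v∈S , v∈C ← hitS (toCycle C) (c , Color.~Cycle.linked C) = v , S⊆W v∈S , v∈C
    found : ∀ ids → (∀ {v} → v ∈ₛ S → ∃[ i ] (i ∈ ids × s i ≡ v)) →
            ∃[ st ] (st ∈ foldr (round (drop 1 ids)) (initial ids) usedColors × Feasible st)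
    found [] as with slots , st∈ , fits ← rounds-complete {s} {[]} (here refl) [] (meets λ v∈S → contradiction (proj₁ (proj₂ (as v∈S))) λ ()) usedColors =
      _ , st∈ , All.map ∈-length fits
    found (i ∷ ids) as with slots , st∈ , fits ← rounds-complete {s} {ids} {initial (i ∷ ids)} (∈-map⁺ _ (∈-allFin (s i))) (All.map⁺ (All.universal (λ _ → ∈-allFin _) ids))
                              (meets λ v∈S → let j , j∈ , eq = as v∈S in subst (_∈ s i ∷ map s ids) eq (∈-map⁺ s j∈)) usedColors =
      _ , st∈ , All.map ∈-length fits

  answer-correct : ∀ k → CorrectAnswer G k (answer k)
  answer-correct k with filter feasible? (search k) in eq
  ... | [] = λ S mfvs → let st , st∈ , ok = answer-complete S mfvs in
    contradiction (subst (st ∈_) eq (∈-filter⁺ feasible? st∈ ok)) λ ()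
  ... | st ∷ _ = let st∈ , ok = ∈-filter⁻ feasible? {xs = search k} (subst (st ∈_) (sym eq) (here refl)) in
    answer-sound {k} {st} st∈ ok

-- Lists and truth values as trees

-- Any tree counts as a truth value, with `leaf` as false. So a list is its own test for being
-- nonempty, and tests are specified only up to `isNode`.
isNode : Tree → Bool
isNode leaf       = false
isNode (node _ _) = true

encodeAll : ∀ {A : Set} → (A → Tree) → List A → Tree
encodeAll enc xs = encodeList (map enc xs)

append-encode : ∀ {A : Set} (enc : A → Tree) xs ys →
    appendᵗ (encodeAll enc xs) (encodeAll enc ys) ≡ encodeAll enc (xs ++ ys)
append-encode enc []       ys = refl
append-encode enc (x ∷ xs) ys = cong (node (enc x)) (append-encode enc xs ys)

append-leaf : ∀ t → appendᵗ t leaf ≡ t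
append-leaf leaf       = refl
append-leaf (node x t) = cong (node x) (append-leaf t)

for-encode : ∀ {A B : Set} (enc : A → Tree) (enc′ : B → Tree) (f : Tree → Tree) (g : A → List B) →
    (∀ x → f (enc x) ≡ encodeAll enc′ (g x)) →
    ∀ xs → forᵗ f (encodeAll enc xs) ≡ encodeAll enc′ (concatMap g xs)
for-encode enc enc′ f g eq []       = refl
for-encode enc enc′ f g eq (x ∷ xs) =
  trans (cong₂ appendᵗ (eq x) (for-encode enc enc′ f g eq xs)) (append-encode enc′ (g x) (concatMap g xs))

map-encode : ∀ {A B : Set} (enc : A → Tree) (enc′ : B → Tree) (f : Tree → Tree) (g : A → B) →
    (∀ x → f (enc x) ≡ enc′ (g x)) →
    ∀ xs → forᵗ (λ x → node (f x) leaf) (encodeAll enc xs) ≡ encodeAll enc′ (map g xs)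
map-encode enc enc′ f g eq []       = refl
map-encode enc enc′ f g eq (x ∷ xs) = cong₂ node (eq x) (map-encode enc enc′ f g eq xs)

filter-encode : ∀ {A : Set} {P : A → Set} (P? : Unary.Decidable P) (enc : A → Tree) (p : Tree → Tree) →
    (∀ x → isNode (p (enc x)) ≡ does (P? x)) →
    ∀ xs → forᵗ (λ x → ifᵗ (p x) (node x leaf) leaf) (encodeAll enc xs) ≡ encodeAll enc (filter P? xs)
filter-encode P? enc p eq [] = refl
filter-encode P? enc p eq (x ∷ xs) with p (enc x) | P? x | eq x
... | leaf     | no _  | _ = filter-encode P? enc p eq xs
... | node _ _ | yes _ | _ = cong (node (enc x)) (filter-encode P? enc p eq xs)

any-encode : ∀ {A : Set} {P : A → Set} (P? : Unary.Decidable P) (enc : A → Tree) (p : Tree → Tree) →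
    (∀ x → isNode (p (enc x)) ≡ does (P? x)) →
    ∀ xs → isNode (forᵗ (λ x → ifᵗ (p x) (node leaf leaf) leaf) (encodeAll enc xs)) ≡ does (any? P? xs)
any-encode P? enc p eq [] = refl
any-encode P? enc p eq (x ∷ xs) with p (enc x) | P? x | eq x
... | leaf     | no _  | _ = any-encode P? enc p eq xs
... | node _ _ | yes _ | _ = refl

fold-encode : ∀ {A B : Set} (enc : A → Tree) (enc′ : B → Tree) (f : Tree → Tree → Tree) (g : A → B → B) →
    (∀ x y → f (enc x) (enc′ y) ≡ enc′ (g x y)) →
    ∀ z xs → foldᵗ f (enc′ z) (encodeAll enc xs) ≡ enc′ (foldr g z xs)
fold-encode enc enc′ f g eq z []       = refl
fold-encode enc enc′ f g eq z (x ∷ xs) =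
  trans (cong (f (enc x)) (fold-encode enc enc′ f g eq z xs)) (eq x (foldr g z xs))

isNode-and : ∀ {a b p q} → isNode a ≡ p → isNode b ≡ q → isNode (ifᵗ a b leaf) ≡ p ∧ q
isNode-and {leaf}     refl _ = refl
isNode-and {node _ _} refl e = e

isNode-or : ∀ {a b p q} → isNode a ≡ p → isNode b ≡ q → isNode (ifᵗ a (node leaf leaf) b) ≡ p ∨ q
isNode-or {leaf}     refl e = e
isNode-or {node _ _} refl _ = refl

isNode-not : ∀ {a p} → isNode a ≡ p → isNode (ifᵗ a leaf (node leaf leaf)) ≡ not p
isNode-not {leaf}     refl = refl
isNode-not {node _ _} refl = refl

if-encode : ∀ {A : Set} {enc : A → Tree} {a x y p u v} → isNode a ≡ p → x ≡ enc u → y ≡ enc v →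
    ifᵗ a x y ≡ enc (if p then u else v)
if-encode {a = leaf}     refl _ e = e
if-encode {a = node _ _} refl e _ = e

isNode-nonempty : ∀ {A : Set} {enc : A → Tree} xs → isNode (encodeAll enc xs) ≡ does (nonempty? xs)
isNode-nonempty []      = refl
isNode-nonempty (_ ∷ _) = refl

size-filter : ∀ (p : Tree → Tree) l → size (forᵗ (λ x → ifᵗ (p x) (node x leaf) leaf) l) ≤ size l
size-filter p leaf = ≤-refl
size-filter p (node x t) with p x
... | leaf     = ≤-trans (size-filter p t) (m≤n⇒m≤1+n (m≤n+m _ (size x)))
... | node _ _ = s≤s (+-monoʳ-≤ (size x) (size-filter p t))

-- The subroutines of the program

true′ : ∀ {b n} → Exp b n
true′ = cons nil nil

and′ or′ : ∀ {b n} → Exp b n → Exp b n → Exp b n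
and′ a b = ifte a b nil
or′ a b = ifte a true′ b

not′ : ∀ {b n} → Exp b n → Exp b n
not′ a = ifte a nil true′

fst′ snd′ : ∀ {b n} → Exp b n → Exp b n
fst′ e = match e nil (arg 0F)
snd′ e = match e nil (arg 1F)

filter′ any′ : ∀ {b n} → Exp b n → Exp b (1 + n) → Exp b n
filter′ xs p = for xs (ifte p (cons (arg 0F) nil) nil)
any′ xs p = for xs (ifte p true′ nil)

cat′ : ∀ {b n} → Exp b n → Exp b n → Exp b n
cat′ a b = for (cons a (cons b nil)) (arg 0F)

-- `fold` consumes a list from its end, but numbers are compared from their least significant digits
-- on. Reversing first turns the fold into a left fold.
reverseᵗ : Tree → Tree
reverseᵗ = foldᵗ (λ x a → appendᵗ a (node x leaf)) leaf

foldlᵗ : (Tree → Tree → Tree) → Tree → Tree → Tree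
foldlᵗ f z leaf       = z
foldlᵗ f z (node x t) = foldlᵗ f (f x z) t

fold-append : ∀ f z a b → foldᵗ f z (appendᵗ a b) ≡ foldᵗ f (foldᵗ f z b) a
fold-append f z leaf       b = refl
fold-append f z (node x a) b = cong (f x) (fold-append f z a b)

fold-reverse : ∀ f z l → foldᵗ f z (reverseᵗ l) ≡ foldlᵗ f z l
fold-reverse f z leaf       = refl
fold-reverse f z (node x t) = trans (fold-append f z (reverseᵗ t) (node x leaf)) (fold-reverse f (f x z) t)

opaque
  reverse′ : Exp true 1
  reverse′ = fold⁺ (arg 0F) nil (cat′ (arg 1F) (cons (arg 0F) nil)) (λ ρ → 1 + (∥ ρ ∥ + 1))
    (poly-+ (poly-const 1) (poly-+ poly-measure (poly-const 1)))
    λ x a ρ → ≤-trans (size-append a (node x leaf)) (+-monoʳ-≤ (size a) (s≤s (+-monoˡ-≤ 1 (m≤m+n (size x) ∥ ρ ∥))))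

  reverse-⟦⟧ : ∀ l → ⟦ reverse′ ⟧ (l ∷ []) ≡ reverseᵗ l
  reverse-⟦⟧ l = refl

-- One step of the comparison of two numbers in bijective base 2, least
-- significant digits first. The state is the rest of the second number
-- and a flag for "smaller so far".
lessStep : Tree → Tree → Tree
lessStep d a = matchᵗ a leaf λ rest flag → matchᵗ rest (node leaf leaf) λ d′ rest′ →
  node rest′ (ifᵗ d (ifᵗ d′ flag (node leaf leaf)) (ifᵗ d′ leaf flag))

lessEnd : Tree → Tree
lessEnd a = matchᵗ a leaf λ rest flag → ifᵗ rest (node leaf leaf) flag

size-lessStep : ∀ d a → size (lessStep d a) ≤ size a + 4
size-lessStep d leaf = s≤s z≤n
size-lessStep d (node leaf flag) = ≤-trans (m≤n+m 3 (suc (suc (size flag)))) (+-monoʳ-≤ (suc (suc (size flag))) (n≤1+n 3))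
size-lessStep d (node (node d′ rest′) flag) = s≤s (begin
  size rest′ + size (ifᵗ d (ifᵗ d′ flag (node leaf leaf)) (ifᵗ d′ leaf flag)) ≤⟨ +-mono-≤ (m≤n+m (size rest′) (suc (size d′))) (flag≤ d d′) ⟩
  suc (size d′ + size rest′) + (size flag + 3) ≡⟨ +-assoc _ (size flag) 3 ⟨
  suc (size d′ + size rest′) + size flag + 3 ≤⟨ +-monoʳ-≤ (suc (size d′ + size rest′) + size flag) (n≤1+n 3) ⟩
  suc (size d′ + size rest′) + size flag + 4 ∎)
  where
  open ≤-Reasoning
  flag≤ : ∀ d d′ → size (ifᵗ d (ifᵗ d′ flag (node leaf leaf)) (ifᵗ d′ leaf flag)) ≤ size flag + 3
  flag≤ leaf       leaf       = m≤m+n _ 3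
  flag≤ leaf       (node _ _) = ≤-trans (s≤s z≤n) (m≤n+m 3 (size flag))
  flag≤ (node _ _) leaf       = m≤n+m 3 (size flag)
  flag≤ (node _ _) (node _ _) = m≤m+n _ 3

-- The flag is the verdict on the digits already read. It counts only if the remaining, more
-- significant digits agree, and unequal digits overwrite it.
compareᵇ : ℕᵇ → ℕᵇ → Bool → Bool
compareᵇ 0ᵇ       0ᵇ       f = f
compareᵇ 0ᵇ       2[1+ _ ] f = true
compareᵇ 0ᵇ       1+[2 _ ] f = true
compareᵇ 2[1+ _ ] 0ᵇ       f = false
compareᵇ 1+[2 _ ] 0ᵇ       f = false
compareᵇ 2[1+ a ] 2[1+ b ] f = compareᵇ a b f
compareᵇ 2[1+ a ] 1+[2 b ] f = compareᵇ a b false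
compareᵇ 1+[2 a ] 2[1+ b ] f = compareᵇ a b true
compareᵇ 1+[2 a ] 1+[2 b ] f = compareᵇ a b f

lessEnd-foldl : ∀ a b f → isNode (lessEnd (foldlᵗ lessStep (node (encodeBin b) f) (encodeBin a))) ≡ compareᵇ a b (isNode f)
lessEnd-foldl 0ᵇ       0ᵇ       f = refl
lessEnd-foldl 0ᵇ       2[1+ b ] f = refl
lessEnd-foldl 0ᵇ       1+[2 b ] f = refl
lessEnd-foldl 2[1+ a ] 0ᵇ       f = stuck a
  where
  -- When the second number is exhausted and a digit of the first remains, the flag is cleared for
  -- good.
  stuck : ∀ a → isNode (lessEnd (foldlᵗ lessStep (node leaf leaf) (encodeBin a))) ≡ false
  stuck 0ᵇ       = refl
  stuck 2[1+ a ] = stuck a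
  stuck 1+[2 a ] = stuck a
lessEnd-foldl 1+[2 a ] 0ᵇ       f = lessEnd-foldl 2[1+ a ] 0ᵇ f
lessEnd-foldl 2[1+ a ] 2[1+ b ] f = lessEnd-foldl a b f
lessEnd-foldl 2[1+ a ] 1+[2 b ] f = lessEnd-foldl a b leaf
lessEnd-foldl 1+[2 a ] 2[1+ b ] f = lessEnd-foldl a b (node leaf leaf)
lessEnd-foldl 1+[2 a ] 1+[2 b ] f = lessEnd-foldl a b f

-- A set flag makes a tie count as smaller and so turns < into ≤. Unequal digits can lead from one
-- statement to the other, hence the mutual induction.
compareᵇ-false : ∀ a b → compareᵇ a b false ≡ does (toℕᵇ a <? toℕᵇ b)
compareᵇ-true  : ∀ a b → compareᵇ a b true ≡ does (toℕᵇ a ≤? toℕᵇ b)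

compareᵇ-false 0ᵇ       0ᵇ       = refl
compareᵇ-false 0ᵇ       2[1+ b ] = refl
compareᵇ-false 0ᵇ       1+[2 b ] = refl
compareᵇ-false 2[1+ a ] 0ᵇ       = refl
compareᵇ-false 1+[2 a ] 0ᵇ       = refl
compareᵇ-false 2[1+ a ] 2[1+ b ] = trans (compareᵇ-false a b) (does-⇔
  (mk⇔ (λ a<b → *-monoʳ-< 2 (s≤s a<b)) (λ lt → s≤s⁻¹ (*-cancelˡ-< 2 (suc (toℕᵇ a)) (suc (toℕᵇ b)) lt))) (toℕᵇ a <? toℕᵇ b) (_ <? _))
compareᵇ-false 2[1+ a ] 1+[2 b ] = trans (compareᵇ-false a b) (does-⇔
  (mk⇔ (λ a<b → s≤s (*-monoʳ-≤ 2 a<b)) (λ lt → *-cancelˡ-≤ 2 (s≤s⁻¹ lt))) (toℕᵇ a <? toℕᵇ b) (2 * suc (toℕᵇ a) <? suc (2 * toℕᵇ b)))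
compareᵇ-false 1+[2 a ] 2[1+ b ] = trans (compareᵇ-true a b) (does-⇔ (mk⇔
  (λ a≤b → ≤-trans (s≤s (s≤s (*-monoʳ-≤ 2 a≤b))) (≤-reflexive (sym (*-suc 2 (toℕᵇ b)))))
  (λ lt → *-cancelˡ-≤ 2 (s≤s⁻¹ (s≤s⁻¹ (≤-trans lt (≤-reflexive (*-suc 2 (toℕᵇ b)))))))) (toℕᵇ a ≤? toℕᵇ b) (suc (2 * toℕᵇ a) <? 2 * suc (toℕᵇ b)))
compareᵇ-false 1+[2 a ] 1+[2 b ] = trans (compareᵇ-false a b) (does-⇔
  (mk⇔ (λ a<b → s≤s (*-monoʳ-< 2 a<b)) (λ lt → *-cancelˡ-< 2 (toℕᵇ a) (toℕᵇ b) (s≤s⁻¹ lt))) (toℕᵇ a <? toℕᵇ b) (_ <? _))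

compareᵇ-true 0ᵇ       0ᵇ       = refl
compareᵇ-true 0ᵇ       2[1+ b ] = refl
compareᵇ-true 0ᵇ       1+[2 b ] = refl
compareᵇ-true 2[1+ a ] 0ᵇ       = refl
compareᵇ-true 1+[2 a ] 0ᵇ       = refl
compareᵇ-true 2[1+ a ] 2[1+ b ] = trans (compareᵇ-true a b) (does-⇔
  (mk⇔ (λ a≤b → *-monoʳ-≤ 2 (s≤s a≤b)) (λ le → s≤s⁻¹ (*-cancelˡ-≤ 2 le))) (toℕᵇ a ≤? toℕᵇ b) (2 * suc (toℕᵇ a) ≤? 2 * suc (toℕᵇ b)))
compareᵇ-true 2[1+ a ] 1+[2 b ] = trans (compareᵇ-false a b) (does-⇔ (mk⇔
  (λ a<b → ≤-trans (*-monoʳ-≤ 2 a<b) (n≤1+n (2 * toℕᵇ b)))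
  (λ le → *-cancelˡ-< 2 (toℕᵇ a) (toℕᵇ b) (s≤s⁻¹ (≤-trans (≤-reflexive (sym (*-suc 2 (toℕᵇ a)))) le)))) (toℕᵇ a <? toℕᵇ b) (2 * suc (toℕᵇ a) ≤? suc (2 * toℕᵇ b)))
compareᵇ-true 1+[2 a ] 2[1+ b ] = trans (compareᵇ-true a b) (does-⇔ (mk⇔
  (λ a≤b → ≤-trans (s≤s (*-monoʳ-≤ 2 a≤b)) (≤-trans (n≤1+n _) (≤-reflexive (sym (*-suc 2 (toℕᵇ b))))))
  (λ le → s≤s⁻¹ (*-cancelˡ-< 2 (toℕᵇ a) (suc (toℕᵇ b)) le))) (toℕᵇ a ≤? toℕᵇ b) (suc (2 * toℕᵇ a) ≤? 2 * suc (toℕᵇ b)))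
compareᵇ-true 1+[2 a ] 1+[2 b ] = trans (compareᵇ-true a b) (does-⇔
  (mk⇔ (λ a≤b → s≤s (*-monoʳ-≤ 2 a≤b)) (λ le → *-cancelˡ-≤ 2 (s≤s⁻¹ le))) (toℕᵇ a ≤? toℕᵇ b) (suc (2 * toℕᵇ a) ≤? suc (2 * toℕᵇ b)))

opaque
  less′ : Exp true 2
  less′ = match
    (fold⁺ (app reverse′ (arg 0F ∷ [])) (cons (arg 1F) nil)
      (match (arg 1F) nil (match (arg 0F) true′
        (cons (arg 1F) (ifte (arg 4F) (ifte (arg 0F) (arg 3F) true′) (ifte (arg 0F) nil (arg 3F))))))
      (λ _ → 4) (poly-const 4) (λ x a ρ → size-lessStep x a))
    nil (ifte (arg 0F) true′ (arg 1F))

  less-encode : ∀ i j → isNode (⟦ less′ ⟧ (encodeℕ i ∷ encodeℕ j ∷ [])) ≡ does (i <? j)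
  less-encode i j = begin
    isNode (lessEnd (foldᵗ lessStep (node (encodeℕ j) leaf) (⟦ reverse′ ⟧ (encodeℕ i ∷ []))))
      ≡⟨ cong (λ t → isNode (lessEnd (foldᵗ lessStep (node (encodeℕ j) leaf) t))) (reverse-⟦⟧ (encodeℕ i)) ⟩
    isNode (lessEnd (foldᵗ lessStep (node (encodeℕ j) leaf) (reverseᵗ (encodeℕ i))))
      ≡⟨ cong (isNode ∘ lessEnd) (fold-reverse lessStep (node (encodeℕ j) leaf) (encodeℕ i)) ⟩
    isNode (lessEnd (foldlᵗ lessStep (node (encodeℕ j) leaf) (encodeℕ i)))
      ≡⟨ lessEnd-foldl (fromℕ i) (fromℕ j) leaf ⟩
    compareᵇ (fromℕ i) (fromℕ j) false
      ≡⟨ compareᵇ-false (fromℕ i) (fromℕ j) ⟩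
    does (toℕᵇ (fromℕ i) <? toℕᵇ (fromℕ j))
      ≡⟨ cong₂ (λ i j → does (i <? j)) (toℕ-fromℕ i) (toℕ-fromℕ j) ⟩
    does (i <? j) ∎
    where open ≡-Reasoning

opaque
  equal′ : Exp true 2
  equal′ = ifte (app less′ (arg 0F ∷ arg 1F ∷ [])) nil (not′ (app less′ (arg 1F ∷ arg 0F ∷ [])))

  equal-encode : ∀ {m} (u v : Fin m) → isNode (⟦ equal′ ⟧ (encodeFin u ∷ encodeFin v ∷ [])) ≡ does (u Fin.≟ v)
  equal-encode u v with ⟦ less′ ⟧ (encodeFin u ∷ encodeFin v ∷ []) | less-encode (toℕ u) (toℕ v)
                      | ⟦ less′ ⟧ (encodeFin v ∷ encodeFin u ∷ []) | less-encode (toℕ v) (toℕ u)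
  ... | a | ea | b | eb = trans (neither a b ea eb) (does-⇔ (mk⇔ (λ (u≮v , v≮u) → toℕ-injective (≤-antisym (≮⇒≥ v≮u) (≮⇒≥ u≮v)))
                                (λ { refl → <-irrefl refl , <-irrefl refl })) (¬? (toℕ u <? toℕ v) ×-dec ¬? (toℕ v <? toℕ u)) (u Fin.≟ v))
    where
    neither : ∀ a b {p q} → isNode a ≡ p → isNode b ≡ q → isNode (ifᵗ a leaf (ifᵗ b leaf (node leaf leaf))) ≡ not p ∧ not q
    neither leaf       leaf       refl refl = refl
    neither leaf       (node _ _) refl refl = refl
    neither (node _ _) b          refl refl = refl

opaque
  member′ : Exp true 2
  member′ = any′ (arg 1F) (app equal′ (arg 1F ∷ arg 0F ∷ []))

  member-encode : ∀ {m} (u : Fin m) xs →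
      isNode (⟦ member′ ⟧ (encodeFin u ∷ encodeAll encodeFin xs ∷ [])) ≡ does (any? (u Fin.≟_) xs)
  member-encode u xs = any-encode (u Fin.≟_) encodeFin _ (equal-encode u) xs

opaque
  shorter′ : Exp true 2
  shorter′ = fold⁺ (arg 0F) (arg 1F) (snd′ (arg 1F)) (λ _ → 0) (poly-const 0) (λ x a ρ → size-snd a)
    where
    size-snd : ∀ a → size (matchᵗ a leaf (λ _ y → y)) ≤ size a + 0
    size-snd leaf       = ≤-refl
    size-snd (node x t) = ≤-trans (m≤n⇒m≤1+n (m≤n+m _ (size x))) (m≤m+n _ 0)

  -- Each entry of the first list removes one entry of the second; something is left exactly if the
  -- second list is longer.
  shorter-encode : ∀ {A B : Set} (enc : A → Tree) (enc′ : B → Tree) xs ys →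
      isNode (⟦ shorter′ ⟧ (encodeAll enc xs ∷ encodeAll enc′ ys ∷ [])) ≡ does (shorter? xs ys)
  shorter-encode {A} {B} enc enc′ xs ys = trans (cong isNode (tails xs ys)) (longer xs ys)
    where
    tail-drop : ∀ k ys → matchᵗ (encodeAll enc′ (drop k ys)) leaf (λ _ y → y) ≡ encodeAll enc′ (drop (suc k) ys)
    tail-drop zero    []       = refl
    tail-drop (suc k) []       = refl
    tail-drop zero    (_ ∷ _)  = refl
    tail-drop (suc k) (_ ∷ ys) = tail-drop k ys
    tails : ∀ (xs : List A) ys → foldᵗ (λ _ a → matchᵗ a leaf (λ _ y → y)) (encodeAll enc′ ys) (encodeAll enc xs) ≡ encodeAll enc′ (drop (length xs) ys)
    tails []       ys = refl
    tails (_ ∷ xs) ys = trans (cong (λ t → matchᵗ t leaf (λ _ y → y)) (tails xs ys)) (tail-drop (length xs) ys)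
    longer : ∀ (xs : List A) ys → isNode (encodeAll enc′ (drop (length xs) ys)) ≡ does (shorter? xs ys)
    longer []       []       = refl
    longer (_ ∷ _)  []       = refl
    longer []       (_ ∷ _)  = refl
    longer (_ ∷ xs) (_ ∷ ys) = longer xs ys

cat-encode : ∀ {A : Set} (enc : A → Tree) xs ys → appendᵗ (encodeAll enc xs) (appendᵗ (encodeAll enc ys) leaf) ≡ encodeAll enc (xs ++ ys)
cat-encode enc xs ys = trans (cong (appendᵗ (encodeAll enc xs)) (append-leaf (encodeAll enc ys))) (append-encode enc xs ys)

toList-tabulate : ∀ {m} {A : Set} (f : Fin m → A) → Vec.toList (Vec.tabulate f) ≡ tabulate f
toList-tabulate {zero}  f = refl
toList-tabulate {suc m} f = cong (f zero ∷_) (toList-tabulate (f ∘ suc))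

size-snd : ∀ {s} t → size t ≤ s → size (matchᵗ t leaf (λ _ y → y)) ≤ s
size-snd leaf       le = le
size-snd (node x y) le = size-tail x y le

opaque
  -- The arguments are the list E of edges, a color c, and two vertices.
  adjacent′ : Exp true 4
  adjacent′ = any′ (arg 0F)
    (and′ (app equal′ (snd′ (snd′ (arg 0F)) ∷ arg 2F ∷ []))
      (or′ (and′ (app equal′ (fst′ (arg 0F) ∷ arg 3F ∷ [])) (app equal′ (fst′ (snd′ (arg 0F)) ∷ arg 4F ∷ [])))
           (and′ (app equal′ (fst′ (arg 0F) ∷ arg 4F ∷ [])) (app equal′ (fst′ (snd′ (arg 0F)) ∷ arg 3F ∷ [])))))

opaque
  -- From here to candidates′, the first three arguments are E, c and a vertex set Y.
  neighbors′ : Exp true 4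
  neighbors′ = filter′ (arg 2F) (app adjacent′ (arg 1F ∷ arg 2F ∷ arg 4F ∷ arg 0F ∷ []))

opaque
  -- The tail of the list of neighbors, used as a truth value, tests for degree at least 2.
  stripOnce′ : Exp true 3
  stripOnce′ = filter′ (arg 2F) (snd′ (app neighbors′ (arg 1F ∷ arg 2F ∷ arg 3F ∷ arg 0F ∷ [])))

opaque
  unfolding stripOnce′

  strip′ : Exp true 3
  strip′ = fold⁺ (arg 2F) (arg 2F) (app stripOnce′ (arg 2F ∷ arg 3F ∷ arg 1F ∷ [])) (λ _ → 0) (poly-const 0)
    (λ x a ρ → ≤-trans (size-filter _ a) (m≤m+n (size a) 0))

opaque
  excess′ : Exp true 4
  excess′ = snd′ (snd′ (app neighbors′ (arg 0F ∷ arg 1F ∷ arg 2F ∷ arg 3F ∷ [])))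

opaque
  surplus′ : Exp true 3
  surplus′ = for (arg 2F) (app excess′ (arg 1F ∷ arg 2F ∷ arg 3F ∷ arg 0F ∷ []))

opaque
  extend′ : Exp true 4
  extend′ = match (arg 3F) nil
    (match (filter′ (arg 4F) (and′ (app adjacent′ (arg 3F ∷ arg 4F ∷ arg 1F ∷ arg 0F ∷ []))
                                   (not′ (app member′ (arg 0F ∷ arg 6F ∷ [])))))
      (arg 5F) (cons (arg 0F) (arg 7F)))

  size-extend : ∀ E c Y p → size (⟦ extend′ ⟧ (E ∷ c ∷ Y ∷ p ∷ [])) ≤ size p + (1 + size Y)
  size-extend E c Y leaf       = s≤s z≤n
  size-extend E c Y (node v p) = go _ _ (size-filter (λ u → ⟦ cond ⟧ (u ∷ v ∷ p ∷ E ∷ c ∷ Y ∷ node v p ∷ [])) Y)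
    where
    cond : Exp true 7
    cond = and′ (app adjacent′ (arg 3F ∷ arg 4F ∷ arg 1F ∷ arg 0F ∷ [])) (not′ (app member′ (arg 0F ∷ arg 6F ∷ [])))
    go : ∀ q us → size us ≤ size Y → size (matchᵗ us q (λ u _ → node u q)) ≤ size q + (1 + size Y)
    go q leaf        _  = m≤m+n (size q) _
    go q (node u us) le = ≤-trans (s≤s (≤-reflexive (+-comm (size u) (size q)))) (≤-trans (≤-reflexive (sym (+-suc (size q) (size u))))
      (+-monoʳ-≤ (size q) (s≤s (size-head u us le))))

opaque
  -- The vertex added in a step is an entry of Y, so the growth is bounded independently of the
  -- path, as the additive criterion for folds requires.
  walk′ : Exp true 3
  walk′ = fold⁺ (arg 2F) (match (arg 2F) nil (cons (arg 0F) nil)) (app extend′ (arg 2F ∷ arg 3F ∷ arg 4F ∷ arg 1F ∷ []))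
    (λ ρ → 1 + ∥ ρ ∥) (poly-+ (poly-const 1) poly-measure)
    λ { x a (E ∷ c ∷ Y ∷ []) → ≤-trans (size-extend E c Y a) (+-monoʳ-≤ (size a) (s≤s
        (size-lookup (x ∷ E ∷ c ∷ Y ∷ []) 3F))) }

opaque
  groups′ : Exp true 4
  groups′ = fold⁺ (arg 3F) (cons nil nil)
    (ifte (app excess′ (arg 2F ∷ arg 3F ∷ arg 4F ∷ arg 0F ∷ []))
      (cons nil (cons (cons (arg 0F) nil) (arg 1F)))
      (match (arg 1F) (cons (cons (arg 0F) nil) nil) (cons (cons (arg 2F) (arg 0F)) (arg 1F))))
    (λ ρ → 5 + ∥ ρ ∥) (poly-+ (poly-const 5) poly-measure)
    λ { x a ρ@(E ∷ c ∷ Y ∷ _) → ≤-trans (size-add (⟦ excess′ ⟧ (E ∷ c ∷ Y ∷ x ∷ [])) x a) (+-monoʳ-≤ (size a) (+-monoʳ-≤ 5 (m≤m+n (size x) ∥ ρ ∥))) }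
    where
    size-add : ∀ e x a → size (ifᵗ e (node leaf (node (node x leaf) a)) (matchᵗ a (node (node x leaf) leaf) (λ g gs → node (node x g) gs)))
             ≤ size a + (5 + size x)
    size-add (node _ _) x a = ≤-reflexive (solve 2 (λ x a → con 3 :+ ((con 1 :+ (x :+ con 1)) :+ a) := a :+ (con 5 :+ x)) refl (size x) (size a))
      where
      open +-*-Solver
    size-add leaf x leaf = ≤-trans (≤-reflexive (solve 1 (λ x → con 1 :+ ((con 1 :+ (x :+ con 1)) :+ con 1) := con 4 :+ x) refl (size x))) (m≤n+m _ 2)
      where
      open +-*-Solver
    size-add leaf x (node g gs) = ≤-trans (≤-reflexive (solve 3 (λ x g h → con 1 :+ ((con 1 :+ (x :+ g)) :+ h) := (con 1 :+ (g :+ h)) :+ (con 1 :+ x)) refl (size x) (size g) (size gs)))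
      (+-monoʳ-≤ (suc (size g + size gs)) (s≤s (m≤n+m (size x) 4)))
      where
      open +-*-Solver

opaque
  weight′ : Exp true 5
  weight′ = for (arg 3F) (bind (cons (arg 5F) (app excess′ (arg 1F ∷ arg 2F ∷ arg 3F ∷ arg 5F ∷ []))) (cat′ (arg 0F) (arg 0F)))

opaque
  candidates′ : Exp true 4
  candidates′ = ifte (app shorter′ (cat′ (arg 3F) (arg 3F) ∷ app surplus′ (arg 0F ∷ arg 1F ∷ arg 2F ∷ []) ∷ []))
    (for (filter′ (arg 2F)
           (not′ (app shorter′ ( app weight′ (arg 1F ∷ arg 2F ∷ arg 3F ∷ arg 4F ∷ arg 0F ∷ [])
                               ∷ app surplus′ (arg 1F ∷ arg 2F ∷ arg 3F ∷ []) ∷ []))))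
         (cons (cons (arg 0F) nil) nil))
    (app groups′ (arg 0F ∷ arg 1F ∷ arg 2F ∷ app walk′ (arg 0F ∷ arg 1F ∷ arg 2F ∷ []) ∷ []))

opaque
  minus′ intersect′ : Exp true 2
  minus′ = filter′ (arg 0F) (not′ (app member′ (arg 0F ∷ arg 2F ∷ [])))
  intersect′ = filter′ (arg 0F) (app member′ (arg 0F ∷ arg 2F ∷ []))

opaque
  remove′ : Exp true 2
  remove′ = filter′ (arg 0F) (not′ (app equal′ (arg 0F ∷ arg 2F ∷ [])))

opaque
  restrict′ : Exp true 3
  restrict′ = for (arg 2F) (cons (match (arg 0F) nil
    (cons (arg 0F) (ifte (app equal′ (arg 0F ∷ arg 3F ∷ [])) (app intersect′ (arg 1F ∷ arg 4F ∷ [])) (arg 1F)))) nil)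

opaque
  branch′ : Exp true 5
  branch′ = for (arg 2F) (cons (cons (arg 1F)
    (cons (app minus′ (arg 2F ∷ arg 5F ∷ []))
      (cons (app remove′ (arg 3F ∷ arg 0F ∷ [])) (app restrict′ (arg 0F ∷ arg 5F ∷ arg 4F ∷ []))))) nil)

opaque
  expand′ : Exp true 3
  expand′ = match (arg 2F) nil (match (arg 1F) nil (match (arg 1F) nil
    (bind (app strip′ (arg 6F ∷ arg 7F ∷ arg 2F ∷ []))
      (ifte (arg 0F)
        (for (app candidates′ (arg 7F ∷ arg 8F ∷ arg 0F ∷ arg 1F ∷ []))
          (app branch′ (arg 6F ∷ arg 1F ∷ arg 2F ∷ arg 3F ∷ arg 0F ∷ [])))
        (cons (arg 9F) nil)))))

opaque
  start′ : Exp true 3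
  start′ = match (arg 2F) nil (cons (arg 0F) (cons (app minus′ (arg 2F ∷ arg 0F ∷ [])) (cons (arg 3F) (arg 1F))))

opaque
  finish′ : Exp true 3
  finish′ = match (arg 2F) nil (match (arg 1F) nil (match (arg 1F) nil
    (ifte (app strip′ (arg 6F ∷ arg 7F ∷ arg 2F ∷ [])) nil (cons (cons (arg 4F) (arg 1F)) nil))))

opaque
  usedColors′ : Exp true 1
  usedColors′ = fold⁺ (arg 0F) nil
    (bind (snd′ (snd′ (arg 0F))) (ifte (app member′ (arg 0F ∷ arg 2F ∷ [])) (arg 2F) (cons (arg 0F) (arg 2F))))
    (λ ρ → 1 + ∥ ρ ∥) (poly-+ (poly-const 1) poly-measure)
    λ x a ρ → size-add _ _ a (≤-trans (size-snd (matchᵗ x leaf (λ _ y → y)) (size-snd x ≤-refl)) (m≤m+n (size x) ∥ ρ ∥))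
    where
    size-add : ∀ {s} e c a → size c ≤ s → size (ifᵗ e a (node c a)) ≤ size a + (1 + s)
    size-add (node _ _) c a le = m≤m+n (size a) _
    size-add {s} leaf   c a le = ≤-trans (s≤s (≤-trans (+-monoˡ-≤ (size a) le) (≤-reflexive (+-comm s (size a))))) (≤-reflexive (sym (+-suc (size a) s)))

opaque
  firstIds′ : Exp true 2
  firstIds′ = filter′ (arg 0F) (app less′ (arg 0F ∷ arg 2F ∷ []))

opaque
  initial′ : Exp true 2
  initial′ = match (arg 1F) (cons (cons nil nil) nil)
    (for (arg 2F) (cons (cons (cons (arg 0F) nil) (for (arg 2F) (cons (cons (arg 0F) (arg 4F)) nil))) nil))

opaque
  feasible′ : Exp true 1
  feasible′ = not′ (any′ (snd′ (arg 0F)) (not′ (snd′ (arg 0F))))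

opaque
  choice′ : Exp true 1
  choice′ = cat′ (fst′ (arg 0F)) (for (snd′ (arg 0F)) (match (snd′ (arg 0F)) nil (cons (arg 0F) nil)))

opaque
  answer′ : Exp true 2
  answer′ = match (filter′ (arg 1F) (app feasible′ (arg 0F ∷ []))) nil
    (cons nil (bind (app choice′ (arg 0F ∷ []))
      (for (arg 3F) (cons (ifte (app member′ (arg 0F ∷ arg 1F ∷ [])) true′ nil) nil))))

-- The subroutines compute the functions of the search

module Simulation {h : ℕ} (G : EdgeColoredGraph h) where
  open EdgeColoredGraph G using (n; color)
  open Search G
  open WithEquality (Fin._≟_ {n})
  open Color using (nbrs; strip₁; excess; surplus; extend; walk; groups; addToGroups; weight; strip; candidates)

  vertices : List V → Tree
  vertices = encodeAll encodeFin

  slotTree : Slot → Tree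
  slotTree (i , D) = node (encodeFin i) (vertices D)

  slotsTree : List Slot → Tree
  slotsTree = encodeAll slotTree

  stateTree : State → Tree
  stateTree (vs , slots) = node (vertices vs) (slotsTree slots)

  cstateTree : ColorState → Tree
  cstateTree (vs , Y , pend , slots) = node (vertices vs) (node (vertices Y) (node (vertices pend) (slotsTree slots)))

  edgeTree : V × V × Fin h → Tree
  edgeTree (u , v , c) = node (encodeFin u) (node (encodeFin v) (encodeFin c))

  E : Tree
  E = encodeAll edgeTree (coloredEdges G)

  -- An edge is listed only once, with its smaller endpoint first, so both orientations have to be
  -- tried.
  Joins : Fin h → V → V → V × V × Fin h → Set
  Joins c u v (a , b , d) = d ≡ c × ((a ≡ u × b ≡ v) ⊎ (a ≡ v × b ≡ u))

  joins? : ∀ c u v → Unary.Decidable (Joins c u v)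
  joins? c u v (a , b , d) = (d Fin.≟ c) ×-dec ((a Fin.≟ u) ×-dec (b Fin.≟ v) ⊎-dec (a Fin.≟ v) ×-dec (b Fin.≟ u))

  opaque
    unfolding adjacent′

    adjacent-encode : ∀ c u v → isNode (⟦ adjacent′ ⟧ (E ∷ encodeFin c ∷ encodeFin u ∷ encodeFin v ∷ [])) ≡ does (u ~[ c ]? v)
    adjacent-encode c u v = trans
      (any-encode (joins? c u v) edgeTree _ (λ (a , b , d) → isNode-and (equal-encode d c)
        (isNode-or (isNode-and (equal-encode a u) (equal-encode b v)) (isNode-and (equal-encode a v) (equal-encode b u)))) (coloredEdges G))
      (does-⇔ (mk⇔ to from) (any? (joins? c u v) (coloredEdges G)) (u ~[ c ]? v))
      where
      to : Any (Joins c u v) (coloredEdges G) → ColoredEdge G c u v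
      to e with find e
      ... | _ , e∈ , refl , inj₁ (refl , refl) = coloredEdges-sound e∈
      ... | _ , e∈ , refl , inj₂ (refl , refl) = coloredEdge-sym (coloredEdges-sound e∈)
      from : ColoredEdge G c u v → Any (Joins c u v) (coloredEdges G)
      from e with ∈-coloredEdges e
      ... | inj₁ e∈ = lose e∈ (refl , inj₁ (refl , refl))
      ... | inj₂ e∈ = lose e∈ (refl , inj₂ (refl , refl))

  opaque
    unfolding neighbors′

    neighbors-encode : ∀ c Y v → ⟦ neighbors′ ⟧ (E ∷ encodeFin c ∷ vertices Y ∷ encodeFin v ∷ []) ≡ vertices (nbrs c Y v)
    neighbors-encode c Y v = filter-encode (λ u → v ~[ c ]? u) encodeFin _ (adjacent-encode c v) Y

  opaque
    unfolding stripOnce′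

    stripOnce-encode : ∀ c Y → ⟦ stripOnce′ ⟧ (E ∷ encodeFin c ∷ vertices Y ∷ []) ≡ vertices (strip₁ c Y)
    stripOnce-encode c Y = filter-encode (λ v → 2 ≤? length (nbrs c Y v)) encodeFin _
      (λ v → trans (cong (λ t → isNode (matchᵗ t leaf (λ _ y → y))) (neighbors-encode c Y v)) (two (nbrs c Y v))) Y
      where
      two : ∀ (l : List V) → isNode (matchᵗ (vertices l) leaf (λ _ y → y)) ≡ does (2 ≤? length l)
      two []          = refl
      two (_ ∷ [])    = refl
      two (_ ∷ _ ∷ _) = refl

  opaque
    unfolding strip′

    strip-encode : ∀ c Y → ⟦ strip′ ⟧ (E ∷ encodeFin c ∷ vertices Y ∷ []) ≡ vertices (strip c Y)
    strip-encode c Y = fold-encode encodeFin vertices _ (λ _ → strip₁ c) (λ _ → stripOnce-encode c) Y Y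

  opaque
    unfolding excess′

    excess-encode : ∀ c Y v → ⟦ excess′ ⟧ (E ∷ encodeFin c ∷ vertices Y ∷ encodeFin v ∷ []) ≡ vertices (excess c Y v)
    excess-encode c Y v = trans (cong (λ t → matchᵗ (matchᵗ t leaf (λ _ y → y)) leaf (λ _ y → y)) (neighbors-encode c Y v)) (drop2 (nbrs c Y v))
      where
      drop2 : ∀ (l : List V) → matchᵗ (matchᵗ (vertices l) leaf (λ _ y → y)) leaf (λ _ y → y) ≡ vertices (drop 2 l)
      drop2 []          = refl
      drop2 (_ ∷ [])    = refl
      drop2 (_ ∷ _ ∷ _) = refl

  opaque
    unfolding surplus′

    surplus-encode : ∀ c Y → ⟦ surplus′ ⟧ (E ∷ encodeFin c ∷ vertices Y ∷ []) ≡ vertices (surplus c Y)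
    surplus-encode c Y = for-encode encodeFin encodeFin _ (excess c Y) (excess-encode c Y) Y

  opaque
    unfolding extend′

    extend-encode : ∀ c Y p → ⟦ extend′ ⟧ (E ∷ encodeFin c ∷ vertices Y ∷ vertices p ∷ []) ≡ vertices (extend c Y p)
    extend-encode c Y []      = refl
    extend-encode c Y (v ∷ p) = trans
      (cong (λ t → matchᵗ t (vertices (v ∷ p)) (λ u _ → node u (vertices (v ∷ p))))
        (filter-encode (λ u → (v ~[ c ]? u) ×-dec ¬? (u ∈? (v ∷ p))) encodeFin _
          (λ u → isNode-and (adjacent-encode c v u) (isNode-not (member-encode u (v ∷ p)))) Y))
      (first (Color.nexts c Y v p))
      where
      first : ∀ (us : List V) → matchᵗ (vertices us) (vertices (v ∷ p)) (λ u _ → node u (vertices (v ∷ p))) ≡ vertices (take 1 us ++ v ∷ p)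
      first []      = refl
      first (_ ∷ _) = refl

  opaque
    unfolding walk′

    walk-encode : ∀ c Y → ⟦ walk′ ⟧ (E ∷ encodeFin c ∷ vertices Y ∷ []) ≡ vertices (walk c Y)
    walk-encode c Y = trans (cong (λ z → foldᵗ (λ _ p → ⟦ extend′ ⟧ (E ∷ encodeFin c ∷ vertices Y ∷ p ∷ [])) z (vertices Y)) (first Y))
      (fold-encode encodeFin vertices _ (λ _ → extend c Y) (λ _ → extend-encode c Y) (take 1 Y) Y)
      where
      first : ∀ (Y : List V) → matchᵗ (vertices Y) leaf (λ v _ → node v leaf) ≡ vertices (take 1 Y)
      first []      = refl
      first (_ ∷ _) = refl

  opaque
    unfolding groups′

    groups-encode : ∀ c Y p → ⟦ groups′ ⟧ (E ∷ encodeFin c ∷ vertices Y ∷ vertices p ∷ []) ≡ encodeAll vertices (groups c Y p)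
    groups-encode c Y p = fold-encode encodeFin (encodeAll vertices) _ (addToGroups c Y)
      (λ v gs → if-encode {enc = encodeAll vertices} (trans (cong isNode (excess-encode c Y v)) (isNode-nonempty (excess c Y v))) refl (add v gs)) [ [] ] p
      where
      add : ∀ v gs → matchᵗ (encodeAll vertices gs) (node (node (encodeFin v) leaf) leaf) (λ g gs → node (node (encodeFin v) g) gs)
                   ≡ encodeAll vertices (Color.addToFirst c v gs)
      add v []      = refl
      add v (_ ∷ _) = refl

  opaque
    unfolding weight′

    weight-encode : ∀ c Y pend v → ⟦ weight′ ⟧ (E ∷ encodeFin c ∷ vertices Y ∷ vertices pend ∷ encodeFin v ∷ []) ≡ vertices (weight c Y pend v)
    weight-encode c Y pend v = for-encode encodeFin encodeFin _ _
      (λ _ → trans (cong (λ t → appendᵗ (node (encodeFin v) t) (appendᵗ (node (encodeFin v) t) leaf)) (excess-encode c Y v))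
                   (cat-encode encodeFin (v ∷ excess c Y v) (v ∷ excess c Y v))) pend

  opaque
    unfolding candidates′

    candidates-encode : ∀ c Y pend → ⟦ candidates′ ⟧ (E ∷ encodeFin c ∷ vertices Y ∷ vertices pend ∷ []) ≡ encodeAll vertices (candidates c Y pend)
    candidates-encode c Y pend = if-encode {enc = encodeAll vertices}
      (trans (cong₂ (λ x y → isNode (⟦ shorter′ ⟧ (x ∷ y ∷ []))) (cat-encode encodeFin pend pend) (surplus-encode c Y))
             (shorter-encode encodeFin encodeFin (pend ++ pend) (surplus c Y)))
      (trans (cong (forᵗ _) (filter-encode (λ v → ¬? (shorter? (weight c Y pend v) (surplus c Y))) encodeFin _
               (λ v → isNode-not (trans (cong₂ (λ x y → isNode (⟦ shorter′ ⟧ (x ∷ y ∷ []))) (weight-encode c Y pend v) (surplus-encode c Y))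
                                        (shorter-encode encodeFin encodeFin (weight c Y pend v) (surplus c Y)))) Y))
             (map-encode encodeFin vertices _ [_] (λ _ → refl) _))
      (trans (cong (λ p → ⟦ groups′ ⟧ (E ∷ encodeFin c ∷ vertices Y ∷ p ∷ [])) (walk-encode c Y)) (groups-encode c Y (walk c Y)))

  opaque
    unfolding minus′

    minus-encode : ∀ Y C → ⟦ minus′ ⟧ (vertices Y ∷ vertices C ∷ []) ≡ vertices (Y ∖∖ C)
    minus-encode Y C = filter-encode (∉? C) encodeFin _ (λ v → isNode-not (member-encode v C)) Y

  opaque
    unfolding intersect′

    intersect-encode : ∀ D C → ⟦ intersect′ ⟧ (vertices D ∷ vertices C ∷ []) ≡ vertices (filter (_∈? C) D)
    intersect-encode D C = filter-encode (_∈? C) encodeFin _ (λ v → member-encode v C) D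

  opaque
    unfolding remove′

    remove-encode : ∀ Y i → ⟦ remove′ ⟧ (vertices Y ∷ encodeFin i ∷ []) ≡ vertices (Y ∖ i)
    remove-encode Y i = filter-encode (≢? i) encodeFin _ (λ v → isNode-not (equal-encode v i)) Y

  opaque
    unfolding restrict′

    restrict-encode : ∀ i C slots → ⟦ restrict′ ⟧ (encodeFin i ∷ vertices C ∷ slotsTree slots ∷ []) ≡ slotsTree (restrict i C slots)
    restrict-encode i C slots = map-encode slotTree slotTree _ (restrictSlot i C)
      (λ (j , D) → cong (node (encodeFin j)) (if-encode {enc = vertices} (equal-encode j i) (intersect-encode D C) refl)) slots

  opaque
    unfolding branch′

    branch-encode : ∀ vs Y pend slots C →
        ⟦ branch′ ⟧ (vertices vs ∷ vertices Y ∷ vertices pend ∷ slotsTree slots ∷ vertices C ∷ []) ≡ encodeAll cstateTree (branch vs Y pend slots C)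
    branch-encode vs Y pend slots C = map-encode encodeFin cstateTree _ _
      (λ i → cong (node (vertices vs)) (cong₂ node (minus-encode Y C) (cong₂ node (remove-encode pend i) (restrict-encode i C slots)))) pend

  opaque
    unfolding expand′

    expand-encode : ∀ c st → ⟦ expand′ ⟧ (E ∷ encodeFin c ∷ cstateTree st ∷ []) ≡ encodeAll cstateTree (expand c st)
    expand-encode c (vs , Y , pend , slots) = if-encode {enc = encodeAll cstateTree}
      (trans (cong isNode (strip-encode c Y)) (isNode-nonempty (strip c Y)))
      (trans (cong (λ Z → forᵗ (λ C → ⟦ branch′ ⟧ (vertices vs ∷ Z ∷ vertices pend ∷ slotsTree slots ∷ C ∷ []))
                              (⟦ candidates′ ⟧ (E ∷ encodeFin c ∷ Z ∷ vertices pend ∷ []))) (strip-encode c Y))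
        (trans (cong (forᵗ _) (candidates-encode c (strip c Y) pend))
          (for-encode vertices cstateTree _ (branch vs (strip c Y) pend slots) (branch-encode vs (strip c Y) pend slots) (candidates c (strip c Y) pend))))
      refl

  opaque
    unfolding start′

    start-encode : ∀ ids st → ⟦ start′ ⟧ (vertices (allFin n) ∷ vertices ids ∷ stateTree st ∷ []) ≡ cstateTree (start ids st)
    start-encode ids (vs , slots) = cong (λ Y → node (vertices vs) (node Y (node (vertices ids) (slotsTree slots)))) (minus-encode (allFin n) vs)

  opaque
    unfolding finish′

    finish-encode : ∀ c st → ⟦ finish′ ⟧ (E ∷ encodeFin c ∷ cstateTree st ∷ []) ≡ encodeAll stateTree (finish c st)
    finish-encode c (vs , Y , pend , slots) = if-encode {enc = encodeAll stateTree}
      (trans (cong isNode (strip-encode c Y)) (isNode-nonempty (strip c Y))) refl refl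

  opaque
    unfolding usedColors′

    usedColors-encode : ⟦ usedColors′ ⟧ (E ∷ []) ≡ encodeAll encodeFin usedColors
    usedColors-encode = fold-encode edgeTree (encodeAll encodeFin) _ addColor
      (λ e cs → if-encode {enc = encodeAll encodeFin} (member-encode (edgeColor e) cs) refl refl) [] (coloredEdges G)

  opaque
    unfolding firstIds′

    firstIds-encode : ∀ k → ⟦ firstIds′ ⟧ (vertices (allFin n) ∷ encodeℕ k ∷ []) ≡ vertices (firstIds k)
    firstIds-encode k = filter-encode (below? k) encodeFin _ (λ v → less-encode (toℕ v) k) (allFin n)

  opaque
    unfolding initial′

    initial-encode : ∀ ids → ⟦ initial′ ⟧ (vertices (allFin n) ∷ vertices ids ∷ []) ≡ encodeAll stateTree (initial ids)
    initial-encode []        = refl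
    initial-encode (_ ∷ ids) = map-encode encodeFin stateTree _ _
      (λ v → cong (node (vertices [ v ])) (map-encode encodeFin slotTree _ (_, allFin n) (λ _ → refl) ids)) (allFin n)

  opaque
    unfolding feasible′

    feasible-encode : ∀ st → isNode (⟦ feasible′ ⟧ (stateTree st ∷ [])) ≡ does (feasible? st)
    feasible-encode (vs , slots) = trans (isNode-not (any-encode (λ (_ , D) → ¬? (nonempty? D)) slotTree _
        (λ (i , D) → isNode-not {vertices D} (isNode-nonempty D)) slots)) (deMorgan slots)
      where
      deMorgan : ∀ (slots : List Slot) → not (does (any? (λ (_ , D) → ¬? (nonempty? D)) slots)) ≡ does (all? (λ (_ , D) → nonempty? D) slots)
      deMorgan [] = refl
      deMorgan ((_ , [])    ∷ slots) = refl
      deMorgan ((_ , _ ∷ _) ∷ slots) = deMorgan slots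

  opaque
    unfolding choice′

    choice-encode : ∀ st → ⟦ choice′ ⟧ (stateTree st ∷ []) ≡ vertices (choice st)
    choice-encode (vs , slots) = trans
      (cong (λ t → appendᵗ (vertices vs) (appendᵗ t leaf)) (for-encode slotTree encodeFin _ (λ (_ , D) → take 1 D) first slots))
      (cat-encode encodeFin vs (concatMap (λ (_ , D) → take 1 D) slots))
      where
      first : ∀ ((i , D) : Slot) → matchᵗ (vertices D) leaf (λ v _ → node v leaf) ≡ vertices (take 1 D)
      first (_ , [])    = refl
      first (_ , _ ∷ _) = refl

  opaque
    unfolding answer′

    answer-encode : ∀ sts → ⟦ answer′ ⟧ (vertices (allFin n) ∷ encodeAll stateTree sts ∷ []) ≡ encodeAnswer (firstAnswer (filter feasible? sts))
    answer-encode sts = trans (cong (λ t → matchᵗ t leaf _) (filter-encode feasible? stateTree _ feasible-encode sts)) (output (filter feasible? sts))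
      where
      bool : ∀ {a p} → isNode a ≡ p → ifᵗ a (node leaf leaf) leaf ≡ encodeBool p
      bool {leaf}     refl = refl
      bool {node _ _} refl = refl
      output : ∀ sts → matchᵗ (encodeAll stateTree sts) leaf (λ st _ → node leaf
                 (forᵗ (λ v → node (ifᵗ (⟦ member′ ⟧ (v ∷ ⟦ choice′ ⟧ (st ∷ []) ∷ [])) (node leaf leaf) leaf) leaf) (vertices (allFin n))))
               ≡ encodeAnswer (firstAnswer sts)
      output []       = refl
      output (st ∷ _) = cong (node leaf) (trans
        (map-encode encodeFin encodeBool _ (λ v → does (v ∈? choice st))
          (λ v → bool (trans (cong (λ W → isNode (⟦ member′ ⟧ (encodeFin v ∷ W ∷ []))) (choice-encode st)) (member-encode v (choice st)))) (allFin n))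
        (cong encodeList (cong (map encodeBool) (trans (map-tabulate id (λ v → does (v ∈? choice st))) (sym (toList-tabulate (λ v → does (v ∈? choice st))))))))

-- Sizes of encoded lists and folds with an invariant

size-∈ : ∀ {A : Set} (enc : A → Tree) {x xs} → x ∈ xs → size (enc x) ≤ size (encodeAll enc xs)
size-∈ enc (here {x} {xs} refl) = size-head (enc x) (encodeAll enc xs) ≤-refl
size-∈ enc (there {y} {xs} x∈)  = ≤-trans (size-∈ enc x∈) (size-tail (enc y) (encodeAll enc xs) ≤-refl)

length≤size : ∀ {A : Set} (enc : A → Tree) xs → length xs ≤ size (encodeAll enc xs)
length≤size enc []       = z≤n
length≤size enc (x ∷ xs) = s≤s (≤-trans (length≤size enc xs) (m≤n+m _ (size (enc x))))

size-encodeAll : ∀ {A : Set} (enc : A → Tree) {s l} xs → (∀ {x} → x ∈ xs → size (enc x) ≤ s) → length xs ≤ l →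
    size (encodeAll enc xs) ≤ 1 + l * (1 + s)
size-encodeAll enc []       _  _ = s≤s z≤n
size-encodeAll enc {s} {suc l} (x ∷ xs) le (s≤s len≤) = s≤s (≤-trans
  (+-mono-≤ (le (here refl)) (size-encodeAll enc xs (le ∘ there) len≤)) (≤-reflexive (+-suc s (l * suc s))))

length-concatMap-≤ : ∀ {A B : Set} (f : A → List B) {b} xs → (∀ {x} → x ∈ xs → length (f x) ≤ b) →
    length (concatMap f xs) ≤ length xs * b
length-concatMap-≤ f {b} xs le = ≤-trans (≤-reflexive (length-concatMap f xs))
  (≤-trans (sumOf-≤ xs le) (≤-reflexive (sumOf-const b xs)))

fold-invariant : ∀ {A B : Set} {g : A → B → B} (Q : ℕ → B → Set) {z} xs → Q 0 z →
    (∀ {i x y} → x ∈ xs → Q i y → Q (suc i) (g x y)) → Q (length xs) (foldr g z xs)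
fold-invariant Q []       q step = q
fold-invariant Q (x ∷ xs) q step = step (here refl) (fold-invariant Q xs q (step ∘ there))

-- This is for folds that carry no size proof: the bound K on one step may rely on an invariant of
-- the accumulator after i entries. The invariant lives on decoded values, hence the simulation
-- hypothesis.
foldCost-encode : ∀ {A B : Set} (enc : A → Tree) (enc′ : B → Tree) (f : Tree → Tree → Tree) (g : A → B → B) →
    (∀ x y → f (enc x) (enc′ y) ≡ enc′ (g x y)) →
    ∀ {c : Tree → Tree → ℕ} {d K} (Q : ℕ → B → Set) {z} xs → Q 0 z →
    (∀ {i x y} → x ∈ xs → Q i y → Q (suc i) (g x y)) →
    (∀ {i x y} → x ∈ xs → i < length xs → Q i y → c (enc x) (enc′ y) ≤ K) →
    foldCost f (enc′ z) c d (encodeAll enc xs) ≤ (6 + d) + length xs * (15 + K)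
foldCost-encode enc enc′ f g sim Q [] q step le = m≤m+n _ _
foldCost-encode {A} {B} enc enc′ f g sim {c} {d} {K} Q {z} (x ∷ xs) q step le = begin
  9 + (foldCost f (enc′ z) c d (encodeAll enc xs) + (6 + c (enc x) (foldᵗ f (enc′ z) (encodeAll enc xs))))
    ≤⟨ +-monoʳ-≤ 9 (+-mono-≤ (foldCost-encode enc enc′ f g sim Q xs q (step ∘ there) (λ x∈ i< → le (there x∈) (m≤n⇒m≤1+n i<)))
         (+-monoʳ-≤ 6 (subst (λ a → c (enc x) a ≤ K) (sym (fold-encode enc enc′ f g sim z xs))
           (le (here refl) ≤-refl (fold-invariant Q xs q (step ∘ there)))))) ⟩
  9 + (((6 + d) + R) + (6 + K))
    ≡⟨ solve 3 (λ k e r → con 9 :+ (((con 6 :+ e) :+ r) :+ (con 6 :+ k))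
                       := (con 6 :+ e) :+ ((con 15 :+ k) :+ r)) refl K d R ⟩
  (6 + d) + ((15 + K) + R) ∎
  where
  open ≤-Reasoning
  open +-*-Solver
  R = length xs * (15 + K)

-- The main program

opaque
  vertexList′ edgeList′ number′ : Exp true 1
  vertexList′ = fst′ (snd′ (fst′ (arg 0F)))
  edgeList′   = snd′ (snd′ (fst′ (arg 0F)))
  number′     = snd′ (arg 0F)

  vertexList-⟦⟧ : ∀ a b c d → ⟦ vertexList′ ⟧ (node (node a (node b c)) d ∷ []) ≡ b
  vertexList-⟦⟧ a b c d = refl

  edgeList-⟦⟧ : ∀ a b c d → ⟦ edgeList′ ⟧ (node (node a (node b c)) d ∷ []) ≡ c
  edgeList-⟦⟧ a b c d = refl

  number-⟦⟧ : ∀ a b → ⟦ number′ ⟧ (node a b ∷ []) ≡ b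
  number-⟦⟧ a b = refl

  tail-encode : ∀ {A : Set} (enc : A → Tree) xs → ⟦ number′ ⟧ (encodeAll enc xs ∷ []) ≡ encodeAll enc (drop 1 xs)
  tail-encode enc []      = refl
  tail-encode enc (_ ∷ _) = refl

opaque
  startAll′ expandAll′ finishAll′ : Exp true 3
  startAll′  = for (arg 2F) (cons (app start′ (arg 1F ∷ arg 2F ∷ arg 0F ∷ [])) nil)
  expandAll′ = for (arg 2F) (app expand′ (arg 1F ∷ arg 2F ∷ arg 0F ∷ []))
  finishAll′ = for (arg 2F) (app finish′ (arg 1F ∷ arg 2F ∷ arg 0F ∷ []))

-- Only the loop over the slots and the loop over the colors around it can multiply the number of
-- states beyond every polynomial. So these folds have `λ ()` in place of a size proof, and the flag
-- false spreads to what contains them.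
expansions′ : Exp false 8
expansions′ = fold (arg 3F) (app startAll′ (arg 6F ∷ arg 3F ∷ arg 1F ∷ [])) (app expandAll′ (arg 7F ∷ arg 2F ∷ arg 1F ∷ [])) λ ()

round′ : Exp false 8
round′ = app finishAll′ (arg 5F ∷ arg 0F ∷ expansions′ ∷ [])

search′ : Exp false 6
search′ = fold (arg 0F) (app initial′ (arg 4F ∷ arg 2F ∷ [])) round′ λ ()

main′ : Exp false 1
main′ =
  bind (app vertexList′ (arg 0F ∷ []))
  (bind (app edgeList′ (arg 1F ∷ []))
  (bind (app firstIds′ (arg 1F ∷ app number′ (arg 2F ∷ []) ∷ []))
  (bind (app number′ (arg 0F ∷ []))
  (bind (app usedColors′ (arg 2F ∷ []))
  (bind search′
  (app answer′ (arg 5F ∷ arg 0F ∷ [])))))))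

-- The value of the main program

module Run {h : ℕ} (G : EdgeColoredGraph h) (k : ℕ) where
  open EdgeColoredGraph G using (n)
  open Search G
  open Simulation G

  input V′ ids′ rest′ cols′ : Tree
  input = encodeInstance G k
  V′    = vertices (allFin n)
  ids′  = vertices (firstIds k)
  rest′ = vertices (drop 1 (firstIds k))
  cols′ = encodeAll encodeFin usedColors

  rest : List V
  rest = drop 1 (firstIds k)

  env₆ : Vec Tree 6
  env₆ = cols′ ∷ rest′ ∷ ids′ ∷ E ∷ V′ ∷ input ∷ []

  opaque
    unfolding startAll′

    startAll-encode : ∀ sts → ⟦ startAll′ ⟧ (V′ ∷ rest′ ∷ encodeAll stateTree sts ∷ []) ≡ encodeAll cstateTree (map (start rest) sts)
    startAll-encode sts = map-encode stateTree cstateTree _ (start rest) (start-encode rest) sts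

    expandAll-encode : ∀ c csts → ⟦ expandAll′ ⟧ (E ∷ encodeFin c ∷ encodeAll cstateTree csts ∷ []) ≡ encodeAll cstateTree (concatMap (expand c) csts)
    expandAll-encode c csts = for-encode cstateTree cstateTree _ (expand c) (expand-encode c) csts

    finishAll-encode : ∀ c csts → ⟦ finishAll′ ⟧ (E ∷ encodeFin c ∷ encodeAll cstateTree csts ∷ []) ≡ encodeAll stateTree (concatMap (finish c) csts)
    finishAll-encode c csts = for-encode cstateTree stateTree _ (finish c) (finish-encode c) csts

  env₈ : Fin h → List State → Vec Tree 8
  env₈ c sts = encodeFin c ∷ encodeAll stateTree sts ∷ env₆

  expansions-encode : ∀ c sts → ⟦ expansions′ ⟧ (env₈ c sts) ≡ encodeAll cstateTree (expansions c rest sts)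
  expansions-encode c sts = trans
    (cong (λ z → foldᵗ (λ _ a → ⟦ expandAll′ ⟧ (E ∷ encodeFin c ∷ a ∷ [])) z rest′) (startAll-encode sts))
    (fold-encode encodeFin (encodeAll cstateTree) _ (λ _ → concatMap (expand c)) (λ _ → expandAll-encode c) (map (start rest) sts) rest)

  round-encode : ∀ c sts → ⟦ round′ ⟧ (env₈ c sts) ≡ encodeAll stateTree (round rest c sts)
  round-encode c sts = trans (cong (λ t → ⟦ finishAll′ ⟧ (E ∷ encodeFin c ∷ t ∷ [])) (expansions-encode c sts))
    (finishAll-encode c (expansions c rest sts))

  search-encode : ⟦ search′ ⟧ env₆ ≡ encodeAll stateTree (search k)
  search-encode = trans (cong (λ z → foldᵗ (λ c a → ⟦ round′ ⟧ (c ∷ a ∷ env₆)) z cols′) (initial-encode (firstIds k)))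
    (fold-encode encodeFin (encodeAll stateTree) _ (round rest) round-encode (initial (firstIds k)) usedColors)

  module _ {X : Set} (F : (V E ids rest cols sts : Tree) → X) where

    -- Result and cost of `main′` depend on the same chain of intermediate values. The chain is
    -- abstracted over a function `F` of them, so that it is evaluated once for both.
    values : X
    values =
      let V    = ⟦ vertexList′ ⟧ (input ∷ [])
          E    = ⟦ edgeList′ ⟧ (input ∷ [])
          ids  = ⟦ firstIds′ ⟧ (V ∷ ⟦ number′ ⟧ (input ∷ []) ∷ [])
          rest = ⟦ number′ ⟧ (ids ∷ [])
          cols = ⟦ usedColors′ ⟧ (E ∷ [])
      in F V E ids rest cols (⟦ search′ ⟧ (cols ∷ rest ∷ ids ∷ E ∷ V ∷ input ∷ []))

    values-≡ : values ≡ F V′ E ids′ rest′ cols′ (encodeAll stateTree (search k))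
    values-≡ = structure (vertexList-⟦⟧ (encodeℕ h) V′ E (encodeℕ k)) (edgeList-⟦⟧ (encodeℕ h) V′ E (encodeℕ k)) (number-⟦⟧ (encodeGraph G) (encodeℕ k))
      where
      searchFrom : (V E ids rest cols : Tree) → X
      searchFrom V E ids rest cols = F V E ids rest cols (⟦ search′ ⟧ (cols ∷ rest ∷ ids ∷ E ∷ V ∷ input ∷ []))
      Result : X → Set
      Result x = x ≡ F V′ E ids′ rest′ cols′ (encodeAll stateTree (search k))
      lists : ∀ {rest cols} → rest ≡ rest′ → cols ≡ cols′ → Result (searchFrom V′ E ids′ rest cols)
      lists refl refl = cong (F V′ E ids′ rest′ cols′) search-encode
      prefix : ∀ {ids} → ids ≡ ids′ → Result (searchFrom V′ E ids (⟦ number′ ⟧ (ids ∷ [])) (⟦ usedColors′ ⟧ (E ∷ [])))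
      prefix refl = lists (tail-encode encodeFin (firstIds k)) usedColors-encode
      structure : ∀ {V E₀ k₀} → V ≡ V′ → E₀ ≡ E → k₀ ≡ encodeℕ k →
          Result (searchFrom V E₀ (⟦ firstIds′ ⟧ (V ∷ k₀ ∷ [])) (⟦ number′ ⟧ (⟦ firstIds′ ⟧ (V ∷ k₀ ∷ []) ∷ [])) (⟦ usedColors′ ⟧ (E₀ ∷ [])))
      structure refl refl refl = prefix (firstIds-encode k)

  main-encode : ⟦ main′ ⟧ (input ∷ []) ≡ encodeAnswer (answer k)
  main-encode = trans (values-≡ (λ V _ _ _ _ sts → ⟦ answer′ ⟧ (V ∷ sts ∷ []))) (answer-encode (search k))

-- Cost as a polynomial in the largest tree size

opaque
  costBound : ∀ {r} → Exp true r → ℕ → ℕ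
  costBound {r} e z = (2 + r * z) ^ proj₁ (cost-poly e)

  costBound-poly : ∀ {r} (e : Exp true r) → Poly id (costBound e)
  costBound-poly {r} e = poly-∘^ (proj₁ (cost-poly e)) (poly-* (poly-const r) poly-measure)

  cost-≤ : ∀ {r} (e : Exp true r) {ρ z} → VAll.All (λ t → size t ≤ z) ρ → cost e ρ ≤ costBound e z
  cost-≤ {r} e {ρ} {z} small = ≤-trans (proj₂ (cost-poly e) ρ) (^-mono (proj₁ (cost-poly e)) (total small))
    where
    total : ∀ {r} {ρ : Vec Tree r} → VAll.All (λ t → size t ≤ z) ρ → ∥ ρ ∥ ≤ r * z
    total []       = z≤n
    total (p ∷ ps) = +-mono-≤ p (total ps)

-- The numerals are the costs of looking up variables and passing arguments.
expansionsBound roundBound searchBound mainBound : ℕ → ℕ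
expansionsBound z = suc (11 + ((6 + suc (33 + costBound startAll′ z)) + z * (15 + suc (33 + costBound expandAll′ z))))
roundBound z = suc (suc (13 + suc (3 + suc (expansionsBound z + 1))) + costBound finishAll′ z)
searchBound z = suc (5 + ((6 + suc (21 + costBound initial′ z)) + z * (15 + roundBound z)))
mainBound z =
  suc (suc (5 + costBound vertexList′ z) + (4 +
  suc (suc (7 + costBound edgeList′ z) + (4 +
  suc (suc (suc (5 + suc (suc (9 + costBound number′ z) + 1)) + costBound firstIds′ z) + (4 +
  suc (suc (5 + costBound number′ z) + (4 +
  suc (suc (9 + costBound usedColors′ z) + (4 +
  suc (searchBound z + (4 +
  suc (19 + costBound answer′ z)))))))))))))

mainBound-poly : Poly id mainBound
mainBound-poly =
  -- Numerals that are added in a row in the bounds are merged: 28 is 6 + 1 + 21, 40 is 6 + 1 + 33,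
  -- and 49 is 15 + 1 + 33.
  suc⁺ (poly-+ (+⁺ 6 (b vertexList′)) (+⁺ 4
  (suc⁺ (poly-+ (+⁺ 8 (b edgeList′)) (+⁺ 4
  (suc⁺ (poly-+ (suc⁺ (poly-+ (+⁺ 6 (suc⁺ (poly-+ (+⁺ 10 (b number′)) (poly-const 1)))) (b firstIds′))) (+⁺ 4
  (suc⁺ (poly-+ (+⁺ 6 (b number′)) (+⁺ 4
  (suc⁺ (poly-+ (+⁺ 10 (b usedColors′)) (+⁺ 4
  (suc⁺ (poly-+ (+⁺ 6 (poly-+ (+⁺ 28 (b initial′)) (poly-* poly-measure (+⁺ 15 round))))
  (+⁺ 4 (+⁺ 20 (b answer′)))))))))))))))))))
  where
  +⁺ : ∀ k {f : ℕ → ℕ} → Poly id f → Poly id (λ z → k + f z)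
  +⁺ k = poly-+ (poly-const k)
  suc⁺ : ∀ {f : ℕ → ℕ} → Poly id f → Poly id (λ z → suc (f z))
  suc⁺ = +⁺ 1
  b : ∀ {r} (e : Exp true r) → Poly id (costBound e)
  b = costBound-poly
  round : Poly id roundBound
  round = suc⁺ (poly-+ (+⁺ 14 (+⁺ 5 (poly-+ (+⁺ 12 (poly-+ (+⁺ 40 (b startAll′)) (poly-* poly-measure (+⁺ 49 (b expandAll′))))) (poly-const 1)))) (b finishAll′))

-- The number and the size of the states

-- The lists of vertices and of slots have at most n ≤ N entries, and an encoded vertex has size at
-- most N. The 3 counts the nodes that join the four components of a `ColorState`; a plain state
-- fits below the same bound.
listSize slotSize slotsSize stateSize : ℕ → ℕ
listSize N = 1 + N * (1 + N)
slotSize N = 1 + (N + listSize N)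
slotsSize N = 1 + N * (1 + slotSize N)
stateSize N = 3 + (listSize N + (listSize N + (listSize N + slotsSize N)))

module CostBound {h : ℕ} (G : EdgeColoredGraph h) (k : ℕ) where
  open EdgeColoredGraph G using (n)
  open Search G
  open Simulation G
  open Run G k
  open WithEquality (Fin._≟_ {n})
  open Color using (strip; candidates; length-candidates; length-strip)

  -- L bounds the number of states at any time, Z the size of every tree used.
  N κ m β L Z : ℕ
  N = size input
  κ = length rest
  m = length usedColors
  β = suc κ ^ 4
  L = (1 + n) * β ^ (m * κ)
  Z = N + (listSize N + (1 + L * (1 + stateSize N)))

  β-nonZero : NonZero β
  β-nonZero = >-nonZero (m^n>0 (suc κ) 4)

  1≤β^ : ∀ i → 1 ≤ β ^ i
  1≤β^ = m^n>0 β {{β-nonZero}}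

  V′≤N : size V′ ≤ N
  V′≤N = size-head V′ E (size-tail (encodeℕ h) (node V′ E) (size-head (encodeGraph G) (encodeℕ k) ≤-refl))

  E≤N : size E ≤ N
  E≤N = size-tail V′ E (size-tail (encodeℕ h) (node V′ E) (size-head (encodeGraph G) (encodeℕ k) ≤-refl))

  n≤N : n ≤ N
  n≤N = ≤-trans (≤-reflexive (sym (length-tabulate id))) (≤-trans (length≤size encodeFin (allFin n)) V′≤N)

  vertex≤N : ∀ (v : V) → size (encodeFin v) ≤ N
  vertex≤N v = ≤-trans (size-∈ encodeFin (∈-allFin v)) V′≤N

  color≤N : ∀ {c} → c ∈ usedColors → size (encodeFin c) ≤ N
  color≤N c∈ = ≤-trans (go (coloredEdges G) c∈) E≤N
    where
    go : ∀ es {c} → c ∈ foldr addColor [] es → size (encodeFin c) ≤ size (encodeAll edgeTree es)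
    go (e@(u , v , d) ∷ es) c∈ with any? (edgeColor e Fin.≟_) (foldr addColor [] es)
    go (e@(u , v , d) ∷ es) c∈          | yes _ = ≤-trans (go es c∈) (size-tail (edgeTree e) (encodeAll edgeTree es) ≤-refl)
    go (e@(u , v , d) ∷ es) (here refl) | no _  = size-tail (encodeFin v) (encodeFin d) (size-tail (encodeFin u) (node (encodeFin v) (encodeFin d))
      (size-head (edgeTree e) (encodeAll edgeTree es) ≤-refl))
    go (e@(u , v , d) ∷ es) (there c∈)  | no _  = ≤-trans (go es c∈) (size-tail (edgeTree e) (encodeAll edgeTree es) ≤-refl)

  m≤N : m ≤ N
  m≤N = ≤-trans (go (coloredEdges G)) (≤-trans (length≤size edgeTree (coloredEdges G)) E≤N)
    where
    go : ∀ es → length (foldr addColor [] es) ≤ length es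
    go [] = z≤n
    go (e ∷ es) with any? (edgeColor e Fin.≟_) (foldr addColor [] es)
    ... | yes _ = m≤n⇒m≤1+n (go es)
    ... | no _  = s≤s (go es)

  m≤h : m ≤ h
  m≤h = ≤-trans (WithEquality.length-⊆ Fin._≟_ usedColors-unique (λ _ → ∈-allFin _)) (≤-reflexive (length-tabulate {n = h} id))

  length-filter-allFin : ∀ {P : V → Set} (P? : Unary.Decidable P) → length (filter P? (allFin n)) ≤ n
  length-filter-allFin P? = ≤-trans (length-filter P? (allFin n)) (≤-reflexive (length-tabulate id))

  length-drop-1 : ∀ {A : Set} (xs : List A) → length (drop 1 xs) ≤ length xs
  length-drop-1 []      = z≤n
  length-drop-1 (_ ∷ _) = n≤1+n _

  κ≤n : κ ≤ n
  κ≤n = ≤-trans (length-drop-1 (firstIds k)) (length-filter-allFin (below? k))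

  Small : List Slot → Set
  Small slots = length slots ≤ n × All (λ (_ , D) → length D ≤ n) slots

  SmallState : State → Set
  SmallState (vs , slots) = length vs ≤ n × Small slots

  SmallColorState : ColorState → Set
  SmallColorState (vs , Y , pend , slots) = length vs ≤ n × length Y ≤ n × length pend ≤ κ × Small slots

  restrict-small : ∀ {i C slots} → Small slots → Small (restrict i C slots)
  restrict-small {i} {C} {slots} (len , all) = ≤-trans (≤-reflexive (length-map _ slots)) len , go slots all
    where
    go : ∀ slots → All (λ ((_ , D) : Slot) → length D ≤ n) slots → All (λ ((_ , D) : Slot) → length D ≤ n) (restrict i C slots)
    go [] [] = []
    go ((j , D) ∷ slots) (p ∷ ps) with j Fin.≟ i
    ... | yes _ = ≤-trans (length-filter (_∈? C) D) p ∷ go slots ps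
    ... | no _  = p ∷ go slots ps

  initial-small : ∀ ids → length (drop 1 ids) ≤ n → ∀ {st} → st ∈ initial ids → SmallState st
  initial-small [] _ (here refl) = z≤n , z≤n , []
  initial-small (_ ∷ ids) len st∈ with v , _ , refl ← ∈-map⁻ _ st∈ =
    ≤-trans (s≤s z≤n) (Fin.toℕ<n v) , ≤-trans (≤-reflexive (length-map _ ids)) len ,
    All.map⁺ (All.universal (λ _ → ≤-reflexive (length-tabulate id)) ids)

  length-initial : ∀ ids → length (initial ids) ≤ 1 + n
  length-initial []      = s≤s z≤n
  length-initial (_ ∷ _) = m≤n⇒m≤1+n (≤-reflexive (trans (length-map _ (allFin n)) (length-tabulate id)))

  start-small : ∀ st → SmallState st → SmallColorState (start rest st)
  start-small (vs , slots) (vs≤ , small) = vs≤ , length-filter-allFin (∉? vs) , ≤-refl , small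

  expand-small : ∀ c cst → SmallColorState cst → ∀ {cst′} → cst′ ∈ expand c cst → SmallColorState cst′
  expand-small c (vs , Y , pend , slots) small@(vs≤ , Y≤ , pend≤ , slots≤) cst′∈ with nonempty? (strip c Y)
  expand-small c (vs , Y , pend , slots) small (here refl) | no _ = small
  expand-small c (vs , Y , pend , slots) small@(vs≤ , Y≤ , pend≤ , slots≤) cst′∈ | yes _
    with C , _ , ∈C ← find (∈-concatMap⁻ (branch vs (strip c Y) pend slots) {xs = candidates c (strip c Y) pend} cst′∈)
    with i , _ , refl ← ∈-map⁻ _ ∈C =
    vs≤ , ≤-trans (length-filter (∉? C) (strip c Y)) (≤-trans (length-strip c {Y}) Y≤) ,
    ≤-trans (length-filter (≢? i) pend) pend≤ , restrict-small {i} {C} {slots} slots≤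

  -- The last steps compare coefficients: (1 + κ)^4 exceeds (1 + 4κ)κ by the polynomial that is
  -- added. The exponent 4 only affects the constant c, while the base 1 + κ is what can be bounded
  -- by k.
  length-expand : ∀ c cst → SmallColorState cst → length (expand c cst) ≤ β
  length-expand c (vs , Y , pend , slots) (_ , _ , pend≤ , _) with nonempty? (strip c Y)
  ... | no _  = m^n>0 (suc κ) 4
  ... | yes _ = begin
    length (concatMap (branch vs (strip c Y) pend slots) (candidates c (strip c Y) pend))
      ≤⟨ length-concatMap-≤ (branch vs (strip c Y) pend slots) (candidates c (strip c Y) pend)
           (λ {C} _ → ≤-trans (≤-reflexive (length-map (λ i → vs , strip c Y ∖∖ C , pend ∖ i , restrict i C slots) pend)) pend≤) ⟩
    length (candidates c (strip c Y) pend) * κ ≤⟨ *-monoˡ-≤ κ (length-candidates c {Y = strip c Y} {pend}) ⟩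
    (1 + 4 * length pend) * κ ≤⟨ *-monoˡ-≤ κ (s≤s (*-monoʳ-≤ 4 pend≤)) ⟩
    (1 + 4 * κ) * κ ≤⟨ m≤m+n _ _ ⟩
    (1 + 4 * κ) * κ + (1 + 3 * κ + 2 * κ ^ 2 + 4 * κ ^ 3 + κ ^ 4)
      ≡⟨ solve 1 (λ κ → (con 1 :+ con 4 :* κ) :* κ :+ (con 1 :+ con 3 :* κ :+ con 2 :* κ :^ 2 :+ con 4 :* κ :^ 3 :+ κ :^ 4) := (con 1 :+ κ) :^ 4) refl κ ⟩
    β ∎
    where
    open ≤-Reasoning
    open +-*-Solver

  finish-small : ∀ c cst → SmallColorState cst → ∀ {st} → st ∈ finish c cst → SmallState st
  finish-small c (vs , Y , pend , slots) (vs≤ , _ , _ , small) st∈ with nonempty? (strip c Y)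
  finish-small c (vs , Y , pend , slots) (vs≤ , _ , _ , small) (here refl) | no _ = vs≤ , small

  length-finish : ∀ c cst → length (finish c cst) ≤ 1
  length-finish c (vs , Y , pend , slots) with nonempty? (strip c Y)
  ... | yes _ = z≤n
  ... | no _  = ≤-refl

  States : ℕ → List State → Set
  States l sts = length sts ≤ l × (∀ {st} → st ∈ sts → SmallState st)

  ColorStates : ℕ → List ColorState → Set
  ColorStates l csts = length csts ≤ l × (∀ {cst} → cst ∈ csts → SmallColorState cst)

  expandAll-states : ∀ {c l csts} → ColorStates l csts → ColorStates (l * β) (concatMap (expand c) csts)
  expandAll-states {c} {l} {csts} (len , small) =
    ≤-trans (length-concatMap-≤ (expand c) csts (λ {cst} cst∈ → length-expand c cst (small cst∈))) (*-monoˡ-≤ β len) ,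
    λ cst′∈ → let cst , cst∈ , ∈cst = find (∈-concatMap⁻ (expand c) {xs = csts} cst′∈) in expand-small c cst (small cst∈) ∈cst

  startAll-states : ∀ {l sts} → States l sts → ColorStates l (map (start rest) sts)
  startAll-states {sts = sts} (len , small) = ≤-trans (≤-reflexive (length-map (start rest) sts)) len ,
    λ cst∈ → let st , st∈ , eq = ∈-map⁻ (start rest) cst∈ in subst SmallColorState (sym eq) (start-small st (small st∈))

  finishAll-states : ∀ {c l csts} → ColorStates l csts → States l (concatMap (finish c) csts)
  finishAll-states {c} {l} {csts} (len , small) =
    ≤-trans (length-concatMap-≤ (finish c) csts (λ {cst} _ → length-finish c cst)) (≤-trans (≤-reflexive (*-identityʳ _)) len) ,
    λ st∈ → let cst , cst∈ , ∈cst = find (∈-concatMap⁻ (finish c) {xs = csts} st∈) in finish-small c cst (small cst∈) ∈cst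

  ColorStates-step : ∀ {l j c csts} → ColorStates (l * β ^ j) csts → ColorStates (l * β ^ suc j) (concatMap (expand c) csts)
  ColorStates-step {l} {j} {c} {csts} p = subst (λ b → ColorStates b (concatMap (expand c) csts))
    (trans (*-assoc l (β ^ j) β) (cong (l *_) (*-comm (β ^ j) β))) (expandAll-states {csts = csts} p)

  expansions-states : ∀ {c l sts} → States l sts → ColorStates (l * β ^ κ) (expansions c rest sts)
  expansions-states {c} {l} {sts} p = fold-invariant (λ j → ColorStates (l * β ^ j)) rest
    (subst (λ b → ColorStates b (map (start rest) sts)) (sym (*-identityʳ l)) (startAll-states p))
    (λ {j} {_} {csts} _ → ColorStates-step {l} {j} {csts = csts})

  -- Each color has κ expansions. The factor 1 + n covers both the n guesses of the fixed vertex and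
  -- the single state that exists when there are no labels.
  RoundStates : ℕ → List State → Set
  RoundStates i = States ((1 + n) * β ^ (i * κ))

  round-states : ∀ {c i sts} → RoundStates i sts → RoundStates (suc i) (round rest c sts)
  round-states {c} {i} {sts} p = subst (λ b → States b (round rest c sts)) eq
    (finishAll-states {csts = expansions c rest sts} (expansions-states {c} {sts = sts} p))
    where
    eq : (1 + n) * β ^ (i * κ) * β ^ κ ≡ (1 + n) * β ^ (suc i * κ)
    eq = trans (*-assoc (1 + n) (β ^ (i * κ)) (β ^ κ)) (cong ((1 + n) *_)
      (trans (sym (^-distribˡ-+-* β (i * κ) κ)) (cong (β ^_) (+-comm (i * κ) κ))))

  initial-states : RoundStates 0 (initial (firstIds k))
  initial-states = ≤-trans (length-initial (firstIds k)) (≤-reflexive (sym (*-identityʳ (1 + n)))) ,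
    initial-small (firstIds k) κ≤n

  search-states : RoundStates m (search k)
  search-states = fold-invariant RoundStates usedColors initial-states (λ {i} {_} {sts} _ → round-states {i = i} {sts})

  level≤L : ∀ {i j} → i < m → j ≤ κ → (1 + n) * β ^ (i * κ) * β ^ j ≤ L
  level≤L {i} {j} i<m j≤κ = begin
    (1 + n) * β ^ (i * κ) * β ^ j ≡⟨ *-assoc (1 + n) (β ^ (i * κ)) (β ^ j) ⟩
    (1 + n) * (β ^ (i * κ) * β ^ j) ≡⟨ cong ((1 + n) *_) (^-distribˡ-+-* β (i * κ) j) ⟨
    (1 + n) * β ^ (i * κ + j) ≤⟨ *-monoʳ-≤ (1 + n) (^-monoʳ-≤ β {{β-nonZero}} exponent) ⟩
    L ∎
    where
    open ≤-Reasoning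
    exponent : i * κ + j ≤ m * κ
    exponent = begin
      i * κ + j ≤⟨ +-monoʳ-≤ (i * κ) j≤κ ⟩
      i * κ + κ ≡⟨ +-comm (i * κ) κ ⟩
      suc i * κ ≤⟨ *-monoˡ-≤ κ i<m ⟩
      m * κ ∎

  vertices-size : ∀ vs → length vs ≤ n → size (vertices vs) ≤ listSize N
  vertices-size vs len = size-encodeAll encodeFin vs (λ {v} _ → vertex≤N v) (≤-trans len n≤N)

  slots-size : ∀ slots → Small slots → size (slotsTree slots) ≤ slotsSize N
  slots-size slots (len , all) = size-encodeAll slotTree slots
    (λ { {i , D} slot∈ → s≤s (+-mono-≤ (vertex≤N i) (vertices-size D (All.lookup all slot∈))) }) (≤-trans len n≤N)

  colorState-size : ∀ cst → SmallColorState cst → size (cstateTree cst) ≤ stateSize N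
  colorState-size (vs , Y , pend , slots) (vs≤ , Y≤ , pend≤ , small) = begin
    suc (size (vertices vs) + suc (size (vertices Y) + suc (size (vertices pend) + size (slotsTree slots))))
      ≤⟨ s≤s (+-mono-≤ (vertices-size vs vs≤) (s≤s (+-mono-≤ (vertices-size Y Y≤) (s≤s (+-mono-≤ (vertices-size pend (≤-trans pend≤ κ≤n)) (slots-size slots small)))))) ⟩
    suc (A + suc (A + suc (A + B)))
      ≡⟨ solve 2 (λ a b → con 1 :+ (a :+ (con 1 :+ (a :+ (con 1 :+ (a :+ b))))) := con 3 :+ (a :+ (a :+ (a :+ b)))) refl A B ⟩
    stateSize N ∎
    where
    open ≤-Reasoning
    open +-*-Solver
    A = listSize N
    B = slotsSize N

  state-size : ∀ st → SmallState st → size (stateTree st) ≤ stateSize N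
  state-size (vs , slots) (vs≤ , small) = ≤-trans (s≤s (+-mono-≤ (vertices-size vs vs≤) (slots-size slots small)))
    (≤-trans (s≤s (+-monoʳ-≤ A (≤-trans (m≤n+m B A) (m≤n+m (A + B) A)))) (m≤n+m _ 2))
    where
    A = listSize N
    B = slotsSize N

  N≤Z : N ≤ Z
  N≤Z = m≤m+n N _

  vertexList≤Z : listSize N ≤ Z
  vertexList≤Z = ≤-trans (m≤m+n (listSize N) _) (m≤n+m _ N)

  states≤Z : ∀ {l sts} → l ≤ L → States l sts → size (encodeAll stateTree sts) ≤ Z
  states≤Z {sts = sts} l≤L (len , small) = ≤-trans (size-encodeAll stateTree sts (λ {st} st∈ → state-size st (small st∈)) (≤-trans len l≤L))
    (≤-trans (m≤n+m _ (listSize N)) (m≤n+m _ N))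

  colorStates≤Z : ∀ {l csts} → l ≤ L → ColorStates l csts → size (encodeAll cstateTree csts) ≤ Z
  colorStates≤Z {csts = csts} l≤L (len , small) = ≤-trans (size-encodeAll cstateTree csts (λ {cst} cst∈ → colorState-size cst (small cst∈)) (≤-trans len l≤L))
    (≤-trans (m≤n+m _ (listSize N)) (m≤n+m _ N))

  V′≤Z : size V′ ≤ Z
  V′≤Z = ≤-trans V′≤N N≤Z

  E≤Z : size E ≤ Z
  E≤Z = ≤-trans E≤N N≤Z

  ids′≤Z : size ids′ ≤ Z
  ids′≤Z = ≤-trans (vertices-size (firstIds k) (length-filter-allFin (below? k))) vertexList≤Z

  rest′≤Z : size rest′ ≤ Z
  rest′≤Z = ≤-trans (vertices-size rest κ≤n) vertexList≤Z

  κ≤Z : κ ≤ Z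
  κ≤Z = ≤-trans κ≤n (≤-trans n≤N N≤Z)

  roundStates≤Z : ∀ {i sts} → i ≤ m → RoundStates i sts → size (encodeAll stateTree sts) ≤ Z
  roundStates≤Z i≤m = states≤Z (*-monoʳ-≤ (1 + n) (^-monoʳ-≤ β {{β-nonZero}} (*-monoˡ-≤ κ i≤m)))

  expansions-cost : ∀ {c i sts} → c ∈ usedColors → i < m → RoundStates i sts → cost expansions′ (env₈ c sts) ≤ expansionsBound Z
  expansions-cost {c} {i} {sts} c∈ i<m p = s≤s (+-monoʳ-≤ 11 (subst (λ z → foldCost step z stepCost startCost rest′ ≤ (6 + suc (33 + costBound startAll′ Z)) + Z * (15 + suc (33 + costBound expandAll′ Z))) (sym (startAll-encode sts)) (≤-trans
    (foldCost-encode encodeFin (encodeAll cstateTree) step (λ _ → concatMap (expand c)) (λ _ → expandAll-encode c)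
      {stepCost} {startCost} {suc (33 + costBound expandAll′ Z)}
      (λ j → ColorStates ((1 + n) * β ^ (i * κ) * β ^ j)) rest
      (subst (λ b → ColorStates b (map (start rest) sts)) (sym (*-identityʳ _)) (startAll-states p))
      (λ {j} {_} {csts} _ → ColorStates-step {(1 + n) * β ^ (i * κ)} {j} {csts = csts})
      (λ {j} {_} {csts} _ j<κ q → s≤s (+-monoʳ-≤ 33 (cost-≤ expandAll′ (E≤Z ∷ color≤Z ∷ colorStates≤Z {csts = csts} (level≤L i<m (<⇒≤ j<κ)) q ∷ [])))))
    (+-mono-≤ (+-monoʳ-≤ 6 (s≤s (+-monoʳ-≤ 33 (cost-≤ startAll′ (V′≤Z ∷ rest′≤Z ∷ roundStates≤Z {sts = sts} (<⇒≤ i<m) p ∷ [])))))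
      (*-monoˡ-≤ _ κ≤Z)))))
    where
    color≤Z = ≤-trans (color≤N c∈) N≤Z
    step : Tree → Tree → Tree
    step _ a = ⟦ expandAll′ ⟧ (E ∷ encodeFin c ∷ a ∷ [])
    stepCost : Tree → Tree → ℕ
    stepCost _ a = suc (33 + cost expandAll′ (E ∷ encodeFin c ∷ a ∷ []))
    startCost : ℕ
    startCost = suc (33 + cost startAll′ (V′ ∷ rest′ ∷ encodeAll stateTree sts ∷ []))

  round-cost : ∀ {c i sts} → c ∈ usedColors → i < m → RoundStates i sts → cost round′ (env₈ c sts) ≤ roundBound Z
  round-cost {c} {i} {sts} c∈ i<m p = s≤s (+-mono-≤ (s≤s (+-monoʳ-≤ 13 (s≤s (+-monoʳ-≤ 3 (s≤s (+-monoˡ-≤ 1 (expansions-cost c∈ i<m p)))))))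
    (cost-≤ finishAll′ (E≤Z ∷ ≤-trans (color≤N c∈) N≤Z ∷
      subst (λ t → size t ≤ Z) (sym (expansions-encode c sts))
        (colorStates≤Z {csts = expansions c rest sts} (level≤L i<m ≤-refl) (expansions-states {c} {sts = sts} p)) ∷ [])))

  search-cost : cost search′ env₆ ≤ searchBound Z
  search-cost = s≤s (+-monoʳ-≤ 5 (subst (λ z → foldCost step z stepCost startCost cols′ ≤ (6 + suc (21 + costBound initial′ Z)) + Z * (15 + roundBound Z)) (sym (initial-encode (firstIds k))) (≤-trans
    (foldCost-encode encodeFin (encodeAll stateTree) step (round rest) round-encode {stepCost} {startCost} {roundBound Z} RoundStates usedColors initial-states
      (λ {i} {_} {sts} _ → round-states {i = i} {sts}) (λ {i} {_} {sts} → round-cost {i = i} {sts}))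
    (+-mono-≤ (+-monoʳ-≤ 6 (s≤s (+-monoʳ-≤ 21 (cost-≤ initial′ (V′≤Z ∷ ids′≤Z ∷ [])))))
      (*-monoˡ-≤ _ (≤-trans m≤N N≤Z))))))
    where
    step : Tree → Tree → Tree
    step c a = ⟦ round′ ⟧ (c ∷ a ∷ env₆)
    stepCost : Tree → Tree → ℕ
    stepCost c a = cost round′ (c ∷ a ∷ env₆)
    startCost : ℕ
    startCost = suc (21 + cost initial′ (V′ ∷ ids′ ∷ []))

  main-cost : cost main′ (input ∷ []) ≤ mainBound Z
  main-cost = begin
    cost main′ (input ∷ []) ≡⟨ values-≡ total ⟩
    total V′ E ids′ rest′ cols′ (encodeAll stateTree (search k))
      ≤⟨ s≤s (+-mono-≤ (s≤s (+-monoʳ-≤ 5 (cost-≤ vertexList′ (N≤Z ∷ [])))) (+-monoʳ-≤ 4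
         (s≤s (+-mono-≤ (s≤s (+-monoʳ-≤ 7 (cost-≤ edgeList′ (N≤Z ∷ [])))) (+-monoʳ-≤ 4
         (s≤s (+-mono-≤ (s≤s (+-mono-≤ (s≤s (+-monoʳ-≤ 5 (s≤s (+-monoˡ-≤ 1 (s≤s (+-monoʳ-≤ 9 (cost-≤ number′ (N≤Z ∷ []))))))))
                          (cost-≤ firstIds′ (V′≤Z ∷ number≤Z ∷ [])))) (+-monoʳ-≤ 4
         (s≤s (+-mono-≤ (s≤s (+-monoʳ-≤ 5 (cost-≤ number′ (ids′≤Z ∷ [])))) (+-monoʳ-≤ 4
         (s≤s (+-mono-≤ (s≤s (+-monoʳ-≤ 9 (cost-≤ usedColors′ (E≤Z ∷ [])))) (+-monoʳ-≤ 4
         (s≤s (+-mono-≤ search-cost (+-monoʳ-≤ 4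
         (s≤s (+-monoʳ-≤ 19 (cost-≤ answer′ (V′≤Z ∷ roundStates≤Z {sts = search k} ≤-refl search-states ∷ []))))))))))))))))))))) ⟩
    mainBound Z ∎
    where
    open ≤-Reasoning
    number≤Z : size (⟦ number′ ⟧ (input ∷ [])) ≤ Z
    number≤Z = subst (λ t → size t ≤ Z) (sym (number-⟦⟧ (encodeGraph G) (encodeℕ k))) (≤-trans (size-tail (encodeGraph G) (encodeℕ k) ≤-refl) N≤Z)
    total : (V E ids rest cols sts : Tree) → ℕ
    total V E ids rest cols sts =
      suc (suc (5 + cost vertexList′ (input ∷ [])) + (4 +
      suc (suc (7 + cost edgeList′ (input ∷ [])) + (4 +
      suc (suc (suc (5 + suc (suc (9 + cost number′ (input ∷ [])) + 1)) + cost firstIds′ (V ∷ ⟦ number′ ⟧ (input ∷ []) ∷ [])) + (4 +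
      suc (suc (5 + cost number′ (ids ∷ [])) + (4 +
      suc (suc (9 + cost usedColors′ (E ∷ [])) + (4 +
      suc (cost search′ (cols ∷ rest ∷ ids ∷ E ∷ V ∷ input ∷ []) + (4 +
      suc (19 + cost answer′ (V ∷ sts ∷ []))))))))))))))

-- From the state count to the time bound

n<2^[1+⌊log₂n⌋] : ∀ n → n < 2 ^ suc ⌊log₂ n ⌋
n<2^[1+⌊log₂n⌋] n = ≰⇒> λ 2^≤n → <-irrefl refl
  (≤-trans (≤-reflexive (sym (⌊log₂[2^n]⌋≡n (suc ⌊log₂ n ⌋)))) (⌊log₂⌋-mono-≤ 2^≤n))

-- `Z` is linear in the state count `W`. Since `W` is at least 1 it can be factored out of the terms
-- without it as well, and `headroom` is what remains.
headroom : ℕ → ℕ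
headroom N = 3 + N + listSize N + (1 + N) * (1 + stateSize N)

opaque
  time-poly : Poly id (λ z → 4 + mainBound z)
  time-poly = poly-+ (poly-const 4) mainBound-poly

  headroom-poly : Poly id headroom
  headroom-poly = poly-+ (poly-+ (poly-+ (poly-const 3) poly-measure) vl) (poly-* (1+ poly-measure) (1+ st))
    where
    1+_ : ∀ {f : ℕ → ℕ} → Poly id f → Poly id (λ x → 1 + f x)
    1+_ = poly-+ (poly-const 1)
    list : ∀ {f : ℕ → ℕ} → Poly id f → Poly id (λ x → 1 + x * (1 + f x))
    list p = 1+ poly-* poly-measure (1+ p)
    vl : Poly id listSize
    vl = list poly-measure
    st : Poly id stateSize
    st = poly-+ (poly-const 3) (poly-+ vl (poly-+ vl (poly-+ vl (list (1+ poly-+ poly-measure vl)))))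

module TimeBound {h : ℕ} (G : EdgeColoredGraph h) (k : ℕ) where
  open EdgeColoredGraph G using (n)
  open Search G
  open Run G k
  open CostBound G k

  W : ℕ
  W = β ^ (m * κ)

  Z-≤ : 2 + Z ≤ W * headroom N
  Z-≤ = begin
    2 + (N + (listSize N + (1 + (1 + n) * W * (1 + stateSize N))))
      ≡⟨ solve 4 (λ x y w s → con 2 :+ (x :+ (y :+ (con 1 :+ s))) := (con 3 :+ x :+ y) :+ s) refl N (listSize N) W ((1 + n) * W * (1 + stateSize N)) ⟩
    (3 + N + listSize N) + (1 + n) * W * (1 + stateSize N)
      ≤⟨ +-mono-≤ (≤-trans (≤-reflexive (sym (*-identityˡ (3 + N + listSize N)))) (*-monoˡ-≤ (3 + N + listSize N) (1≤β^ (m * κ))))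
           (*-monoˡ-≤ (1 + stateSize N) (*-monoˡ-≤ W (s≤s n≤N))) ⟩
    W * (3 + N + listSize N) + (1 + N) * W * (1 + stateSize N)
      ≡⟨ solve 4 (λ x y w s → w :* x :+ y :* w :* s := w :* (x :+ y :* s)) refl (3 + N + listSize N) (1 + N) W (1 + stateSize N) ⟩
    W * headroom N ∎
    where
    open ≤-Reasoning
    open +-*-Solver

  l : ℕ
  l = hklogk h k

  -- Rounding the logarithm down loses a factor of at most 2, which the fourth power turns into the
  -- constant 16.
  ^4-≤ : ∀ x → x ^ 4 ≤ (2 * 2 ^ ⌊log₂ x ⌋) ^ 4
  ^4-≤ x = ^-monoˡ-≤ 4 (<⇒≤ (n<2^[1+⌊log₂n⌋] x))

  16*16^l : (2 * 2 ^ l) ^ 4 ≡ 16 * 16 ^ l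
  16*16^l = begin
    (2 * 2 ^ l) ^ 4 ≡⟨ ^-*-assoc 2 (suc l) 4 ⟩
    2 ^ (suc l * 4) ≡⟨ cong (2 ^_) (*-comm (suc l) 4) ⟩
    2 ^ (4 * suc l) ≡⟨ ^-*-assoc 2 4 (suc l) ⟨
    16 * 16 ^ l ∎
    where open ≡-Reasoning

  -- Without labels κ is 0 and `W` is 1. Otherwise the guessed vertex occupies one of at most k
  -- labels, so 1 + κ ≤ k, and `W` is at most the fourth power of k^(hk), whose logarithm `l`
  -- rounds.
  W-≤ : W ≤ 16 * 16 ^ l
  W-≤ with κ | inspect-κ
    where
    inspect-κ : κ ≡ 0 ⊎ suc κ ≤ k
    inspect-κ with firstIds k | length-firstIds k
    ... | []     | _  = inj₁ refl
    ... | _ ∷ vs | le = inj₂ le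
  ... | κ | inj₁ refl = ≤-trans (≤-reflexive (cong ((1 ^ 4) ^_) (*-zeroʳ m))) (*-mono-≤ {1} {16} (s≤s z≤n) (m^n>0 16 l))
  ... | κ | inj₂ κ<k = begin
    (suc κ ^ 4) ^ (m * κ) ≤⟨ ^-monoˡ-≤ (m * κ) (^-monoˡ-≤ 4 κ<k) ⟩
    (k ^ 4) ^ (m * κ) ≤⟨ ^-monoʳ-≤ (k ^ 4) {{>-nonZero (m^n>0 k {{>-nonZero (≤-trans (s≤s z≤n) κ<k)}} 4)}} (*-mono-≤ m≤h (<⇒≤ κ<k)) ⟩
    (k ^ 4) ^ (h * k) ≡⟨ ^-*-assoc k 4 (h * k) ⟩
    k ^ (4 * (h * k)) ≡⟨ cong (k ^_) (*-comm 4 (h * k)) ⟩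
    k ^ (h * k * 4) ≡⟨ ^-*-assoc k (h * k) 4 ⟨
    (k ^ (h * k)) ^ 4 ≤⟨ ^4-≤ (k ^ (h * k)) ⟩
    (2 * 2 ^ l) ^ 4 ≡⟨ 16*16^l ⟩
    16 * 16 ^ l ∎
    where open ≤-Reasoning

  -- A running time of degree p in `Z` raises `W` to the power p, and this is where the base 16 ^ p
  -- comes from. As an input has size at least 1, 2 + N ≤ 3N turns the polynomial into a constant
  -- times a pure power of N.
  time-≤ : ∀ p q → headroom N ≤ (2 + N) ^ q → (2 + Z) ^ p ≤ 3 ^ (q * p) * 16 ^ p * N ^ (q * p) * (16 ^ p) ^ l
  time-≤ p q headroom≤ = begin
    (2 + Z) ^ p ≤⟨ ^-monoˡ-≤ p (≤-trans Z-≤ (*-mono-≤ W-≤ headroom≤)) ⟩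
    (16 * 16 ^ l * (2 + N) ^ q) ^ p ≤⟨ ^-monoˡ-≤ p (*-monoʳ-≤ (16 * 16 ^ l) (^-monoˡ-≤ q 2+N≤3N)) ⟩
    (16 * 16 ^ l * (3 * N) ^ q) ^ p ≡⟨ ^-distribʳ-* p (16 * 16 ^ l) ((3 * N) ^ q) ⟩
    (16 * 16 ^ l) ^ p * ((3 * N) ^ q) ^ p ≡⟨ cong₂ _*_ (^-distribʳ-* p 16 (16 ^ l)) (^-*-assoc (3 * N) q p) ⟩
    16 ^ p * (16 ^ l) ^ p * (3 * N) ^ (q * p) ≡⟨ cong₂ (λ x y → 16 ^ p * x * y) swap (^-distribʳ-* (q * p) 3 N) ⟩
    16 ^ p * (16 ^ p) ^ l * (3 ^ (q * p) * N ^ (q * p))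
      ≡⟨ solve 4 (λ a b c d → a :* b :* (c :* d) := c :* a :* d :* b) refl (16 ^ p) ((16 ^ p) ^ l) (3 ^ (q * p)) (N ^ (q * p)) ⟩
    3 ^ (q * p) * 16 ^ p * N ^ (q * p) * (16 ^ p) ^ l ∎
    where
    open ≤-Reasoning
    open +-*-Solver
    2+N≤3N : 2 + N ≤ 3 * N
    2+N≤3N = ≤-trans (+-monoˡ-≤ N (*-monoʳ-≤ 2 (1≤size input))) (≤-reflexive (solve 1 (λ x → con 2 :* x :+ x := con 3 :* x) refl N))
    swap : (16 ^ l) ^ p ≡ (16 ^ p) ^ l
    swap = trans (^-*-assoc 16 l p) (trans (cong (16 ^_) (*-comm l p)) (sym (^-*-assoc 16 p l)))
    ^-distribʳ-* : ∀ p x y → (x * y) ^ p ≡ x ^ p * y ^ p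
    ^-distribʳ-* zero    x y = refl
    ^-distribʳ-* (suc p) x y = trans (cong (x * y *_) (^-distribʳ-* p x y))
      (solve 4 (λ a b c d → a :* b :* (c :* d) := a :* c :* (b :* d)) refl x y (x ^ p) (y ^ p))

theorem2 : ∃[ c ] ∃[ P ] ∃[ a ] ∃[ b ]
    ((h : ℕ) (G : EdgeColoredGraph h) (k : ℕ) →
    ∃[ answer ] ∃[ t ]
    ( Runs P (encodeInstance G k) (encodeAnswer answer) t
    × CorrectAnswer G k answer
    × t ≤ a * size (encodeInstance G k) ^ b * c ^ hklogk h k ))
theorem2 = 16 ^ p , program main′ , 3 ^ (q * p) * 16 ^ p , q * p , λ h G k →
  Search.answer G k , 4 + cost main′ (encodeInstance G k ∷ []) ,
  subst (λ y → Runs (program main′) (encodeInstance G k) y (4 + cost main′ (encodeInstance G k ∷ []))) (Run.main-encode G k)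
    (program-runs main′ (encodeInstance G k)) ,
  Search.answer-correct G k ,
  ≤-trans (+-monoʳ-≤ 4 (CostBound.main-cost G k))
    (≤-trans (proj₂ time-poly (CostBound.Z G k)) (TimeBound.time-≤ G k p q (proj₂ headroom-poly (CostBound.N G k))))
  where
  p = proj₁ time-poly
  q = proj₁ headroom-poly
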